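{- For every $n\ge1$ and every $0<\varepsilon\le 1$, given an input DAG on $n$ vertices and $m$ arcs with nonnegative integer arc weights, two vertices $s$ and $t$ of it, and a capacity $C$, one can (deterministically) compute a $1-\varepsilon$ approximation of the number $N$ of $s,t$-paths of total weight at most $C$, that is, a number $Z$ with $(1-\varepsilon)N\le Z\le N$, in time $$O\!\left(m\,n^2\log\!\left(\tfrac{m}{n}\right)\varepsilon^{ -1}\left\lceil\frac{\log(1/\varepsilon)}{\log n}\right\rceil\right),$$ assuming unit cost additions and comparisons on numbers with $O(\log C)$ bits.
   Context: A DAG is a finite directed graph without directed cycles. An $s,t$-path is a directed path from $s$ to $t$; its total weight is the sum of the weights of its arcs. The capacity $C$ is a nonnegative integer. Logarithms are base 2.
   Formalization: The factors log(m/n) and ⌈log(1/ε)/log n⌉ are read as at least 1 (with log base 2 for n=1) and 1 is added to the bound for m=0, since as written it is 0, negative or undefined for m≤n, ε=1 or n=1; ε is rational, from which real ε follows. -}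

module Defs where

open import Data.Bool using (if_then_else_)
open import Data.Fin using (Fin; toℕ; fromℕ<)
open import Data.Integer using (+_; ∣_∣)
open import Data.Nat
open import Data.Nat.DivMod using (_/_)
open import Data.Nat.Logarithm using (⌊log₂_⌋; ⌈log₂_⌉)
open import Data.Nat.Properties
open import Data.Product using (Σ-syntax; _×_; _,_)
open import Data.Rational as ℚ using (ℚ; 1ℚ; 1/_)
open import Data.Rational.Properties using (pos⇒nonZero)
open import Relation.Binary.Construct.Closure.ReflexiveTransitive using (Star; fold)
open import Relation.Binary.Construct.Closure.Transitive using (TransClosure)
open import Relation.Binary.PropositionalEquality using (_≡_; refl; sym; cong)
open import Relation.Nullary using (¬_; yes; no)

record Digraph (n m : ℕ) : Set where
  field
    src tgt : Fin m → Fin n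
    weight  : Fin m → ℕ
    simple  : ∀ {e f} → src e ≡ src f → tgt e ≡ tgt f → e ≡ f

  Arc : Fin n → Fin n → Set
  Arc u v = Σ[ e ∈ Fin m ] (src e ≡ u × tgt e ≡ v)

  -- Without directed cycles a walk cannot repeat a vertex, so in a DAG
  -- these are exactly the directed paths.
  Path : Fin n → Fin n → Set
  Path = Star Arc

  totalWeight : ∀ {u v} → Path u v → ℕ
  totalWeight = fold (λ _ _ → ℕ) (λ { (e , _) W → weight e + W }) 0

  PathWithin : Fin n → Fin n → ℕ → Set
  PathWithin s t C = Σ[ p ∈ Path s t ] totalWeight p ≤ C

record DAG (n m : ℕ) : Set where
  field
    digraph : Digraph n m
  open Digraph digraph public
  field
    acyclic : ∀ v → ¬ TransClosure Arc v v

Var Array : Set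
Var   = ℕ
Array = ℕ

data Operand : Set where
  lit  : ℕ → Operand
  reg  : Var → Operand
  cell : Array → Var → Operand

infix 6 _⊕_ _⊖_ _≪_ _≫_
data Expr : Set where
  val             : Operand → Expr
  _⊕_ _⊖_ _≪_ _≫_ : Operand → Operand → Expr

infix 6 _≤'_ _<'_
data Test : Set where
  _≤'_ _<'_ : Operand → Operand → Test

infix  5 _≔_ _[_]≔_
infixr 4 _⨾_
infix  5 IF_THEN_ELSE_ WHILE_DO_
data Program : Set where
  skip          : Program
  _≔_           : Var → Expr → Program
  _[_]≔_        : Array → Var → Expr → Program
  _⨾_           : Program → Program → Program
  IF_THEN_ELSE_ : Test → Program → Program → Program
  WHILE_DO_     : Test → Program → Program

record State : Set where
  constructor state
  field
    regs : Var → ℕ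
    mem  : Array → ℕ → ℕ
open State public

_[_↦_] : {A : Set} → (ℕ → A) → ℕ → A → ℕ → A
(f [ x ↦ a ]) y = if y ≡ᵇ x then a else f y

setReg : Var → ℕ → State → State
setReg x a (state r h) = state (r [ x ↦ a ]) h

setCell : Array → ℕ → ℕ → State → State
setCell b i a (state r h) = state r (h [ b ↦ h b [ i ↦ a ] ])

⟦_⟧ₒ : Operand → State → ℕ
⟦ lit k    ⟧ₒ σ = k
⟦ reg x    ⟧ₒ σ = regs σ x
⟦ cell a x ⟧ₒ σ = mem σ a (regs σ x)

⟦_⟧ₑ : Expr → State → ℕ
⟦ val p ⟧ₑ σ = ⟦ p ⟧ₒ σ
⟦ p ⊕ q ⟧ₑ σ = ⟦ p ⟧ₒ σ + ⟦ q ⟧ₒ σ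
⟦ p ⊖ q ⟧ₑ σ = ⟦ p ⟧ₒ σ ∸ ⟦ q ⟧ₒ σ
⟦ p ≪ q ⟧ₑ σ = ⟦ p ⟧ₒ σ * 2 ^ ⟦ q ⟧ₒ σ
⟦ p ≫ q ⟧ₑ σ = _/_ (⟦ p ⟧ₒ σ) (2 ^ ⟦ q ⟧ₒ σ) {{m^n≢0 2 (⟦ q ⟧ₒ σ)}}

True False : Test → State → Set
True  (p ≤' q) σ = ⟦ p ⟧ₒ σ ≤ ⟦ q ⟧ₒ σ
True  (p <' q) σ = ⟦ p ⟧ₒ σ < ⟦ q ⟧ₒ σ
False b σ = ¬ True b σ

-- Number of binary digits.
bits : ℕ → ℕ
bits x = ⌈log₂ suc x ⌉

-- Time for an elementary operation on x when Θ(w) bits are handled at unit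
-- cost; a longer number is handled piece by piece.
opTime : (w x : ℕ) → ℕ
opTime w x = 1 + bits x / suc w

-- Machine words have Θ(log n) bits.  In addition, numbers of O(log C) bits
-- are added, subtracted, compared and copied at unit cost; addressing and
-- shifting do not enjoy this.
module Timed (n C : ℕ) where

  wordTime numberTime : ℕ → ℕ
  wordTime   = opTime ⌊log₂ n ⌋
  numberTime = opTime (⌊log₂ n ⌋ + ⌊log₂ C ⌋)

  fetchTime : Operand → State → ℕ
  fetchTime (lit k)    σ = 0
  fetchTime (reg x)    σ = 0
  fetchTime (cell a x) σ = wordTime (regs σ x)

  exprTime : Expr → State → ℕ
  exprTime (val p) σ = fetchTime p σ + numberTime (⟦ p ⟧ₒ σ)
  exprTime (p ⊕ q) σ =
    fetchTime p σ + fetchTime q σ + numberTime (⟦ p ⟧ₒ σ + ⟦ q ⟧ₒ σ)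
  exprTime (p ⊖ q) σ =
    fetchTime p σ + fetchTime q σ + numberTime (⟦ p ⟧ₒ σ ⊔ ⟦ q ⟧ₒ σ)
  exprTime (p ≪ q) σ =
    fetchTime p σ + fetchTime q σ +
    wordTime (⟦ q ⟧ₒ σ) + wordTime (⟦ p ≪ q ⟧ₑ σ)
  exprTime (p ≫ q) σ =
    fetchTime p σ + fetchTime q σ +
    wordTime (⟦ q ⟧ₒ σ) + wordTime (⟦ p ⟧ₒ σ)

  -- A comparison is over once the shorter number is exhausted.  Hence an
  -- input weight that is huge compared to C can be recognised as such
  -- without paying for its length.
  testTime : Test → State → ℕ
  testTime (p ≤' q) σ =
    fetchTime p σ + fetchTime q σ + numberTime (⟦ p ⟧ₒ σ ⊓ ⟦ q ⟧ₒ σ)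
  testTime (p <' q) σ =
    fetchTime p σ + fetchTime q σ + numberTime (⟦ p ⟧ₒ σ ⊓ ⟦ q ⟧ₒ σ)

  -- ⟨ P , σ ⟩⇓⟨ τ , T ⟩: started in σ, P halts in τ after time T.
  infix 3 ⟨_,_⟩⇓⟨_,_⟩
  data ⟨_,_⟩⇓⟨_,_⟩ : Program → State → State → ℕ → Set where
    skip   : ∀ {σ} → ⟨ skip , σ ⟩⇓⟨ σ , 1 ⟩
    assign : ∀ {σ x e} →
             ⟨ x ≔ e , σ ⟩⇓⟨ setReg x (⟦ e ⟧ₑ σ) σ , exprTime e σ ⟩
    store  : ∀ {σ a x e} →
             ⟨ a [ x ]≔ e , σ ⟩⇓⟨ setCell a (regs σ x) (⟦ e ⟧ₑ σ) σ
                                , wordTime (regs σ x) + exprTime e σ ⟩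
    seq    : ∀ {σ τ υ P Q T U} →
             ⟨ P , σ ⟩⇓⟨ τ , T ⟩ → ⟨ Q , τ ⟩⇓⟨ υ , U ⟩ →
             ⟨ P ⨾ Q , σ ⟩⇓⟨ υ , T + U ⟩
    ifTrue : ∀ {σ τ b P Q T} →
             True b σ → ⟨ P , σ ⟩⇓⟨ τ , T ⟩ →
             ⟨ IF b THEN P ELSE Q , σ ⟩⇓⟨ τ , testTime b σ + T ⟩
    ifFalse : ∀ {σ τ b P Q T} →
             False b σ → ⟨ Q , σ ⟩⇓⟨ τ , T ⟩ →
             ⟨ IF b THEN P ELSE Q , σ ⟩⇓⟨ τ , testTime b σ + T ⟩
    whileTrue : ∀ {σ τ υ b P T U} →
             True b σ → ⟨ P , σ ⟩⇓⟨ τ , T ⟩ → ⟨ WHILE b DO P , τ ⟩⇓⟨ υ , U ⟩ →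
             ⟨ WHILE b DO P , σ ⟩⇓⟨ υ , testTime b σ + (T + U) ⟩
    whileFalse : ∀ {σ b P} →
             False b σ → ⟨ WHILE b DO P , σ ⟩⇓⟨ σ , testTime b σ ⟩

open Timed public using () renaming (⟨_,_⟩⇓⟨_,_⟩ to Runs)

-- ⌈ 1/ε ⌉.  This is all the machine is told about ε: an arbitrary ε ∈ (0,1]
-- has no description whose length is bounded in terms of 1/ε.
⌈1/_⌉ : (ε : ℚ) .{{_ : ℚ.Positive ε}} → ℕ
⌈1/ ε ⌉ = ∣ ℚ.ceiling ((1/ ε) {{pos⇒nonZero ε}}) ∣

entries : ∀ {m} → (Fin m → ℕ) → ℕ → ℕ
entries {m} f i with i <? m
... | yes i<m = f (fromℕ< i<m)
... | no  _   = 0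

module _ {n m} (G : DAG n m) (s t : Fin n) (C : ℕ)
         (ε : ℚ) .{{_ : ℚ.Positive ε}} where
  open DAG G

  inputRegs : Var → ℕ
  inputRegs 0 = n
  inputRegs 1 = m
  inputRegs 2 = toℕ s
  inputRegs 3 = toℕ t
  inputRegs 4 = C
  inputRegs 5 = ⌈1/ ε ⌉
  inputRegs _ = 0

  inputMem : Array → ℕ → ℕ
  inputMem 0 = entries (λ e → toℕ (src e))
  inputMem 1 = entries (λ e → toℕ (tgt e))
  inputMem 2 = entries weight
  inputMem _ = λ _ → 0

  input : State
  input = state inputRegs inputMem

output : State → ℕ
output σ = regs σ 0

-- Least k with x ≤ b ^ k, for b ≥ 2.
⌈log[_]_⌉ : (b x : ℕ) → ℕ
⌈log[ b ] x ⌉ = search x 0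
  module CeilLog where
  search : (fuel k : ℕ) → ℕ
  search zero       k = k
  search (suc fuel) k with x ≤? b ^ k
  ... | yes _ = k
  ... | no  _ = search fuel (suc k)

module _ {b x : ℕ} (2≤b : 2 ≤ b) where
  open CeilLog b x

  private
    n≤b^n : ∀ n → n ≤ b ^ n
    n≤b^n zero    = z≤n
    n≤b^n (suc n) = begin
      1 + n         ≤⟨ +-mono-≤ 1≤b^n (n≤b^n n) ⟩
      b ^ n + b ^ n ≡⟨ cong (λ k → b ^ n + k) (+-identityʳ (b ^ n)) ⟨
      2 * b ^ n     ≤⟨ *-monoˡ-≤ (b ^ n) 2≤b ⟩
      b * b ^ n     ∎
      where
      open ≤-Reasoning
      1≤b^n : 1 ≤ b ^ n
      1≤b^n = m^n>0 b {{>-nonZero (≤-trans (s≤s z≤n) 2≤b)}} n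

    upper : ∀ f k → x ≤ f + k → x ≤ b ^ search f k
    upper zero    k x≤k = ≤-trans x≤k (n≤b^n k)
    upper (suc f) k x≤ with x ≤? b ^ k
    ... | yes p = p
    ... | no  _ = upper f (suc k) (≤-trans x≤ (≤-reflexive (sym (+-suc f k))))

    least : ∀ f k {j} → k ≤ j → x ≤ b ^ j → search f k ≤ j
    least zero    k     k≤j _  = k≤j
    least (suc f) k {j} k≤j x≤ with x ≤? b ^ k
    ... | yes _ = k≤j
    ... | no ¬p = least f (suc k) (≤∧≢⇒< k≤j λ where refl → ¬p x≤) x≤

  ⌈log⌉-upper : x ≤ b ^ ⌈log[ b ] x ⌉
  ⌈log⌉-upper = upper x 0 (m≤m+n x 0)

  ⌈log⌉-least : ∀ {j} → x ≤ b ^ j → ⌈log[ b ] x ⌉ ≤ j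
  ⌈log⌉-least = least x 0 z≤n

fromℕ : ℕ → ℚ
fromℕ k = + k ℚ./ 1

module _ (n m : ℕ) .{{_ : NonZero n}} (ε : ℚ) .{{_ : ℚ.Positive ε}} where

  -- As usual under O(·), a logarithmic factor is never less than 1.  For
  -- x ≥ 2 the number ⌊log₂ ⌊x⌋⌋ = ⌊log₂ x⌋ lies between ½ log₂ x and log₂ x.
  log[m/n] : ℕ
  log[m/n] = 1 ⊔ ⌊log₂ (m / n) ⌋

  -- ⌈ log (1/ε) / log n ⌉, as 1/ε ≤ n ^ k iff ⌈ 1/ε ⌉ ≤ n ^ k.  For n = 1,
  -- where log n = 0, the base is immaterial: then m = 0.
  ⌈log[1/ε]/log[n]⌉ : ℕ
  ⌈log[1/ε]/log[n]⌉ = 1 ⊔ ⌈log[ n ⊔ 2 ] ⌈1/ ε ⌉ ⌉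

  -- The summand 1 matters only for m = 0.
  timeBound : ℚ
  timeBound =
    1ℚ ℚ.+ fromℕ (m * n ^ 2 * log[m/n] * ⌈log[1/ε]/log[n]⌉)
           ℚ.* (1/ ε) {{pos⇒nonZero ε}}

-- Let R u x be the number of u,t-paths of weight at most C + 1 − x; then R u is
-- the sum over the arcs e leaving u of R (head e) (x + weight e).  R u is
-- stored through its inverse, which maps the i-th number with b + 1
-- significant bits to the largest x at which R u reaches it, so that the shift
-- by an arc weight is a subtraction.  The sum of two stored functions is found
-- by merging, with a relative error of 3 · 2 ^ -b.
--
-- To add the d functions of a vertex without a factor log d, they are merged
-- in a balanced binary tree in which the precision grows by one bit on every
-- other level.  The total size of the lists on a level then decreases
-- geometrically, as does the error made there, and both sums are bounded by
-- their first terms.  The result is rounded back to precision b.  Heights are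
-- less than n, so 2 ^ b ≈ 8 n / ε suffices.
--
-- The number of paths is at most the product of the out-degrees, and
-- d ≤ 2 ^ (k + ⌊d / 2 ^ k⌋) with 2 ^ k ≈ m / n bounds its logarithm by
-- O(n log (m / n)).  This gives O(n² log (m / n) / ε) entries per list.

module Submission where

open import Defs
open import Function.Bundles using (_↔_)
open import Data.Bool using (Bool; true; false; if_then_else_)
open import Data.Empty using (⊥; ⊥-elim)
open import Data.Fin using (Fin; toℕ; fromℕ<)
open import Data.List using (List; []; _∷_; replicate)
open import Data.Nat
open import Data.Nat.DivMod
open import Data.Nat.Logarithm using (⌊log₂_⌋; ⌈log₂⌉-mono-≤; ⌈log₂2^n⌉≡n)
open import Data.Nat.Properties
open import Data.Nat.Tactic.RingSolver using (solve-∀)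
open import Data.Product using (Σ; Σ-syntax; ∃-syntax; _×_; _,_; proj₁; proj₂)
open import Data.Sum using (_⊎_; inj₁; inj₂)
open import Data.Unit using (⊤; tt)
open import Function using (_∘_; id)
open import Relation.Binary.PropositionalEquality hiding ([_]; J)
open import Relation.Nullary using (¬_; Dec; yes; no; contradiction)
open import Relation.Binary.Definitions using (tri<; tri≈; tri>)

-- Evaluation of programs with a time budget

-- A path count may have far more bits than a word, so the main phase never computes one. List
-- entries are capacities of at most `suc C`, a grid value is represented by its index alone, and
-- grid values are added by shifting mantissas to a common exponent. Only the final conversion of
-- one index into a number computes with long numbers.
--
-- Indices and addresses are bounded by a polynomial in `n` times a power of 1/ε, hence have O(⌈log
-- (1/ε) / log n⌉) words; this is the last factor of the time bound.
--
-- The offset in `C + 1 − x`, with `x ≥ 1`, makes the entry 0 mean that no capacity suffices, so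
-- that truncated subtraction shifts correctly.
--
-- A level that gains a bit turns an error of `K` units into `2 K + 4`, the next one adds 3. A pair
-- of levels thus adds 7 units of the new precision, 7/2 of the old one, and the whole tree at most
-- 7/2 + 7/4 + ... = 7 units at precision `b`, whatever the degree. Heights are below `n`, and
-- reading off the count at `s` costs one more unit: 8 n units in all, the origin of the 8 in 8 n /
-- ε.

infix 4 _≈_

-- Function extensionality is not available, so states are compared pointwise.
record _≈_ (σ τ : State) : Set where
  field
    regs≈ : ∀ x → regs σ x ≡ regs τ x
    mem≈  : ∀ a i → mem σ a i ≡ mem τ a i
open _≈_

⟦⟧ₒ-cong : ∀ p {σ τ} → σ ≈ τ → ⟦ p ⟧ₒ σ ≡ ⟦ p ⟧ₒ τ
⟦⟧ₒ-cong (lit k)            eq = refl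
⟦⟧ₒ-cong (reg x)            eq = regs≈ eq x
⟦⟧ₒ-cong (cell a x) {τ = τ} eq rewrite regs≈ eq x = mem≈ eq a (regs τ x)

⟦⟧ₑ-cong : ∀ e {σ τ} → σ ≈ τ → ⟦ e ⟧ₑ σ ≡ ⟦ e ⟧ₑ τ
⟦⟧ₑ-cong (val p) eq = ⟦⟧ₒ-cong p eq
⟦⟧ₑ-cong (p ⊕ q) eq rewrite ⟦⟧ₒ-cong p eq | ⟦⟧ₒ-cong q eq = refl
⟦⟧ₑ-cong (p ⊖ q) eq rewrite ⟦⟧ₒ-cong p eq | ⟦⟧ₒ-cong q eq = refl
⟦⟧ₑ-cong (p ≪ q) eq rewrite ⟦⟧ₒ-cong p eq | ⟦⟧ₒ-cong q eq = refl
⟦⟧ₑ-cong (p ≫ q) eq rewrite ⟦⟧ₒ-cong p eq | ⟦⟧ₒ-cong q eq = refl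

lookup : {A : Set} → A → List A → ℕ → A
lookup d []       y       = d
lookup d (a ∷ as) zero    = a
lookup d (a ∷ as) (suc y) = lookup d as y

update : {A : Set} → A → List A → ℕ → A → List A
update d []       zero    b = b ∷ []
update d []       (suc x) b = d ∷ update d [] x b
update d (a ∷ as) zero    b = b ∷ as
update d (a ∷ as) (suc x) b = a ∷ update d as x b

lookup-update : {A : Set} (d : A) (as : List A) (x : ℕ) (b : A) (y : ℕ) →
                (lookup d as [ x ↦ b ]) y ≡ lookup d (update d as x b) y
lookup-update d []       zero    b zero    = refl
lookup-update d []       zero    b (suc y) = refl
lookup-update d []       (suc x) b zero    = refl
lookup-update d []       (suc x) b (suc y) = lookup-update d [] x b y
lookup-update d (a ∷ as) zero    b zero    = refl
lookup-update d (a ∷ as) zero    b (suc y) = refl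
lookup-update d (a ∷ as) (suc x) b zero    = refl
lookup-update d (a ∷ as) (suc x) b (suc y) = lookup-update d as x b y

[↦]-cong : {A : Set} {f g : ℕ → A} (x : ℕ) (b : A) → (∀ y → f y ≡ g y) → ∀ y → (f [ x ↦ b ]) y ≡ (g [ x ↦ b ]) y
[↦]-cong x b eq y with y ≡ᵇ x
... | true  = refl
... | false = eq y

-- Registers and arrays as lists padded with zeros: a lookup or an update at a
-- literal position computes, so symbolic execution leaves a state in normal
-- form and the untouched tail of the list frames itself.
Env : Set
Env = List ℕ × List (ℕ → ℕ)

Array₀ : ℕ → ℕ
Array₀ _ = 0

toState : Env → State
toState (ρ , μ) = state (lookup 0 ρ) (lookup Array₀ μ)

setR : Var → ℕ → Env → Env
setR x v (ρ , μ) = update 0 ρ x v , μ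

setM : Array → ℕ → ℕ → Env → Env
setM a i v (ρ , μ) = ρ , update Array₀ μ a (lookup Array₀ μ a [ i ↦ v ])

setReg-≈ : ∀ x {v w} {σ} (e : Env) → v ≡ w → σ ≈ toState e → setReg x v σ ≈ toState (setR x w e)
setReg-≈ x {v} (ρ , μ) refl eq = record
  { regs≈ = λ y → trans ([↦]-cong x v (regs≈ eq) y) (lookup-update 0 ρ x v y)
  ; mem≈  = mem≈ eq }

setCell-≈ : ∀ a {i j v w} {σ} (e : Env) → i ≡ j → v ≡ w → σ ≈ toState e → setCell a i v σ ≈ toState (setM a j w e)
setCell-≈ a {i} {v = v} {σ = σ} (ρ , μ) refl refl eq = record
  { regs≈ = regs≈ eq
  ; mem≈  = λ b k → trans (step b k) (cong (λ f → f k) (lookup-update Array₀ μ a _ b)) }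
  where
  step : ∀ b k → (mem σ [ a ↦ mem σ a [ i ↦ v ] ]) b k ≡ (lookup Array₀ μ [ a ↦ lookup Array₀ μ a [ i ↦ v ] ]) b k
  step b k with b ≡ᵇ a
  ... | true  = [↦]-cong i v (mem≈ eq a) k
  ... | false = mem≈ eq b k

ifEq : Var → Var → Program → Program
ifEq x y P = IF reg x ≤' reg y THEN (IF reg y ≤' reg x THEN P ELSE skip) ELSE skip

module Cost (n C V u : ℕ)
  (word-V : Timed.wordTime n C V ≤ u) (number-C : Timed.numberTime n C (suc C) ≤ u) where

  open Timed n C

  Word : ℕ → Set
  Word v = v ≤ V

  -- The two kinds of numbers that are handled in time `u`. Neither bound implies the other: `C` may
  -- be much longer than any word, and a word may exceed `suc C`.
  data Num (v : ℕ) : Set where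
    word : v ≤ V → Num v
    cap  : v ≤ suc C → Num v

  private
    bits-mono : ∀ {x y} → x ≤ y → bits x ≤ bits y
    bits-mono {x} {y} p = ⌈log₂⌉-mono-≤ {suc x} {suc y} (s≤s p)

    opTime-mono : ∀ w {x y} → x ≤ y → opTime w x ≤ opTime w y
    opTime-mono w {x} {y} p = s≤s (/-monoˡ-≤ (suc w) (bits-mono {x} {y} p))

  wordTime≤ : ∀ {v} → Word v → wordTime v ≤ u
  wordTime≤ {v} p = ≤-trans (opTime-mono _ {v} p) word-V

  numberTime≤wordTime : ∀ v → numberTime v ≤ wordTime v
  numberTime≤wordTime v = s≤s (/-monoʳ-≤ (bits v) (s≤s (m≤m+n ⌊log₂ n ⌋ ⌊log₂ C ⌋)))

  numberTime≤ : ∀ {v} → Num v → numberTime v ≤ u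
  numberTime≤ {v} (word p) = ≤-trans (numberTime≤wordTime v) (wordTime≤ p)
  numberTime≤ {v} (cap p)  = ≤-trans (opTime-mono _ {v} p) number-C

  Num-⊔ : ∀ {v w} → Num v → Num w → Num (v ⊔ w)
  Num-⊔ {v} {w} p q with ⊔-sel v w
  ... | inj₁ eq rewrite eq = p
  ... | inj₂ eq rewrite eq = q

  -- The costliest instruction is a store of a shifted number: the address, two fetches, the shift
  -- distance and the shifted number are five charges of at most `u`.
  unit : ℕ
  unit = 5 * u

  Fetch : Operand → Env → Set
  Fetch (lit k)    e = ⊤
  Fetch (reg x)    e = ⊤
  Fetch (cell a x) e = Word (regs (toState e) x)

  CheapE : Expr → Env → Set
  CheapE (val p) e = Fetch p e × Num (⟦ p ⟧ₒ (toState e))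
  CheapE (p ⊕ q) e = Fetch p e × Fetch q e × Num (⟦ p ⊕ q ⟧ₑ (toState e))
  CheapE (p ⊖ q) e = Fetch p e × Fetch q e × Num (⟦ p ⟧ₒ (toState e)) × Num (⟦ q ⟧ₒ (toState e))
  CheapE (p ≪ q) e = Fetch p e × Fetch q e × Word (⟦ q ⟧ₒ (toState e)) × Word (⟦ p ≪ q ⟧ₑ (toState e))
  CheapE (p ≫ q) e = Fetch p e × Fetch q e × Word (⟦ q ⟧ₒ (toState e)) × Word (⟦ p ⟧ₒ (toState e))

  -- One short side is enough, because a comparison is charged for the shorter operand. This admits
  -- an arc weight of arbitrary length on the other side.
  CheapT : Test → Env → Set
  CheapT (p ≤' q) e = Fetch p e × Fetch q e × (Num (⟦ p ⟧ₒ (toState e)) ⊎ Num (⟦ q ⟧ₒ (toState e)))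
  CheapT (p <' q) e = Fetch p e × Fetch q e × (Num (⟦ p ⟧ₒ (toState e)) ⊎ Num (⟦ q ⟧ₒ (toState e)))

  private
    fetchTime-cong : ∀ p {σ τ} → σ ≈ τ → fetchTime p σ ≡ fetchTime p τ
    fetchTime-cong (lit k)    eq = refl
    fetchTime-cong (reg x)    eq = refl
    fetchTime-cong (cell a x) eq = cong wordTime (regs≈ eq x)

    exprTime-cong : ∀ p {σ τ} → σ ≈ τ → exprTime p σ ≡ exprTime p τ
    exprTime-cong (val p) eq rewrite fetchTime-cong p eq | ⟦⟧ₒ-cong p eq = refl
    exprTime-cong (p ⊕ q) eq rewrite fetchTime-cong p eq | fetchTime-cong q eq | ⟦⟧ₒ-cong p eq | ⟦⟧ₒ-cong q eq = refl
    exprTime-cong (p ⊖ q) eq rewrite fetchTime-cong p eq | fetchTime-cong q eq | ⟦⟧ₒ-cong p eq | ⟦⟧ₒ-cong q eq = refl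
    exprTime-cong (p ≪ q) eq rewrite fetchTime-cong p eq | fetchTime-cong q eq | ⟦⟧ₒ-cong p eq | ⟦⟧ₒ-cong q eq = refl
    exprTime-cong (p ≫ q) eq rewrite fetchTime-cong p eq | fetchTime-cong q eq | ⟦⟧ₒ-cong p eq | ⟦⟧ₒ-cong q eq = refl

    testTime-cong : ∀ b {σ τ} → σ ≈ τ → testTime b σ ≡ testTime b τ
    testTime-cong (p ≤' q) eq rewrite fetchTime-cong p eq | fetchTime-cong q eq | ⟦⟧ₒ-cong p eq | ⟦⟧ₒ-cong q eq = refl
    testTime-cong (p <' q) eq rewrite fetchTime-cong p eq | fetchTime-cong q eq | ⟦⟧ₒ-cong p eq | ⟦⟧ₒ-cong q eq = refl

    True-cong : ∀ b {σ τ} → σ ≈ τ → True b τ → True b σ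
    True-cong (p ≤' q) eq t rewrite ⟦⟧ₒ-cong p eq | ⟦⟧ₒ-cong q eq = t
    True-cong (p <' q) eq t rewrite ⟦⟧ₒ-cong p eq | ⟦⟧ₒ-cong q eq = t

    False-cong : ∀ b {σ τ} → σ ≈ τ → False b τ → False b σ
    False-cong (p ≤' q) eq t rewrite ⟦⟧ₒ-cong p eq | ⟦⟧ₒ-cong q eq = t
    False-cong (p <' q) eq t rewrite ⟦⟧ₒ-cong p eq | ⟦⟧ₒ-cong q eq = t

    fetchTime≤ : ∀ p {e} → Fetch p e → fetchTime p (toState e) ≤ u
    fetchTime≤ (lit k)    f = z≤n
    fetchTime≤ (reg x)    f = z≤n
    fetchTime≤ (cell a x) f = wordTime≤ f

    pad₂ : ∀ {a b} → a ≤ u → b ≤ u → a + b ≤ 4 * u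
    pad₂ p q = ≤-trans (+-mono-≤ p q) (≤-trans (m≤m+n _ _) (≤-reflexive (lem u)))
      where
      lem : ∀ v → (v + v) + (v + v) ≡ 4 * v
      lem = solve-∀

    pad₃ : ∀ {a b c} → a ≤ u → b ≤ u → c ≤ u → a + b + c ≤ 4 * u
    pad₃ p q r = ≤-trans (+-mono-≤ (+-mono-≤ p q) r) (≤-trans (m≤m+n _ _) (≤-reflexive (lem u)))
      where
      lem : ∀ v → (v + v + v) + v ≡ 4 * v
      lem = solve-∀

    pad₄ : ∀ {a b c d} → a ≤ u → b ≤ u → c ≤ u → d ≤ u → a + b + c + d ≤ 4 * u
    pad₄ p q r s = ≤-trans (+-mono-≤ (+-mono-≤ (+-mono-≤ p q) r) s) (≤-reflexive (lem u))
      where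
      lem : ∀ v → v + v + v + v ≡ 4 * v
      lem = solve-∀

    exprTime≤ : ∀ ex {e} → CheapE ex e → exprTime ex (toState e) ≤ 4 * u
    exprTime≤ (val p) (f , r)         = pad₂ (fetchTime≤ p f) (numberTime≤ r)
    exprTime≤ (p ⊕ q) (f , g , r)     = pad₃ (fetchTime≤ p f) (fetchTime≤ q g) (numberTime≤ r)
    exprTime≤ (p ⊖ q) (f , g , r , s) = pad₃ (fetchTime≤ p f) (fetchTime≤ q g) (numberTime≤ (Num-⊔ r s))
    exprTime≤ (p ≪ q) (f , g , r , s) = pad₄ (fetchTime≤ p f) (fetchTime≤ q g) (wordTime≤ r) (wordTime≤ s)
    exprTime≤ (p ≫ q) (f , g , r , s) = pad₄ (fetchTime≤ p f) (fetchTime≤ q g) (wordTime≤ r) (wordTime≤ s)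

    numberTime-⊓ : ∀ v w → Num v ⊎ Num w → numberTime (v ⊓ w) ≤ u
    numberTime-⊓ v w (inj₁ p) = ≤-trans (opTime-mono _ {v ⊓ w} (m⊓n≤m v w)) (numberTime≤ p)
    numberTime-⊓ v w (inj₂ q) = ≤-trans (opTime-mono _ {v ⊓ w} (m⊓n≤n v w)) (numberTime≤ q)

    4u≤unit : 4 * u ≤ unit
    4u≤unit = *-monoˡ-≤ u (n≤1+n 4)

    testTime≤ : ∀ b {e} → CheapT b e → testTime b (toState e) ≤ unit
    testTime≤ (p ≤' q) (f , g , r) = ≤-trans (pad₃ (fetchTime≤ p f) (fetchTime≤ q g) (numberTime-⊓ _ _ r)) 4u≤unit
    testTime≤ (p <' q) (f , g , r) = ≤-trans (pad₃ (fetchTime≤ p f) (fetchTime≤ q g) (numberTime-⊓ _ _ r)) 4u≤unit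

  record Reach (P : Program) (e : Env) (k : ℕ) (Q : Env → Set) : Set where
    constructor reach
    field
      exec : ∀ σ → σ ≈ toState e →
            Σ[ τ ∈ State ] Σ[ T ∈ ℕ ] Σ[ e' ∈ Env ] (⟨ P , σ ⟩⇓⟨ τ , T ⟩ × T ≤ k * unit × τ ≈ toState e' × Q e')
  open Reach public

  relax : ∀ {P e k k' Q} → k ≤ k' → Reach P e k Q → Reach P e k' Q
  relax k≤k' r .exec σ eq with r .exec σ eq
  ... | τ , T , e' , run , T≤ , eq' , q = τ , T , e' , run , ≤-trans T≤ (*-monoˡ-≤ unit k≤k') , eq' , q

  conseq : ∀ {P e k Q Q'} → Reach P e k Q → (∀ e' → Q e' → Q' e') → Reach P e k Q'
  conseq r f .exec σ eq with r .exec σ eq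
  ... | τ , T , e' , run , T≤ , eq' , q = τ , T , e' , run , T≤ , eq' , f e' q

  -- The correctness of the second program is the postcondition of the first. Symbolic execution
  -- therefore runs forward, and intermediate assertions need not be stated.
  chain : ∀ {P P' e k k' Q} → Reach P e k (λ e' → Reach P' e' k' Q) → Reach (P ⨾ P') e (k + k') Q
  chain {k = k} {k'} r .exec σ eq with r .exec σ eq
  ... | τ , T , e' , run , T≤ , eq' , r' with r' .exec τ eq'
  ... | υ , U , e'' , run' , U≤ , eq'' , q =
    υ , T + U , e'' , seq run run' , ≤-trans (+-mono-≤ T≤ U≤) (≤-reflexive (sym (*-distribʳ-+ unit k k'))) , eq'' , q

  -- Restates the environment in normal form; without it the terms left behind
  -- by symbolic execution grow exponentially.
  from : ∀ e' {e P k Q} → e ≡ e' → Reach P e' k Q → Reach P e k Q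
  from _ refl r = r

  -- Leaves the time bound to the caller. Besides `set`, this serves the final conversion, whose
  -- numbers are neither words nor capacities.
  assignₖ : ∀ {x ex e Q} k → exprTime ex (toState e) ≤ k * unit →
            Q (setR x (⟦ ex ⟧ₑ (toState e)) e) → Reach (x ≔ ex) e k Q
  assignₖ {x} {ex} {e} k t≤ q .exec σ eq =
    _ , _ , _ , assign , ≤-trans (≤-reflexive (exprTime-cong ex eq)) t≤ , setReg-≈ x e (⟦⟧ₑ-cong ex eq) eq , q

  set : ∀ {x ex e Q} → CheapE ex e → Q (setR x (⟦ ex ⟧ₑ (toState e)) e) → Reach (x ≔ ex) e 1 Q
  set {ex = ex} c = assignₖ 1 (≤-trans (exprTime≤ ex c) (≤-trans 4u≤unit (≤-reflexive (sym (+-identityʳ unit)))))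

  put : ∀ {a x ex e Q} → Word (regs (toState e) x) → CheapE ex e →
        Q (setM a (regs (toState e) x) (⟦ ex ⟧ₑ (toState e)) e) → Reach (a [ x ]≔ ex) e 1 Q
  put {a} {x} {ex} {e} w c q .exec σ eq =
    _ , _ , _ , store
    , ≤-trans (≤-reflexive (cong₂ _+_ (cong wordTime (regs≈ eq x)) (exprTime-cong ex eq)))
        (≤-trans (+-mono-≤ (wordTime≤ w) (exprTime≤ ex c)) (≤-reflexive (sym (+-identityʳ unit))))
    , setCell-≈ a e (regs≈ eq x) (⟦⟧ₑ-cong ex eq) eq , q

  infixr 4 _►_
  _►_ : ∀ {x ex P e k Q} → CheapE ex e → Reach P (setR x (⟦ ex ⟧ₑ (toState e)) e) k Q →
        Reach (x ≔ ex ⨾ P) e (suc k) Q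
  _►_ {x} {ex} {P} {e} c r =
    chain {P = x ≔ ex} {P' = P} (set {x} {ex} {e} {λ e' → Reach P e' _ _} c r)

  nothing : ∀ {e} {Q : Env → Set} → Q e → Reach skip e 1 Q
  nothing q .exec σ eq = _ , _ , _ , skip , ≤-trans (≤-trans (s≤s z≤n) word-V) (≤-trans (m≤m+n u _) (≤-reflexive (sym (+-identityʳ unit)))) , eq , q

  test? : ∀ b σ → Dec (True b σ)
  test? (p ≤' q) σ = ⟦ p ⟧ₒ σ ≤? ⟦ q ⟧ₒ σ
  test? (p <' q) σ = ⟦ p ⟧ₒ σ <? ⟦ q ⟧ₒ σ

  branch : ∀ {b P P' e k Q} → CheapT b e → (True b (toState e) → Reach P e k Q) →
           (False b (toState e) → Reach P' e k Q) → Reach (IF b THEN P ELSE P') e (suc k) Q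
  branch {b} {e = e} c t f .exec σ eq with test? b (toState e)
  ... | yes y with t y .exec σ eq
  ...   | τ , T , e' , run , T≤ , eq' , q =
    τ , _ , e' , ifTrue (True-cong b eq y) run
    , +-mono-≤ (≤-trans (≤-reflexive (testTime-cong b eq)) (testTime≤ b c)) T≤ , eq' , q
  branch {b} {e = e} c t f .exec σ eq | no y with f y .exec σ eq
  ...   | τ , T , e' , run , T≤ , eq' , q =
    τ , _ , e' , ifFalse (False-cong b eq y) run
    , +-mono-≤ (≤-trans (≤-reflexive (testTime-cong b eq)) (testTime≤ b c)) T≤ , eq' , q

  ifEq-yes : ∀ {x y P e k Q} → regs (toState e) x ≡ regs (toState e) y → Num (regs (toState e) y) →
             Reach P e k Q → Reach (ifEq x y P) e (2 + k) Q
  ifEq-yes eq num r = branch (tt , tt , inj₂ num)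
    (λ _ → branch (tt , tt , inj₁ num) (λ _ → r) (λ ¬ge → contradiction (≤-reflexive (sym eq)) ¬ge))
    (λ ¬le → contradiction (≤-reflexive eq) ¬le)

  ifEq-no : ∀ {x y P e} {Q : Env → Set} → regs (toState e) x ≢ regs (toState e) y → Num (regs (toState e) y) →
            Q e → Reach (ifEq x y P) e 3 Q
  ifEq-no neq num q = branch (tt , tt , inj₂ num)
    (λ le → branch (tt , tt , inj₁ num) (λ ge → contradiction (≤-antisym le ge) neq) (λ _ → nothing q))
    (λ _ → relax (n≤1+n 1) (nothing q))

  -- Each round is paid from the credit c, which also bounds the number of rounds.
  while : ∀ {b P Q} (Inv : ℕ → Env → Set) →
          (∀ c e → Inv c e → CheapT b e ×
            ((True b (toState e) × ∃[ k ] ∃[ c' ] (suc (k + c') ≤ c × Reach P e k (Inv c')))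
             ⊎ (False b (toState e) × 1 ≤ c × Q e))) →
          ∀ c e → Inv c e → Reach (WHILE b DO P) e c Q
  while {b} {P} {Q} Inv step c = go c c ≤-refl
    where
    -- The credit drops by `k + 1`, which is no structural descent; `fuel` drops by one and stays
    -- above it.
    go : ∀ fuel c → c ≤ fuel → ∀ e → Inv c e → Reach (WHILE b DO P) e c Q
    go fuel c c≤ e inv .exec σ eq with step c e inv
    go fuel c c≤ e inv .exec σ eq | ch , inj₂ (f , 1≤c , q) =
      σ , _ , e , whileFalse (False-cong b eq f)
      , ≤-trans (≤-trans (≤-reflexive (testTime-cong b eq)) (testTime≤ b ch))
          (≤-trans (≤-reflexive (sym (+-identityʳ unit))) (*-monoˡ-≤ unit 1≤c)) , eq , q
    go zero c c≤ e inv .exec σ eq | ch , inj₁ (t , k , c' , lt , r) = contradiction (≤-trans lt c≤) λ ()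
    go (suc fuel) c c≤ e inv .exec σ eq | ch , inj₁ (t , k , c' , lt , r) with r .exec σ eq
    ... | τ , T , e' , run , T≤ , eq' , inv'
      with go fuel c' (≤-trans (m≤n+m c' k) (s≤s⁻¹ (≤-trans lt c≤))) e' inv' .exec τ eq'
    ... | υ , U , e'' , run' , U≤ , eq'' , q =
      υ , _ , e'' , whileTrue (True-cong b eq t) run run'
      , ≤-trans (+-mono-≤ (≤-trans (≤-reflexive (testTime-cong b eq)) (testTime≤ b ch))
                  (≤-trans (+-mono-≤ T≤ U≤) (≤-reflexive (sym (*-distribʳ-+ unit k c')))))
          (*-monoˡ-≤ unit lt) , eq'' , q

  for : ∀ {b P Q} k (Inv : ℕ → Env → Set) →
        (∀ r e → Inv r e → CheapT b e ×
          ((True b (toState e) × ∃[ r' ] (r ≡ suc r' × Reach P e k (Inv r')))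
           ⊎ (False b (toState e) × Q e))) →
        ∀ r e → Inv r e → Reach (WHILE b DO P) e (r * suc k + 1) Q
  for {b} {P} {Q} k Inv step r e inv =
    while {b} {P} {Q} (λ c e → ∃[ r ] (Inv r e × c ≡ r * suc k + 1)) step' _ e (r , inv , refl)
    where
    step' : ∀ c e → ∃[ r ] (Inv r e × c ≡ r * suc k + 1) → CheapT b e ×
            ((True b (toState e) × ∃[ k ] ∃[ c' ] (suc (k + c') ≤ c × Reach P e k (λ e → ∃[ r ] (Inv r e × c' ≡ r * suc _ + 1))))
             ⊎ (False b (toState e) × 1 ≤ c × Q e))
    step' c e (r , inv , refl) with step r e inv
    ... | ch , inj₁ (t , r' , refl , body) =
      ch , inj₁ (t , k , r' * suc k + 1 , ≤-reflexive (cong suc (sym (+-assoc k _ 1)))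
                , conseq body λ e' inv' → r' , inv' , refl)
    ... | ch , inj₂ (f , q) = ch , inj₂ (f , m≤n+m 1 _ , q)

-- Numbers with b + 1 significant bits

shr : ℕ → ℕ → ℕ
shr x k = _/_ x (2 ^ k) {{m^n≢0 2 k}}

pow>0 : ∀ k → 1 ≤ 2 ^ k
pow>0 k = m^n>0 2 k

n<2^n : ∀ n → n < 2 ^ n
n<2^n zero    = s≤s z≤n
n<2^n (suc n) = ≤-trans (+-mono-≤ (pow>0 n) (n<2^n n)) (≤-reflexive (cong (2 ^ n +_) (sym (+-identityʳ (2 ^ n)))))

shr-lower : ∀ x k → shr x k * 2 ^ k ≤ x
shr-lower x k = m/n*n≤m x (2 ^ k) {{m^n≢0 2 k}}

shr-upper : ∀ x k → x < suc (shr x k) * 2 ^ k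
shr-upper x k = begin-strict
  x ≡⟨ m≡m%n+[m/n]*n x (2 ^ k) {{m^n≢0 2 k}} ⟩
  _%_ x (2 ^ k) {{m^n≢0 2 k}} + shr x k * 2 ^ k <⟨ +-monoˡ-< _ (m%n<n x (2 ^ k) {{m^n≢0 2 k}}) ⟩
  2 ^ k + shr x k * 2 ^ k ∎
  where open ≤-Reasoning

shr≤ : ∀ x k → shr x k ≤ x
shr≤ x k = m/n≤m x (2 ^ k) {{m^n≢0 2 k}}

shr-mono : ∀ k {x y} → x ≤ y → shr x k ≤ shr y k
shr-mono k = /-monoˡ-≤ (2 ^ k) {{m^n≢0 2 k}}

shr-unique : ∀ x k q → q * 2 ^ k ≤ x → x < suc q * 2 ^ k → shr x k ≡ q
shr-unique x k q lo hi = ≤-antisym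
  (s≤s⁻¹ (*-cancelʳ-< (2 ^ k) (shr x k) (suc q) (≤-<-trans (shr-lower x k) hi)))
  (s≤s⁻¹ (*-cancelʳ-< (2 ^ k) q (suc (shr x k)) (≤-<-trans lo (shr-upper x k))))

shr-zero : ∀ x → shr x 0 ≡ x
shr-zero x = n/1≡n x

shr-* : ∀ q k → shr (q * 2 ^ k) k ≡ q
shr-* q k = m*n/n≡m q (2 ^ k) {{m^n≢0 2 k}}

-- The numbers with b + 1 significant bits, enumerated in increasing order:
-- index i stands for mant b i · 2 ^ ex b i, where the exponent is 0 for i < 2 ^ b.
ex mant grid : ℕ → ℕ → ℕ
ex b i   = shr i b ∸ 1
mant b i = i ∸ ex b i * 2 ^ b
grid b i = mant b i * 2 ^ ex b i

ex-lower : ∀ b i → ex b i * 2 ^ b ≤ i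
ex-lower b i = ≤-trans (*-monoˡ-≤ (2 ^ b) (m∸n≤m (shr i b) 1)) (shr-lower i b)

mant+ : ∀ b i → mant b i + ex b i * 2 ^ b ≡ i
mant+ b i = m∸n+n≡m (ex-lower b i)

ex-mono : ∀ b {i j} → i ≤ j → ex b i ≤ ex b j
ex-mono b i≤j = ∸-monoˡ-≤ 1 (shr-mono b i≤j)

-- Within a block of `2 ^ b` indices the exponent is constant and the mantissa grows by one. At the
-- end of a block the mantissa would become `2 * 2 ^ b`, which is the same as `2 ^ b` with the next
-- exponent. Between the first two blocks nothing happens, since truncated subtraction gives both
-- the exponent 0.
grid-suc : ∀ b i → grid b (suc i) ≡ grid b i + 2 ^ ex b i
grid-suc b i = by (shr i b) refl
  where
  same : ex b (suc i) ≡ ex b i → grid b (suc i) ≡ grid b i + 2 ^ ex b i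
  same eq rewrite eq | +-∸-assoc 1 (ex-lower b i) = +-comm (2 ^ ex b i) _
  by : ∀ q → shr i b ≡ q → grid b (suc i) ≡ grid b i + 2 ^ ex b i
  by q eq with suc i <? suc q * 2 ^ b
  ... | yes lt = same (cong (_∸ 1) (trans (shr-unique (suc i) b q (≤-trans (subst (λ v → v * 2 ^ b ≤ i) eq (shr-lower i b)) (n≤1+n i)) lt) (sym eq)))
  ... | no ¬lt = next q eq
    where
    top : suc i ≡ suc q * 2 ^ b
    top = ≤-antisym (subst (λ v → i < suc v * 2 ^ b) eq (shr-upper i b)) (≮⇒≥ ¬lt)
    shr-top : shr (suc i) b ≡ suc q
    shr-top = trans (cong (λ v → shr v b) top) (shr-* (suc q) b)
    next : ∀ r → shr i b ≡ r → grid b (suc i) ≡ grid b i + 2 ^ ex b i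
    next zero    e = same (trans (cong (_∸ 1) (trans shr-top (cong suc (trans (sym eq) e)))) (sym (cong (_∸ 1) e)))
    next (suc r) e = begin
      grid b (suc i) ≡⟨ cong (λ v → (suc i ∸ v * 2 ^ b) * 2 ^ v) ex-top ⟩
      (suc i ∸ suc r * P) * 2 ^ suc r ≡⟨ cong (λ v → (v ∸ suc r * P) * 2 ^ suc r) top′ ⟩
      (suc (suc r) * P ∸ suc r * P) * 2 ^ suc r ≡⟨ cong (_* 2 ^ suc r) (m+n∸n≡m P (suc r * P)) ⟩
      P * (2 * 2 ^ r) ≡⟨ lem P (2 ^ r) ⟩
      (P + P) * 2 ^ r ≡⟨ cong (_* 2 ^ r) (+-cancelʳ-≡ (r * P) (suc (mant b i)) (P + P) suc-mant) ⟨
      suc (mant b i) * 2 ^ r ≡⟨ cong (λ v → suc (mant b i) * 2 ^ v) (cong (_∸ 1) e) ⟨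
      suc (mant b i) * 2 ^ ex b i ≡⟨ +-comm (2 ^ ex b i) _ ⟩
      grid b i + 2 ^ ex b i ∎
      where
      open ≡-Reasoning
      P = 2 ^ b
      ex-top : ex b (suc i) ≡ suc r
      ex-top = cong (_∸ 1) (trans shr-top (cong suc (trans (sym eq) e)))
      top′ : suc i ≡ suc (suc r) * P
      top′ = trans top (cong (λ v → suc v * P) (trans (sym eq) e))
      lem : ∀ p t → p * (2 * t) ≡ (p + p) * t
      lem = solve-∀
      suc-mant : suc (mant b i) + r * P ≡ P + P + r * P
      suc-mant = begin
        suc (mant b i) + r * P ≡⟨ cong (λ v → suc (mant b i + v * P)) (cong (_∸ 1) e) ⟨
        suc (mant b i + ex b i * P) ≡⟨ cong suc (mant+ b i) ⟩
        suc i ≡⟨ top′ ⟩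
        P + (P + r * P) ≡⟨ +-assoc P P (r * P) ⟨
        P + P + r * P ∎

grid-mono : ∀ b {i j} → i ≤ j → grid b i ≤ grid b j
grid-mono b {i} i≤j = go (≤⇒≤′ i≤j)
  where
  go : ∀ {j} → i ≤′ j → grid b i ≤ grid b j
  go ≤′-refl           = ≤-refl
  go (≤′-step {j} i≤j) = ≤-trans (go i≤j) (≤-trans (m≤m+n _ (2 ^ ex b j)) (≤-reflexive (sym (grid-suc b j))))

grid-mono-< : ∀ b {i j} → i < j → grid b i < grid b j
grid-mono-< b {i} i<j = ≤-trans (≤-trans (m<m+n (grid b i) (pow>0 (ex b i))) (≤-reflexive (sym (grid-suc b i)))) (grid-mono b i<j)

grid-cancel-≤ : ∀ b {i j} → grid b i ≤ grid b j → i ≤ j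
grid-cancel-≤ b le = ≮⇒≥ λ j<i → <⇒≱ (grid-mono-< b j<i) le

grid-zero : ∀ b → grid b 0 ≡ 0
grid-zero b = cong (_* 2 ^ ex b 0) (0∸n≡0 (ex b 0 * 2 ^ b))

grid>0 : ∀ b {i} → 1 ≤ i → 1 ≤ grid b i
grid>0 b 1≤i = ≤-trans (s≤s z≤n) (grid-mono-< b 1≤i)

grid-top : ∀ b X → grid b (suc X * 2 ^ b) ≡ 2 ^ b * 2 ^ X
grid-top b X rewrite shr-* (suc X) b = cong (_* 2 ^ X) (m+n∸n≡m (2 ^ b) (X * 2 ^ b))

grid-one : ∀ b → grid b (2 ^ b) ≡ 2 ^ b
grid-one b = trans (cong (grid b) (sym (*-identityˡ (2 ^ b)))) (trans (grid-top b 0) (*-identityʳ (2 ^ b)))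

full-mant : ∀ b i {q} → shr i b ≡ suc q → 2 ^ b ≤ mant b i
full-mant b i {q} eq = begin
  2 ^ b ≡⟨ m+n∸n≡m (2 ^ b) (q * 2 ^ b) ⟨
  suc q * 2 ^ b ∸ q * 2 ^ b ≤⟨ ∸-monoˡ-≤ (q * 2 ^ b) (subst (λ v → v * 2 ^ b ≤ i) eq (shr-lower i b)) ⟩
  i ∸ q * 2 ^ b ≡⟨ cong (λ v → i ∸ (v ∸ 1) * 2 ^ b) eq ⟨
  mant b i ∎
  where open ≤-Reasoning

-- Turns an absolute rounding error into a relative one. Beyond the first block the mantissa is at
-- least `2 ^ b`, so one spacing is at most the fraction `2 ^ b` of the value; in the first block
-- the spacing is 1, and `R` is at least 1.
ulp≤ : ∀ b i {R} → 1 ≤ R → grid b i ≤ 2 ^ b * R → 2 ^ ex b i ≤ R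
ulp≤ b i {R} 1≤R le = by (shr i b) refl
  where
  by : ∀ q → shr i b ≡ q → 2 ^ ex b i ≤ R
  by zero    eq = subst (λ v → 2 ^ (v ∸ 1) ≤ R) (sym eq) 1≤R
  by (suc q) eq = *-cancelˡ-≤ (2 ^ b) {{m^n≢0 2 b}} (≤-trans (*-monoˡ-≤ (2 ^ ex b i) (full-mant b i eq)) le)

-- The blocks at precision `b + e` are `2 ^ e` times as long, so scaling the index by that factor
-- keeps the exponent and scales only the mantissa. Every grid value thus remains one at a higher
-- precision.
grid-scale : ∀ b e i → grid (b + e) (i * 2 ^ e) ≡ grid b i * 2 ^ e
grid-scale b e i = begin
  grid (b + e) (i * 2 ^ e) ≡⟨ cong (λ v → (i * 2 ^ e ∸ v * 2 ^ (b + e)) * 2 ^ v) eq ⟩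
  (i * 2 ^ e ∸ ex b i * 2 ^ (b + e)) * 2 ^ ex b i ≡⟨ cong (λ v → (i * 2 ^ e ∸ ex b i * v) * 2 ^ ex b i) (^-distribˡ-+-* 2 b e) ⟩
  (i * 2 ^ e ∸ ex b i * (2 ^ b * 2 ^ e)) * 2 ^ ex b i ≡⟨ cong (λ v → (i * 2 ^ e ∸ v) * 2 ^ ex b i) (*-assoc (ex b i) (2 ^ b) (2 ^ e)) ⟨
  (i * 2 ^ e ∸ ex b i * 2 ^ b * 2 ^ e) * 2 ^ ex b i ≡⟨ cong (_* 2 ^ ex b i) (*-distribʳ-∸ (2 ^ e) i (ex b i * 2 ^ b)) ⟨
  mant b i * 2 ^ e * 2 ^ ex b i ≡⟨ lem (mant b i) (2 ^ e) (2 ^ ex b i) ⟩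
  grid b i * 2 ^ e ∎
  where
  open ≡-Reasoning
  lem : ∀ x y z → x * y * z ≡ x * z * y
  lem = solve-∀
  shr-eq : shr (i * 2 ^ e) (b + e) ≡ shr i b
  shr-eq = shr-unique (i * 2 ^ e) (b + e) (shr i b)
    (subst (_≤ i * 2 ^ e) (assoc (shr i b)) (*-monoˡ-≤ (2 ^ e) (shr-lower i b)))
    (subst (i * 2 ^ e <_) (assoc (suc (shr i b))) (*-monoˡ-< (2 ^ e) {{m^n≢0 2 e}} (shr-upper i b)))
    where
    assoc : ∀ q → q * 2 ^ b * 2 ^ e ≡ q * 2 ^ (b + e)
    assoc q = trans (*-assoc q (2 ^ b) (2 ^ e)) (cong (q *_) (sym (^-distribˡ-+-* 2 b e)))
  eq : ex (b + e) (i * 2 ^ e) ≡ ex b i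
  eq = cong (_∸ 1) shr-eq

-- The mantissa of i in the scale of j.
scaled : ℕ → ℕ → ℕ → ℕ
scaled b j i = shr (mant b i) (ex b j ∸ ex b i)

module _ (b : ℕ) {i j : ℕ} (i≤j : i ≤ j) where
  private
    split : 2 ^ (ex b j ∸ ex b i) * 2 ^ ex b i ≡ 2 ^ ex b j
    split = trans (sym (^-distribˡ-+-* 2 (ex b j ∸ ex b i) (ex b i))) (cong (2 ^_) (m∸n+n≡m (ex-mono b i≤j)))

    assoc : ∀ q → q * 2 ^ (ex b j ∸ ex b i) * 2 ^ ex b i ≡ q * 2 ^ ex b j
    assoc q = trans (*-assoc q _ _) (cong (q *_) split)

  scaled-lower : scaled b j i * 2 ^ ex b j ≤ grid b i
  scaled-lower = subst (_≤ grid b i) (assoc (scaled b j i))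
    (*-monoˡ-≤ (2 ^ ex b i) (shr-lower (mant b i) (ex b j ∸ ex b i)))

  scaled-upper : grid b i < suc (scaled b j i) * 2 ^ ex b j
  scaled-upper = subst (grid b i <_) (assoc (suc (scaled b j i)))
    (*-monoˡ-< (2 ^ ex b i) {{m^n≢0 2 (ex b i)}} (shr-upper (mant b i) (ex b j ∸ ex b i)))

scaled-self : ∀ b i → scaled b i i ≡ mant b i
scaled-self b i rewrite n∸n≡0 (ex b i) = shr-zero (mant b i)

module _ (b : ℕ) {i₁ i₂ j : ℕ} (i₁≤j : i₁ ≤ j) (i₂≤j : i₂ ≤ j) where

  test-sound : mant b j ≤ scaled b j i₁ + scaled b j i₂ → grid b j ≤ grid b i₁ + grid b i₂
  test-sound le = begin
    mant b j * 2 ^ ex b j ≤⟨ *-monoˡ-≤ (2 ^ ex b j) le ⟩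
    (scaled b j i₁ + scaled b j i₂) * 2 ^ ex b j ≡⟨ *-distribʳ-+ (2 ^ ex b j) (scaled b j i₁) (scaled b j i₂) ⟩
    scaled b j i₁ * 2 ^ ex b j + scaled b j i₂ * 2 ^ ex b j ≤⟨ +-mono-≤ (scaled-lower b i₁≤j) (scaled-lower b i₂≤j) ⟩
    grid b i₁ + grid b i₂ ∎
    where open ≤-Reasoning

  module _ (¬test : ¬ mant b j ≤ scaled b j i₁ + scaled b j i₂) where

    -- Each truncation loses less than one unit in the scale of `j`, and the failed comparison of
    -- integers gives one unit back.
    test-fails : grid b i₁ + grid b i₂ < grid b j + 2 ^ ex b j
    test-fails = begin-strict
      grid b i₁ + grid b i₂ <⟨ +-mono-< (scaled-upper b i₁≤j) (scaled-upper b i₂≤j) ⟩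
      suc h₁ * 2 ^ ex b j + suc h₂ * 2 ^ ex b j ≡⟨ lem h₁ h₂ (2 ^ ex b j) ⟩
      suc (h₁ + h₂) * 2 ^ ex b j + 2 ^ ex b j ≤⟨ +-monoˡ-≤ (2 ^ ex b j) (*-monoˡ-≤ (2 ^ ex b j) (≰⇒> ¬test)) ⟩
      grid b j + 2 ^ ex b j ∎
      where
      open ≤-Reasoning
      h₁ = scaled b j i₁
      h₂ = scaled b j i₂
      lem : ∀ x y z → suc x * z + suc y * z ≡ suc (x + y) * z + z
      lem = solve-∀

    -- An index equal to `j` would pass the test by itself. Hence an argument index never overtakes
    -- the output index, exponent differences are never negative, and both mantissas are scaled by
    -- right shifts.
    test-fails-ˡ : i₁ < j
    test-fails-ˡ = ≤∧≢⇒< i₁≤j λ where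
      refl → ¬test (≤-trans (≤-reflexive (sym (scaled-self b i₁))) (m≤m+n _ _))

    test-fails-ʳ : i₂ < j
    test-fails-ʳ = ≤∧≢⇒< i₂≤j λ where
      refl → ¬test (≤-trans (≤-reflexive (sym (scaled-self b i₂))) (m≤n+m _ _))

-- Finite sums

sum : ℕ → (ℕ → ℕ) → ℕ
sum zero    f = 0
sum (suc k) f = sum k f + f k

sum-cong : ∀ k {f g} → (∀ i → i < k → f i ≡ g i) → sum k f ≡ sum k g
sum-cong zero    eq = refl
sum-cong (suc k) eq = cong₂ _+_ (sum-cong k λ i i<k → eq i (m≤n⇒m≤1+n i<k)) (eq k ≤-refl)

sum-mono : ∀ k {f g} → (∀ i → i < k → f i ≤ g i) → sum k f ≤ sum k g
sum-mono zero    le = z≤n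
sum-mono (suc k) le = +-mono-≤ (sum-mono k λ i i<k → le i (m≤n⇒m≤1+n i<k)) (le k ≤-refl)

sum-zero : ∀ k → sum k (λ _ → 0) ≡ 0
sum-zero zero    = refl
sum-zero (suc k) = trans (+-identityʳ (sum k (λ _ → 0))) (sum-zero k)

sum-const : ∀ k c → sum k (λ _ → c) ≡ k * c
sum-const zero    c = refl
sum-const (suc k) c = trans (+-comm (sum k (λ _ → c)) c) (cong (c +_) (sum-const k c))

sum-+ : ∀ k f g → sum k (λ i → f i + g i) ≡ sum k f + sum k g
sum-+ zero    f g = refl
sum-+ (suc k) f g = trans (cong (_+ (f k + g k)) (sum-+ k f g)) (lem (sum k f) (sum k g) (f k) (g k))
  where
  lem : ∀ a b c d → a + b + (c + d) ≡ a + c + (b + d)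
  lem = solve-∀

sum-* : ∀ k f c → sum k (λ i → f i * c) ≡ sum k f * c
sum-* zero    f c = refl
sum-* (suc k) f c = trans (cong (_+ f k * c) (sum-* k f c)) (sym (*-distribʳ-+ c (sum k f) (f k)))

sum-swap : ∀ k l (f : ℕ → ℕ → ℕ) → sum k (λ i → sum l (f i)) ≡ sum l (λ j → sum k (λ i → f i j))
sum-swap zero    l f = sym (sum-zero l)
sum-swap (suc k) l f = trans (cong (_+ sum l (f k)) (sum-swap k l f))
  (sym (sum-+ l (λ j → sum k (λ i → f i j)) (f k)))

sum-pairs : ∀ k f → sum k (λ p → f (p * 2) + f (suc (p * 2))) ≡ sum (k * 2) f
sum-pairs zero    f = refl
sum-pairs (suc k) f = trans (sym (+-assoc _ (f (k * 2)) (f (suc (k * 2)))))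
  (cong (λ v → v + f (k * 2) + f (suc (k * 2))) (sum-pairs k f))

sum-pad : ∀ {k l f} → k ≤ l → (∀ i → k ≤ i → f i ≡ 0) → sum l f ≡ sum k f
sum-pad {k} {l} {f} k≤l z = go (≤⇒≤′ k≤l)
  where
  go : ∀ {l} → k ≤′ l → sum l f ≡ sum k f
  go ≤′-refl           = refl
  go (≤′-step {l} k≤l) = trans (cong₂ _+_ (go k≤l) (z l (≤′⇒≤ k≤l))) (+-identityʳ _)

sum-term : ∀ {k f i} → i < k → f i ≤ sum k f
sum-term {suc k} {f} {i} i<1+k with m≤n⇒m<n∨m≡n (s≤s⁻¹ i<1+k)
... | inj₁ i<k  = ≤-trans (sum-term i<k) (m≤m+n (sum k f) (f k))
... | inj₂ refl = m≤n+m (f k) (sum k f)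

-- For potential arguments in which a single vertex releases the amount `c`.
sum-gap : ∀ {k f g i c} → i < k → (∀ j → j < k → f j ≤ g j) → c + f i ≤ g i → c + sum k f ≤ sum k g
sum-gap {suc k} {f} {g} {i} {c} i<1+k le gap with m≤n⇒m<n∨m≡n (s≤s⁻¹ i<1+k)
... | inj₁ i<k  = ≤-trans (≤-reflexive (sym (+-assoc c (sum k f) (f k))))
                    (+-mono-≤ (sum-gap i<k (λ j j<k → le j (m≤n⇒m≤1+n j<k)) gap) (le k ≤-refl))
... | inj₂ refl = ≤-trans (≤-reflexive (lem c (sum k f) (f k)))
                    (+-mono-≤ (sum-mono k λ j j<k → le j (m≤n⇒m≤1+n j<k)) gap)
  where
  lem : ∀ a b d → a + (b + d) ≡ b + (a + d)
  lem = solve-∀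

sum-≤ : ∀ {k l} f → k ≤ l → sum k f ≤ sum l f
sum-≤ {k} f k≤l = go (≤⇒≤′ k≤l)
  where
  go : ∀ {l} → k ≤′ l → sum k f ≤ sum l f
  go ≤′-refl           = ≤-refl
  go (≤′-step {l} k≤l) = ≤-trans (go k≤l) (m≤m+n (sum l f) (f l))

-- Lists of capacities and their merging

-- S i is an approximate inverse of the nonincreasing counting function R: the
-- largest x with R x at least the i-th grid value, in units of 2 ^ -b.  Here k
-- bounds the relative error, again in units of 2 ^ -b.
record Represents (b k J : ℕ) (S R : ℕ → ℕ) : Set where
  field
    sound : ∀ {i x} → 1 ≤ i → i ≤ J → 1 ≤ x → x ≤ S i → grid b i ≤ 2 ^ b * R x
    compl : ∀ {i x} → 1 ≤ i → i ≤ J → 1 ≤ x → grid b i + k * R x ≤ 2 ^ b * R x → x ≤ S i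

rep-cong : ∀ {b k J S S' R R'} → (∀ i → 1 ≤ i → i ≤ J → S i ≡ S' i) → (∀ x → 1 ≤ x → R x ≡ R' x) →
           Represents b k J S R → Represents b k J S' R'
rep-cong {b} {k} eqS eqR r = record
  { sound = λ {i} {x} 1≤i i≤J 1≤x le → subst (λ v → grid b i ≤ 2 ^ b * v) (eqR x 1≤x)
              (sound 1≤i i≤J 1≤x (subst (x ≤_) (sym (eqS i 1≤i i≤J)) le))
  ; compl = λ {i} {x} 1≤i i≤J 1≤x le → subst (x ≤_) (eqS i 1≤i i≤J)
              (compl 1≤i i≤J 1≤x (subst (λ v → grid b i + k * v ≤ 2 ^ b * v) (sym (eqR x 1≤x)) le)) }
  where open Represents r

rep-weaken : ∀ {b k k' J S R} → k ≤ k' → Represents b k J S R → Represents b k' J S R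
rep-weaken {b} {R = R} k≤k' r = record
  { sound = sound
  ; compl = λ {i} {x} 1≤i i≤J 1≤x le → compl 1≤i i≤J 1≤x (≤-trans (+-monoʳ-≤ (grid b i) (*-monoˡ-≤ (R x) k≤k')) le) }
  where open Represents r

-- Where the subtraction truncates, the entry becomes 0 and no `x ≥ 1` lies below it, just as no
-- `x + w` with `x ≥ 1` lay below the old entry.
rep-shift : ∀ {b k J S R} w → Represents b k J S R → Represents b k J (λ i → S i ∸ w) (λ x → R (x + w))
rep-shift {S = S} w r = record
  { sound = λ {i} {x} 1≤i i≤J 1≤x le → sound 1≤i i≤J (≤-trans 1≤x (m≤m+n x w))
              (subst (x + w ≤_) (m∸n+n≡m (<⇒≤ (m∸n≢0⇒n<m {S i} {w} λ e → <⇒≱ (≤-trans 1≤x le) (≤-reflexive e)))) (+-monoˡ-≤ w le))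
  ; compl = λ {i} {x} 1≤i i≤J 1≤x le →
              subst (_≤ S i ∸ w) (m+n∸n≡m x w) (∸-monoˡ-≤ w (compl 1≤i i≤J (≤-trans 1≤x (m≤m+n x w)) le)) }
  where open Represents r

rep-zero : ∀ b {k J S} → (∀ i → 1 ≤ i → i ≤ J → S i ≡ 0) → Represents b k J S (λ _ → 0)
rep-zero b {k} {S = S} eq = record
  { sound = λ {i} 1≤i i≤J 1≤x le → contradiction (≤-trans 1≤x le) (<⇒≱ (s≤s (≤-reflexive (eq i 1≤i i≤J))))
  ; compl = λ {i} 1≤i i≤J 1≤x le → contradiction (≤-trans (m≤m+n (grid b i) _) le)
              (<⇒≱ (subst (_< grid b i) (sym (*-zeroʳ (2 ^ b))) (grid>0 b 1≤i))) }

shr-index : ∀ {σ i J} → σ ≤ 1 → i ≤ J * 2 ^ σ → shr (i + σ) σ ≤ J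
shr-index {σ} {i} {J} σ≤1 i≤ = s≤s⁻¹ (*-cancelʳ-< (2 ^ σ) _ (suc J) (begin-strict
  shr (i + σ) σ * 2 ^ σ ≤⟨ shr-lower (i + σ) σ ⟩
  i + σ <⟨ +-mono-≤-< i≤ (σ<2^σ σ≤1) ⟩
  J * 2 ^ σ + 2 ^ σ ≡⟨ +-comm (J * 2 ^ σ) (2 ^ σ) ⟩
  suc J * 2 ^ σ ∎))
  where
  open ≤-Reasoning
  σ<2^σ : ∀ {σ} → σ ≤ 1 → σ < 2 ^ σ
  σ<2^σ z≤n       = s≤s z≤n
  σ<2^σ (s≤s z≤n) = s≤s (s≤s z≤n)

shr-index>0 : ∀ {σ i} → σ ≤ 1 → 1 ≤ i → 1 ≤ shr (i + σ) σ
shr-index>0 {i = i} z≤n 1≤i = subst (1 ≤_) (sym (trans (shr-zero (i + 0)) (+-identityʳ i))) 1≤i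
shr-index>0 {i = i} (s≤s z≤n) 1≤i = s≤s⁻¹ (*-cancelʳ-< 2 1 (suc (shr (i + 1) 1)) (≤-<-trans (+-monoˡ-≤ 1 1≤i) (shr-upper (i + 1) 1)))

-- For `σ ≤ 1` the index `shr (i + σ) σ` is `i / 2 ^ σ` rounded up. Rounding up keeps soundness;
-- with one more bit it overshoots by at most one fine spacing, and since the units are half as
-- large, the error `k` becomes `2 * k + 1`.
rep-refine : ∀ {b k J S R} σ → σ ≤ 1 → Represents b k J S R →
             Represents (b + σ) (2 ^ σ * k + σ) (J * 2 ^ σ) (λ i → S (shr (i + σ) σ)) R
rep-refine {b} {k} {J} {S} {R} 0 _ r rewrite +-identityʳ b | *-identityʳ J | +-identityʳ (k + 0) | +-identityʳ k =
  rep-cong {b} {k} (λ i _ _ → cong S (sym (trans (shr-zero (i + 0)) (+-identityʳ i)))) (λ _ _ → refl) r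
rep-refine {b} {k} {J} {S} {R} 1 _ r = record { sound = snd ; compl = cmp }
  where
  open Represents r
  module _ {i : ℕ} (1≤i : 1 ≤ i) (i≤J : i ≤ J * 2) where
    h = shr (i + 1) 1
    upper : i + 1 < suc h * 2
    upper = shr-upper (i + 1) 1
    i≤2h : i ≤ h * 2
    i≤2h = s≤s⁻¹ (s≤s⁻¹ (subst (_≤ suc h * 2) (cong suc (+-comm i 1)) upper))
    2h≤1+i : h * 2 ≤ suc i
    2h≤1+i = subst (h * 2 ≤_) (+-comm i 1) (shr-lower (i + 1) 1)
    1≤h : 1 ≤ h
    1≤h = shr-index>0 (s≤s z≤n) 1≤i
    h≤J : h ≤ J
    h≤J = shr-index (s≤s z≤n) i≤J
    scale : grid (b + 1) (h * 2) ≡ grid b h * 2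
    scale = grid-scale b 1 h
  two : ∀ v → 2 ^ (b + 1) * v ≡ 2 ^ b * v * 2
  two v = trans (cong (_* v) (^-distribˡ-+-* 2 b 1)) (lem (2 ^ b) v)
    where
    lem : ∀ p v → p * 2 * v ≡ p * v * 2
    lem = solve-∀
  snd : ∀ {i x} → 1 ≤ i → i ≤ J * 2 → 1 ≤ x → x ≤ S (shr (i + 1) 1) → grid (b + 1) i ≤ 2 ^ (b + 1) * R x
  snd {i} {x} 1≤i i≤J 1≤x le = begin
    grid (b + 1) i ≤⟨ grid-mono (b + 1) (i≤2h 1≤i i≤J) ⟩
    grid (b + 1) (h 1≤i i≤J * 2) ≡⟨ scale 1≤i i≤J ⟩
    grid b (h 1≤i i≤J) * 2 ≤⟨ *-monoˡ-≤ 2 (sound (1≤h 1≤i i≤J) (h≤J 1≤i i≤J) 1≤x le) ⟩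
    2 ^ b * R x * 2 ≡⟨ two (R x) ⟨
    2 ^ (b + 1) * R x ∎
    where open ≤-Reasoning
  cmp : ∀ {i x} → 1 ≤ i → i ≤ J * 2 → 1 ≤ x → grid (b + 1) i + (2 * k + 1) * R x ≤ 2 ^ (b + 1) * R x →
        x ≤ S (shr (i + 1) 1)
  cmp {i} {x} 1≤i i≤J 1≤x le = compl (1≤h 1≤i i≤J) (h≤J 1≤i i≤J) 1≤x (*-cancelʳ-≤ _ _ 2 (begin
    (grid b h' + k * R x) * 2 ≡⟨ lem₁ (grid b h') k (R x) ⟩
    grid b h' * 2 + 2 * k * R x ≡⟨ cong (_+ 2 * k * R x) (scale 1≤i i≤J) ⟨
    grid (b + 1) (h' * 2) + 2 * k * R x ≤⟨ +-monoˡ-≤ _ (grid-mono (b + 1) (2h≤1+i 1≤i i≤J)) ⟩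
    grid (b + 1) (suc i) + 2 * k * R x ≡⟨ cong (_+ 2 * k * R x) (grid-suc (b + 1) i) ⟩
    grid (b + 1) i + 2 ^ ex (b + 1) i + 2 * k * R x ≤⟨ +-monoˡ-≤ _ (+-monoʳ-≤ (grid (b + 1) i) (ulp≤ (b + 1) i R>0 fits)) ⟩
    grid (b + 1) i + R x + 2 * k * R x ≡⟨ lem₂ (grid (b + 1) i) k (R x) ⟩
    grid (b + 1) i + (2 * k + 1) * R x ≤⟨ le ⟩
    2 ^ (b + 1) * R x ≡⟨ two (R x) ⟩
    2 ^ b * R x * 2 ∎))
    where
    open ≤-Reasoning
    h' = h 1≤i i≤J
    fits : grid (b + 1) i ≤ 2 ^ (b + 1) * R x
    fits = ≤-trans (m≤m+n _ _) le
    R>0 : 1 ≤ R x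
    R>0 = n≢0⇒n>0 λ e → <⇒≱ (grid>0 (b + 1) 1≤i)
            (subst (grid (b + 1) i ≤_) (trans (cong (2 ^ (b + 1) *_) e) (*-zeroʳ (2 ^ (b + 1)))) fits)
    lem₁ : ∀ g k r → (g + k * r) * 2 ≡ g * 2 + 2 * k * r
    lem₁ = solve-∀
    lem₂ : ∀ g k r → g + r + 2 * k * r ≡ g + (2 * k + 1) * r
    lem₂ = solve-∀
rep-refine (suc (suc σ)) (s≤s ()) r

-- By `grid-scale` the coarse grid values are among the fine ones, so reading every `2 ^ e`-th entry
-- loses nothing; only the unit of the error changes.
rep-coarsen : ∀ {b k K J J' S R} e → K ≤ k * 2 ^ e → J * 2 ^ e ≤ J' →
              Represents (b + e) K J' S R → Represents b k J (λ i → S (i * 2 ^ e)) R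
rep-coarsen {b} {k} {K} {J} {J'} {S} {R} e K≤ J≤ r = record
  { sound = λ {i} {x} 1≤i i≤J 1≤x le → *-cancelʳ-≤ _ _ (2 ^ e) {{m^n≢0 2 e}}
      (subst₂ _≤_ (grid-scale b e i) (factor (R x)) (sound (pos 1≤i) (inside i≤J) 1≤x le))
  ; compl = λ {i} {x} 1≤i i≤J 1≤x le → compl (pos 1≤i) (inside i≤J) 1≤x (begin
      grid (b + e) (i * 2 ^ e) + K * R x ≤⟨ +-monoʳ-≤ _ (*-monoˡ-≤ (R x) K≤) ⟩
      grid (b + e) (i * 2 ^ e) + k * 2 ^ e * R x ≡⟨ cong (_+ k * 2 ^ e * R x) (grid-scale b e i) ⟩
      grid b i * 2 ^ e + k * 2 ^ e * R x ≡⟨ lem (grid b i) k (2 ^ e) (R x) ⟩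
      (grid b i + k * R x) * 2 ^ e ≤⟨ *-monoˡ-≤ (2 ^ e) le ⟩
      2 ^ b * R x * 2 ^ e ≡⟨ factor (R x) ⟨
      2 ^ (b + e) * R x ∎) }
  where
  open Represents r
  open ≤-Reasoning
  pos : ∀ {i} → 1 ≤ i → 1 ≤ i * 2 ^ e
  pos 1≤i = *-mono-≤ 1≤i (pow>0 e)
  inside : ∀ {i} → i ≤ J → i * 2 ^ e ≤ J'
  inside i≤J = ≤-trans (*-monoˡ-≤ (2 ^ e) i≤J) J≤
  factor : ∀ v → 2 ^ (b + e) * v ≡ 2 ^ b * v * 2 ^ e
  factor v = trans (cong (_* v) (^-distribˡ-+-* 2 b e)) (lem′ (2 ^ b) (2 ^ e) v)
    where
    lem′ : ∀ p q v → p * q * v ≡ p * v * q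
    lem′ = solve-∀
  lem : ∀ g k q r → g * q + k * q * r ≡ (g + k * r) * q
  lem = solve-∀

-- Merging two lists: specification and invariant

Supported : (ℕ → ℕ) → ℕ → ℕ → Set
Supported S x a = ∀ {i} → 1 ≤ i → i ≤ a → x ≤ S i

-- The third case asks for a margin of one spacing at `a`, because by `test-fails` the merging test
-- can miss a sum without it. If one argument reaches index `a` by itself, the test cannot fail and
-- no margin is required.
Enough : (b a₁ a₂ a : ℕ) → Set
Enough b a₁ a₂ a = a ≤ a₁ ⊎ a ≤ a₂ ⊎ grid b a + 2 ^ ex b a ≤ grid b a₁ + grid b a₂

-- Index 0 stands for the value 0, which every capacity reaches and for which no entry is stored;
-- hence the guards.
Justified : (b : ℕ) (S₁ S₂ : ℕ → ℕ) (x a : ℕ) → Set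
Justified b S₁ S₂ x a = ∃[ a₁ ] ∃[ a₂ ]
  (a₁ ≤ a × a₂ ≤ a × (1 ≤ a₁ → x ≤ S₁ a₁) × (1 ≤ a₂ → x ≤ S₂ a₂) × grid b a ≤ grid b a₁ + grid b a₂)

-- The bound `J` is exclusive, so that it can be the next output index. Lists are not known to be
-- nonincreasing, which is why `Supported` speaks of all entries up to an index and not only of the
-- last.
record Merged (b J : ℕ) (S₁ S₂ S : ℕ → ℕ) : Set where
  field
    sound : ∀ {a x} → 1 ≤ a → a < J → x ≤ S a → Justified b S₁ S₂ x a
    compl : ∀ {a x a₁ a₂} → 1 ≤ a → a < J → Supported S₁ x a₁ → Supported S₂ x a₂ → Enough b a₁ a₂ a → x ≤ S a

private
  last≤ : {P : ℕ → Set} → (∀ i → Dec (P i)) → ∀ j → ∃[ i ] (i ≤ j × (i ≡ 0 ⊎ P i) × (i ≡ j ⊎ ¬ P (suc i)))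
  last≤ P? zero = 0 , z≤n , inj₁ refl , inj₁ refl
  last≤ P? (suc j) with P? (suc j) | last≤ P? j
  ... | yes p | _ = suc j , ≤-refl , inj₂ p , inj₁ refl
  ... | no ¬p | i , i≤j , q , inj₁ refl = i , m≤n⇒m≤1+n i≤j , q , inj₂ ¬p
  ... | no ¬p | i , i≤j , q , inj₂ ¬q   = i , m≤n⇒m≤1+n i≤j , q , inj₂ ¬q

-- Origin of the 3: rounding each argument down to a supported index costs up to one spacing, and
-- the margin in `Enough` is a third. By `ulp≤` each of them is at most `R₁ x + R₂ x`.
rep-merge : ∀ {b k J S₁ S₂ S R₁ R₂} → Represents b k J S₁ R₁ → Represents b k J S₂ R₂ → Merged b (suc J) S₁ S₂ S →
            Represents b (k + 3) J S (λ x → R₁ x + R₂ x)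
rep-merge {b} {k} {J} {S₁} {S₂} {S} {R₁} {R₂} r₁ r₂ m = record { sound = snd ; compl = cmp }
  where
  part : ∀ {S R} → Represents b k J S R → ∀ {a x} → a ≤ J → 1 ≤ x → (1 ≤ a → x ≤ S a) → grid b a ≤ 2 ^ b * R x
  part r {zero}  a≤J 1≤x le = ≤-trans (≤-reflexive (grid-zero b)) z≤n
  part r {suc a} a≤J 1≤x le = Represents.sound r (s≤s z≤n) a≤J 1≤x (le (s≤s z≤n))
  snd : ∀ {i x} → 1 ≤ i → i ≤ J → 1 ≤ x → x ≤ S i → grid b i ≤ 2 ^ b * (R₁ x + R₂ x)
  snd {i} {x} 1≤i i≤J 1≤x le with Merged.sound m 1≤i (s≤s i≤J) le
  ... | a₁ , a₂ , a₁≤ , a₂≤ , le₁ , le₂ , g≤ = ≤-trans g≤ (≤-trans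
        (+-mono-≤ (part r₁ (≤-trans a₁≤ i≤J) 1≤x le₁) (part r₂ (≤-trans a₂≤ i≤J) 1≤x le₂))
        (≤-reflexive (sym (*-distribˡ-+ (2 ^ b) (R₁ x) (R₂ x)))))
  -- The search stops at `j`, so that the spacing lost at `a` is at most the spacing at `j`;
  -- reaching `j` falls under the other cases of `Enough`.
  best : ∀ {S R} → Represents b k J S R → ∀ {j x} → j ≤ J → 1 ≤ x →
         ∃[ a ] (Supported S x a × (a ≡ j ⊎ (2 ^ b * R x < grid b a + 2 ^ ex b j + k * R x)))
  best {S} {R} r {j} {x} j≤J 1≤x with last≤ (λ i → grid b i + k * R x ≤? 2 ^ b * R x) j
  ... | a , a≤j , q , stop = a , supp q , next stop
    where
    supp : a ≡ 0 ⊎ grid b a + k * R x ≤ 2 ^ b * R x → Supported S x a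
    supp (inj₁ refl) 1≤i i≤a = contradiction (≤-trans 1≤i i≤a) λ ()
    supp (inj₂ p)    1≤i i≤a = Represents.compl r 1≤i (≤-trans i≤a (≤-trans a≤j j≤J)) 1≤x
                                 (≤-trans (+-monoˡ-≤ (k * R x) (grid-mono b i≤a)) p)
    next : a ≡ j ⊎ ¬ (grid b (suc a) + k * R x ≤ 2 ^ b * R x) → a ≡ j ⊎ (2 ^ b * R x < grid b a + 2 ^ ex b j + k * R x)
    next (inj₁ eq) = inj₁ eq
    next (inj₂ ¬p) = inj₂ (<-≤-trans (≰⇒> ¬p) (+-monoˡ-≤ (k * R x)
      (≤-trans (≤-reflexive (grid-suc b a)) (+-monoʳ-≤ (grid b a) (^-monoʳ-≤ 2 (ex-mono b a≤j))))))
  cmp : ∀ {i x} → 1 ≤ i → i ≤ J → 1 ≤ x → grid b i + (k + 3) * (R₁ x + R₂ x) ≤ 2 ^ b * (R₁ x + R₂ x) → x ≤ S i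
  cmp {i} {x} 1≤i i≤J 1≤x le with best r₁ i≤J 1≤x | best r₂ i≤J 1≤x
  ... | a₁ , supp₁ , stop₁ | a₂ , supp₂ , stop₂ = Merged.compl m 1≤i (s≤s i≤J) supp₁ supp₂ (enough stop₁ stop₂)
    where
    R = R₁ x + R₂ x
    fits : grid b i ≤ 2 ^ b * R
    fits = ≤-trans (m≤m+n _ _) le
    R>0 : 1 ≤ R
    R>0 = n≢0⇒n>0 λ e → <⇒≱ (grid>0 b 1≤i) (subst (grid b i ≤_) (trans (cong (2 ^ b *_) e) (*-zeroʳ (2 ^ b))) fits)
    t = 2 ^ ex b i
    t≤R : t ≤ R
    t≤R = ulp≤ b i R>0 fits
    enough : a₁ ≡ i ⊎ (2 ^ b * R₁ x < grid b a₁ + t + k * R₁ x) →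
             a₂ ≡ i ⊎ (2 ^ b * R₂ x < grid b a₂ + t + k * R₂ x) → Enough b a₁ a₂ i
    enough (inj₁ eq) _ = inj₁ (≤-reflexive (sym eq))
    enough (inj₂ _) (inj₁ eq) = inj₂ (inj₁ (≤-reflexive (sym eq)))
    enough (inj₂ p) (inj₂ q) = inj₂ (inj₂ (+-cancelʳ-≤ (2 * t + k * R) _ _ (begin
      grid b i + t + (2 * t + k * R) ≡⟨ lem₁ (grid b i) t (k * R) ⟩
      grid b i + (k * R + 3 * t) ≤⟨ +-monoʳ-≤ (grid b i) (+-monoʳ-≤ (k * R) (*-monoʳ-≤ 3 t≤R)) ⟩
      grid b i + (k * R + 3 * R) ≡⟨ cong (grid b i +_) (*-distribʳ-+ R k 3) ⟨
      grid b i + (k + 3) * R ≤⟨ le ⟩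
      2 ^ b * R ≡⟨ *-distribˡ-+ (2 ^ b) (R₁ x) (R₂ x) ⟩
      2 ^ b * R₁ x + 2 ^ b * R₂ x ≤⟨ +-mono-≤ (<⇒≤ p) (<⇒≤ q) ⟩
      grid b a₁ + t + k * R₁ x + (grid b a₂ + t + k * R₂ x) ≡⟨ lem₂ (grid b a₁) (grid b a₂) t k (R₁ x) (R₂ x) ⟩
      grid b a₁ + grid b a₂ + (2 * t + k * R) ∎)))
      where
      open ≤-Reasoning
      lem₁ : ∀ g t r → g + t + (2 * t + r) ≡ g + (r + 3 * t)
      lem₁ = solve-∀
      lem₂ : ∀ g h t k r s → g + t + k * r + (h + t + k * s) ≡ g + h + (2 * t + k * (r + s))
      lem₂ = solve-∀

-- A sweep through the capacities in decreasing order. At capacity `cur` the arguments reach the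
-- indices `i₁` and `i₂`, and by `beyond` nothing that a larger capacity is bound to deliver is
-- missing from the outputs before `j`.
record Merging (b : ℕ) (S₁ S₂ S : ℕ → ℕ) (i₁ i₂ j cur : ℕ) : Set where
  field
    i₁≤j   : i₁ ≤ j
    i₂≤j   : i₂ ≤ j
    j>0    : 1 ≤ j
    cur₁   : 1 ≤ i₁ → cur ≤ S₁ i₁
    cur₂   : 1 ≤ i₂ → cur ≤ S₂ i₂
    beyond : ∀ {x a₁ a₂ a} → cur < x → Supported S₁ x a₁ → Supported S₂ x a₂ → Enough b a₁ a₂ a → a < j
    filled : Merged b j S₁ S₂ S

merging-start : ∀ {b S₁ S₂ S c} → (∀ i → S₁ i ≤ c) → (∀ i → S₂ i ≤ c) → Merging b S₁ S₂ S 0 0 1 c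
merging-start {b} {S₁} {S₂} {c = c} le₁ le₂ = record
  { i₁≤j = z≤n ; i₂≤j = z≤n ; j>0 = ≤-refl ; cur₁ = λ () ; cur₂ = λ ()
  ; beyond = λ c<x p q → none (empty le₁ c<x p) (empty le₂ c<x q)
  ; filled = record { sound = λ 1≤a a<1 → contradiction a<1 (≤⇒≯ 1≤a)
                    ; compl = λ 1≤a a<1 → contradiction a<1 (≤⇒≯ 1≤a) } }
  where
  empty : ∀ {S x a} → (∀ i → S i ≤ c) → c < x → Supported S x a → a ≡ 0
  empty {a = zero}  le c<x p = refl
  empty {a = suc a} le c<x p = contradiction (≤-trans (p (s≤s z≤n) (s≤s z≤n)) (le 1)) (<⇒≱ c<x)
  none : ∀ {a₁ a₂ a} → a₁ ≡ 0 → a₂ ≡ 0 → Enough b a₁ a₂ a → a < 1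
  none refl refl (inj₁ le)        = s≤s le
  none refl refl (inj₂ (inj₁ le)) = s≤s le
  none {a = a} refl refl (inj₂ (inj₂ le)) = contradiction
    (≤-trans (pow>0 (ex b a)) (≤-trans (m≤n+m _ (grid b a)) (≤-trans le (≤-reflexive (cong₂ _+_ (grid-zero b) (grid-zero b))))))
    λ ()

merging-end : ∀ {b J S₁ S₂ S i₁ i₂ j cur} → Merging b S₁ S₂ S i₁ i₂ j cur → J < j → Merged b (suc J) S₁ S₂ S
merging-end m J<j = record
  { sound = λ 1≤a a≤J → Merged.sound filled 1≤a (<-≤-trans a≤J J<j)
  ; compl = λ 1≤a a≤J → Merged.compl filled 1≤a (<-≤-trans a≤J J<j) }
  where open Merging m

module _ {b S₁ S₂ S i₁ i₂ j cur} (m : Merging b S₁ S₂ S i₁ i₂ j cur) where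
  open Merging m

  merging-store : ∀ {S'} → mant b j ≤ scaled b j i₁ + scaled b j i₂ → S' j ≡ cur → (∀ a → a < j → S' a ≡ S a) →
                  Merging b S₁ S₂ S' i₁ i₂ (suc j) cur
  merging-store {S'} test new old = record
    { i₁≤j = m≤n⇒m≤1+n i₁≤j ; i₂≤j = m≤n⇒m≤1+n i₂≤j ; j>0 = s≤s z≤n ; cur₁ = cur₁ ; cur₂ = cur₂
    ; beyond = λ lt p q en → m≤n⇒m≤1+n (beyond lt p q en)
    ; filled = record { sound = snd ; compl = cmp } }
    where
    snd : ∀ {a x} → 1 ≤ a → a < suc j → x ≤ S' a → Justified b S₁ S₂ x a
    snd {a} {x} 1≤a a<1+j le with m≤n⇒m<n∨m≡n (s≤s⁻¹ a<1+j)
    ... | inj₁ a<j  = Merged.sound filled 1≤a a<j (≤-trans le (≤-reflexive (old a a<j)))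
    ... | inj₂ refl = i₁ , i₂ , i₁≤j , i₂≤j , (λ p → ≤-trans x≤cur (cur₁ p)) , (λ p → ≤-trans x≤cur (cur₂ p))
                    , test-sound b i₁≤j i₂≤j test
      where
      x≤cur : x ≤ cur
      x≤cur = ≤-trans le (≤-reflexive new)
    cmp : ∀ {a x a₁ a₂} → 1 ≤ a → a < suc j → Supported S₁ x a₁ → Supported S₂ x a₂ → Enough b a₁ a₂ a → x ≤ S' a
    cmp {a} {x} 1≤a a<1+j p q en with m≤n⇒m<n∨m≡n (s≤s⁻¹ a<1+j)
    ... | inj₁ a<j  = ≤-trans (Merged.compl filled 1≤a a<j p q en) (≤-reflexive (sym (old a a<j)))
    ... | inj₂ refl = ≤-trans (≮⇒≥ λ lt → <-irrefl refl (beyond lt p q en)) (≤-reflexive (sym new))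

  -- A capacity above both next entries supports at most `i₁` and `i₂`. Since the test failed there,
  -- the sum has no margin at `j`, and still less at a later index, where value and spacing are at
  -- least as large. So the sweep may go down to the larger of the next entries.
  merging-advance : ∀ {i₁' i₂' cur'} → ¬ mant b j ≤ scaled b j i₁ + scaled b j i₂ → i₁' ≤ j → i₂' ≤ j →
                    (1 ≤ i₁' → cur' ≤ S₁ i₁') → (1 ≤ i₂' → cur' ≤ S₂ i₂') →
                    (∀ {x} → cur' < x → cur < x ⊎ (S₁ (suc i₁) < x × S₂ (suc i₂) < x)) →
                    Merging b S₁ S₂ S i₁' i₂' j cur'
  merging-advance {i₁'} {i₂'} {cur'} ¬test i₁'≤ i₂'≤ c₁ c₂ drop = record
    { i₁≤j = i₁'≤ ; i₂≤j = i₂'≤ ; j>0 = j>0 ; cur₁ = c₁ ; cur₂ = c₂ ; beyond = bey ; filled = filled }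
    where
    below : ∀ {S x a i} → Supported S x a → S (suc i) < x → a ≤ i
    below p lt = ≮⇒≥ λ i<a → <⇒≱ lt (p (s≤s z≤n) i<a)
    bey : ∀ {x a₁ a₂ a} → cur' < x → Supported S₁ x a₁ → Supported S₂ x a₂ → Enough b a₁ a₂ a → a < j
    bey {x} {a₁} {a₂} {a} lt p q en with drop lt
    ... | inj₁ lt' = beyond lt' p q en
    ... | inj₂ (lt₁ , lt₂) = by en
      where
      a₁≤i₁ = below {S₁} p lt₁
      a₂≤i₂ = below {S₂} q lt₂
      by : Enough b a₁ a₂ a → a < j
      by (inj₁ le)        = ≤-<-trans (≤-trans le a₁≤i₁) (test-fails-ˡ b i₁≤j i₂≤j ¬test)
      by (inj₂ (inj₁ le)) = ≤-<-trans (≤-trans le a₂≤i₂) (test-fails-ʳ b i₁≤j i₂≤j ¬test)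
      by (inj₂ (inj₂ le)) = ≰⇒> λ j≤a → <-irrefl refl (begin-strict
        grid b i₁ + grid b i₂ <⟨ test-fails b i₁≤j i₂≤j ¬test ⟩
        grid b j + 2 ^ ex b j ≤⟨ +-mono-≤ (grid-mono b j≤a) (^-monoʳ-≤ 2 (ex-mono b j≤a)) ⟩
        grid b a + 2 ^ ex b a ≤⟨ le ⟩
        grid b a₁ + grid b a₂ ≤⟨ +-mono-≤ (grid-mono b a₁≤i₁) (grid-mono b a₂≤i₂) ⟩
        grid b i₁ + grid b i₂ ∎)
        where open ≤-Reasoning

-- The merging program

-- Registers 0–11, the scratch registers of the innermost loops.  Eta for
-- records lets any concrete list of values be read as such a block.
record Scratch : Set where
  constructor scratch
  field
    w₀ w₁ w₂ w₃ w₄ w₅ w₆ w₇ w₈ w₉ w₁₀ w₁₁ : ℕ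
open Scratch

infixr 5 _⊹_
_⊹_ : Scratch → List ℕ → List ℕ
w ⊹ ρ = w₀ w ∷ w₁ w ∷ w₂ w ∷ w₃ w ∷ w₄ w ∷ w₅ w ∷ w₆ w ∷ w₇ w ∷ w₈ w ∷ w₉ w ∷ w₁₀ w ∷ w₁₁ w ∷ ρ

loadMant : Var → Var → Var → Program → Program
loadMant E M i P = E ≔ reg i ≫ reg 16 ⨾ E ≔ reg E ⊖ lit 1 ⨾ M ≔ reg E ≪ reg 16 ⨾ M ≔ reg i ⊖ reg M ⨾ P

loadScaled : Var → Var → Var → Program → Program
loadScaled E M i P = loadMant E M i (E ≔ reg 4 ⊖ reg E ⨾ M ≔ reg M ≫ reg E ⨾ P)

loadNext : Var → Var → Var → Program → Program
loadNext x i p P = x ≔ lit 1 ⊕ reg i ⨾ x ≔ reg x ⊕ reg 15 ⨾ x ≔ reg x ≫ reg 15 ⨾ x ≔ reg p ⊕ reg x ⨾ x ≔ val (cell 5 x) ⨾ P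

-- The pointer with the larger next entry advances. Taking the minimum with the current capacity
-- keeps the sweep decreasing in whatever order the entries come.
mergeAdvance : Program
mergeAdvance =
  loadNext 10 0 12 (loadNext 11 1 13 (
  (IF reg 10 <' reg 11 THEN (10 ≔ val (reg 11) ⨾ 1 ≔ lit 1 ⊕ reg 1) ELSE (0 ≔ lit 1 ⊕ reg 0)) ⨾
  (IF reg 10 <' reg 3 THEN (3 ≔ val (reg 10)) ELSE (3 ≔ val (reg 3)))))

mergeStore : Program
mergeStore = 10 ≔ reg 14 ⊕ reg 2 ⨾ 5 [ 10 ]≔ val (reg 3) ⨾ 2 ≔ lit 1 ⊕ reg 2

mergeBody : Program
mergeBody =
  loadMant 4 5 2 (loadScaled 6 7 0 (loadScaled 8 9 1 (
  7 ≔ reg 7 ⊕ reg 9 ⨾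
  (IF reg 5 ≤' reg 7 THEN mergeStore ELSE mergeAdvance))))

-- Merges the lists of array 5 stored behind addresses r12 and r13, both read
-- at the possibly finer precision r16, into the list behind address r14.
merge : Program
merge = 0 ≔ val (lit 0) ⨾ 1 ≔ val (lit 0) ⨾ 2 ≔ val (lit 1) ⨾ 3 ≔ val (reg 34) ⨾
        (WHILE reg 2 ≤' reg 17 DO mergeBody)

[↦]-same : {A : Set} (f : ℕ → A) (i : ℕ) (v : A) → (f [ i ↦ v ]) i ≡ v
[↦]-same f zero    v = refl
[↦]-same f (suc i) v = [↦]-same (λ z → f (suc z)) i v

[↦]-other : {A : Set} (f : ℕ → A) {i j : ℕ} (v : A) → j ≢ i → (f [ i ↦ v ]) j ≡ f j
[↦]-other f {zero}  {zero}  v j≢i = contradiction refl j≢i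
[↦]-other f {zero}  {suc j} v j≢i = refl
[↦]-other f {suc i} {zero}  v j≢i = refl
[↦]-other f {suc i} {suc j} v j≢i = [↦]-other (λ z → f (suc z)) v λ e → j≢i (cong suc e)

[↦]-bound : (f : ℕ → ℕ) {i v c : ℕ} → v ≤ c → (∀ z → f z ≤ c) → ∀ z → (f [ i ↦ v ]) z ≤ c
[↦]-bound f {i} {v} v≤ f≤ z with z ≡ᵇ i
... | true  = v≤
... | false = f≤ z

-- A list is indexed from 1, so it occupies the cells after `base`, and `base` itself is the last
-- cell of what precedes it.
Outside : (base J z : ℕ) → Set
Outside base J z = z ≤ base ⊎ base + J < z

outside-≢ : ∀ {base J z j} → Outside base J z → 1 ≤ j → j ≤ J → z ≢ base + j
outside-≢ {base} (inj₁ z≤) 1≤j j≤J refl = <⇒≱ (m<m+n base 1≤j) z≤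
outside-≢ {base} (inj₂ lt) 1≤j j≤J refl = <⇒≱ lt (+-monoʳ-≤ base j≤J)

-- A refined list is never written out, but read through the index map of `rep-refine`.
virtual : (Q : ℕ → ℕ) (base σ : ℕ) → ℕ → ℕ
virtual Q base σ i = Q (base + shr (i + σ) σ)

module MergeRun (n C V u : ℕ)
  (word-V : Timed.wordTime n C V ≤ u) (number-C : Timed.numberTime n C (suc C) ≤ u) where
  open Cost n C V u word-V number-C

  module _ (sr tg wt dn F : ℕ → ℕ) (p₁ p₂ pw σ b J : ℕ) (ρ : List ℕ) (Q₀ : ℕ → ℕ)
    (cap-reg : lookup 0 ρ 16 ≡ suc C) (σ≤1 : σ ≤ 1) (b≤V : b ≤ V) (room : suc J + suc J ≤ V)
    (word₁ : ∀ {i} → i ≤ J → p₁ + shr (i + σ) σ ≤ V) (word₂ : ∀ {i} → i ≤ J → p₂ + shr (i + σ) σ ≤ V)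
    (wordₒ : pw + J ≤ V)
    (out₁ : ∀ {i} → 1 ≤ i → i ≤ J → Outside pw J (p₁ + shr (i + σ) σ))
    (out₂ : ∀ {i} → 1 ≤ i → i ≤ J → Outside pw J (p₂ + shr (i + σ) σ))
    (Q₀≤ : ∀ z → Q₀ z ≤ suc C) where

    private
      S₁ S₂ : ℕ → ℕ
      S₁ = virtual Q₀ p₁ σ
      S₂ = virtual Q₀ p₂ σ

    at : Scratch → (ℕ → ℕ) → Env
    at w Q = (w ⊹ p₁ ∷ p₂ ∷ pw ∷ σ ∷ b ∷ J ∷ ρ) , (sr ∷ tg ∷ wt ∷ dn ∷ F ∷ Q ∷ [])

    private
      record Progress (w : Scratch) (Q : ℕ → ℕ) : Set where
        constructor progress
        field
          merging : Merging b S₁ S₂ (λ i → Q (pw + i)) (w₀ w) (w₁ w) (w₂ w) (w₃ w)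
          same    : ∀ {z} → Outside pw J z → Q z ≡ Q₀ z
          bound   : ∀ z → Q z ≤ suc C
          cur≤    : w₃ w ≤ suc C

      -- Each round advances exactly one of the indices `i₁`, `i₂` and `j`, and none of them exceeds
      -- `suc J`. Hence the time is linear in `J`.
      Inv : ℕ → Env → Set
      Inv r e = ∃[ w ] ∃[ Q ] (e ≡ at w Q × Progress w Q × w₀ w + w₁ w + w₂ w + r ≡ 3 * suc J)

      J+1≤V : suc J ≤ V
      J+1≤V = ≤-trans (m≤m+n (suc J) (suc J)) room

      J≤V : J ≤ V
      J≤V = ≤-trans (n≤1+n J) J+1≤V

      1≤V : 1 ≤ V
      1≤V = ≤-trans (s≤s z≤n) J+1≤V

      module _ (i₁ i₂ j cur : ℕ) (Q : ℕ → ℕ) (j≤J : j ≤ J)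
        (merging : Merging b S₁ S₂ (λ i → Q (pw + i)) i₁ i₂ j cur)
        (same    : ∀ {z} → Outside pw J z → Q z ≡ Q₀ z)
        (bound   : ∀ z → Q z ≤ suc C)
        (cur≤    : cur ≤ suc C) where
        open Merging merging

        store-step : ∀ {y₄ y₅ y₆ y₇ y₈ y₉ y₁₀ y₁₁ r} →
          i₁ + i₂ + j + suc r ≡ 3 * suc J → mant b j ≤ scaled b j i₁ + scaled b j i₂ →
          Reach mergeStore (at (scratch i₁ i₂ j cur y₄ y₅ y₆ y₇ y₈ y₉ y₁₀ y₁₁) Q) 3 (Inv r)
        store-step {r = r} meas test =
          (tt , tt , word pw+j≤V) ►
          chain (put pw+j≤V (tt , cap cur≤)
            (set (tt , tt , word (≤-trans (s≤s j≤J) J+1≤V))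
              (_ , _ , refl , progress
                (merging-store merging test ([↦]-same Q (pw + j) cur)
                  λ a a<j → [↦]-other Q cur λ e → <⇒≢ a<j (+-cancelˡ-≡ pw a j e))
                (λ out → trans ([↦]-other Q cur (outside-≢ out j>0 j≤J)) (same out))
                ([↦]-bound Q cur≤ bound) cur≤
              , trans (lem i₁ i₂ j r) meas)))
          where
          pw+j≤V : pw + j ≤ V
          pw+j≤V = ≤-trans (+-monoʳ-≤ pw j≤J) wordₒ
          lem : ∀ i₁ i₂ j r → i₁ + i₂ + suc j + r ≡ i₁ + i₂ + j + suc r
          lem = solve-∀

        module _ (¬test : ¬ mant b j ≤ scaled b j i₁ + scaled b j i₂) where

          lower-cur : ∀ {i₁' i₂' y₄ y₅ y₆ y₇ y₈ y₉ x y₁₁ r} → i₁' ≤ j → i₂' ≤ j →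
            (1 ≤ i₁' → cur ≤ S₁ i₁' ⊎ x ≤ S₁ i₁') → (1 ≤ i₂' → cur ≤ S₂ i₂' ⊎ x ≤ S₂ i₂') →
            (∀ {y} → x < y → S₁ (suc i₁) < y × S₂ (suc i₂) < y) → i₁' + i₂' + j + r ≡ 3 * suc J →
            Reach (IF reg 10 <' reg 3 THEN (3 ≔ val (reg 10)) ELSE (3 ≔ val (reg 3)))
              (at (scratch i₁' i₂' j cur y₄ y₅ y₆ y₇ y₈ y₉ x y₁₁) Q) 2 (Inv r)
          lower-cur {i₁'} {i₂'} {x = x} le₁ le₂ c₁ c₂ drop meas = branch (tt , tt , inj₂ (cap cur≤))
            (λ x<cur → set (tt , cap (≤-trans (<⇒≤ x<cur) cur≤))
              (_ , _ , refl , progress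
                (merging-advance merging ¬test le₁ le₂
                  (λ p → by-x x<cur (c₁ p)) (λ p → by-x x<cur (c₂ p)) (λ lt → inj₂ (drop lt)))
                same bound (≤-trans (<⇒≤ x<cur) cur≤) , meas))
            (λ x≮cur → set (tt , cap cur≤)
              (_ , _ , refl , progress
                (merging-advance merging ¬test le₁ le₂
                  (λ p → by-cur (≮⇒≥ x≮cur) (c₁ p)) (λ p → by-cur (≮⇒≥ x≮cur) (c₂ p)) inj₁)
                same bound cur≤ , meas))
            where
            by-x : ∀ {v} → x < cur → cur ≤ v ⊎ x ≤ v → x ≤ v
            by-x lt (inj₁ p) = ≤-trans (<⇒≤ lt) p
            by-x lt (inj₂ p) = p
            by-cur : ∀ {v} → cur ≤ x → cur ≤ v ⊎ x ≤ v → cur ≤ v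
            by-cur le (inj₁ p) = p
            by-cur le (inj₂ p) = ≤-trans le p

          private
            i₁<j : i₁ < j
            i₁<j = test-fails-ˡ b i₁≤j i₂≤j ¬test
            i₂<j : i₂ < j
            i₂<j = test-fails-ʳ b i₁≤j i₂≤j ¬test
            ahead : ∀ {i} → i < j → suc i + σ ≤ V
            ahead i<j = ≤-trans (+-mono-≤ (≤-trans i<j (≤-trans j≤J (n≤1+n J))) (≤-trans σ≤1 (s≤s z≤n))) room
            next≤V : ∀ {i} → i < j → suc i ≤ V
            next≤V i<j = ≤-trans i<j (≤-trans j≤J J≤V)
            σ≤V : σ ≤ V
            σ≤V = ≤-trans σ≤1 1≤V
            x₁≡ : virtual Q p₁ σ (suc i₁) ≡ S₁ (suc i₁)
            x₁≡ = same (out₁ (s≤s z≤n) (≤-trans i₁<j j≤J))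
            x₂≡ : virtual Q p₂ σ (suc i₂) ≡ S₂ (suc i₂)
            x₂≡ = same (out₂ (s≤s z≤n) (≤-trans i₂<j j≤J))

          advance-step : ∀ {y₄ y₅ y₆ y₇ y₈ y₉ y₁₀ y₁₁ r} → i₁ + i₂ + j + suc r ≡ 3 * suc J →
            Reach mergeAdvance (at (scratch i₁ i₂ j cur y₄ y₅ y₆ y₇ y₈ y₉ y₁₀ y₁₁) Q) 15 (Inv r)
          advance-step {y₄} {y₅} {y₆} {y₇} {y₈} {y₉} {y₁₁ = y₁₁} {r} meas =
            (tt , tt , word (next≤V i₁<j)) ►
            (tt , tt , word (ahead i₁<j)) ►
            (tt , tt , σ≤V , ahead i₁<j) ►
            (tt , tt , word (word₁ (≤-trans i₁<j j≤J))) ►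
            (word₁ (≤-trans i₁<j j≤J) , cap (bound _)) ►
            from (at (scratch i₁ i₂ j cur y₄ y₅ y₆ y₇ y₈ y₉ (virtual Q p₁ σ (suc i₁)) y₁₁) Q) refl (
            (tt , tt , word (next≤V i₂<j)) ►
            (tt , tt , word (ahead i₂<j)) ►
            (tt , tt , σ≤V , ahead i₂<j) ►
            (tt , tt , word (word₂ (≤-trans i₂<j j≤J))) ►
            (word₂ (≤-trans i₂<j j≤J) , cap (bound _)) ►
            from (at (scratch i₁ i₂ j cur y₄ y₅ y₆ y₇ y₈ y₉ (virtual Q p₁ σ (suc i₁)) (virtual Q p₂ σ (suc i₂))) Q) refl (
            chain {k = 3} {k' = 2} (branch (tt , tt , inj₁ (cap (bound _)))
              (λ x₁<x₂ → (tt , cap (bound _)) ► set (tt , tt , word (next≤V i₂<j))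
                (lower-cur i₁≤j i₂<j (λ p → inj₁ (cur₁ p)) (λ _ → inj₂ (≤-reflexive x₂≡))
                  (λ {y} lt → subst (_< y) x₁≡ (<-trans x₁<x₂ lt) , subst (_< y) x₂≡ lt)
                  (trans (lem₂ i₁ i₂ j r) meas)))
              (λ x₁≮x₂ → relax (n≤1+n 1) (set (tt , tt , word (next≤V i₁<j))
                (lower-cur i₁<j i₂≤j (λ _ → inj₂ (≤-reflexive x₁≡)) (λ p → inj₁ (cur₂ p))
                  (λ {y} lt → subst (_< y) x₁≡ lt , subst (_< y) x₂≡ (≤-<-trans (≮⇒≥ x₁≮x₂) lt))
                  (trans (lem₁ i₁ i₂ j r) meas)))))))
            where
            lem₁ : ∀ i₁ i₂ j r → suc i₁ + i₂ + j + r ≡ i₁ + i₂ + j + suc r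
            lem₁ = solve-∀
            lem₂ : ∀ i₁ i₂ j r → i₁ + suc i₂ + j + r ≡ i₁ + i₂ + j + suc r
            lem₂ = solve-∀

        -- The 33 units are 16 for the three mantissas, one for their sum, one for the test, and 15
        -- for the longer branch.
        body-step : ∀ {y₄ y₅ y₆ y₇ y₈ y₉ y₁₀ y₁₁ r} → i₁ + i₂ + j + suc r ≡ 3 * suc J →
          Reach mergeBody (at (scratch i₁ i₂ j cur y₄ y₅ y₆ y₇ y₈ y₉ y₁₀ y₁₁) Q) 33 (Inv r)
        body-step {y₆ = y₆} {y₇} {y₈} {y₉} {y₁₀} {y₁₁} meas =
          (tt , tt , b≤V , small ≤-refl) ►
          (tt , tt , word (small (shr≤ j b)) , word 1≤V) ►
          (tt , tt , b≤V , small (ex-lower b j)) ►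
          (tt , tt , word (small ≤-refl) , word (small (ex-lower b j))) ►
          from (at (scratch i₁ i₂ j cur (ex b j) (mant b j) y₆ y₇ y₈ y₉ y₁₀ y₁₁) Q) refl (
          (tt , tt , b≤V , small i₁≤j) ►
          (tt , tt , word (small (≤-trans (shr≤ i₁ b) i₁≤j)) , word 1≤V) ►
          (tt , tt , b≤V , small (≤-trans (ex-lower b i₁) i₁≤j)) ►
          (tt , tt , word (small i₁≤j) , word (small (≤-trans (ex-lower b i₁) i₁≤j))) ►
          (tt , tt , word (ex≤V ≤-refl) , word (ex≤V i₁≤j)) ►
          (tt , tt , ≤-trans (m∸n≤m _ (ex b i₁)) (ex≤V ≤-refl) , small (≤-trans (m∸n≤m i₁ (ex b i₁ * 2 ^ b)) i₁≤j)) ►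
          from (at (scratch i₁ i₂ j cur (ex b j) (mant b j) (ex b j ∸ ex b i₁) (scaled b j i₁) y₈ y₉ y₁₀ y₁₁) Q) refl (
          (tt , tt , b≤V , small i₂≤j) ►
          (tt , tt , word (small (≤-trans (shr≤ i₂ b) i₂≤j)) , word 1≤V) ►
          (tt , tt , b≤V , small (≤-trans (ex-lower b i₂) i₂≤j)) ►
          (tt , tt , word (small i₂≤j) , word (small (≤-trans (ex-lower b i₂) i₂≤j))) ►
          (tt , tt , word (ex≤V ≤-refl) , word (ex≤V i₂≤j)) ►
          (tt , tt , ≤-trans (m∸n≤m _ (ex b i₂)) (ex≤V ≤-refl) , small (≤-trans (m∸n≤m i₂ (ex b i₂ * 2 ^ b)) i₂≤j)) ►
          from (at (scratch i₁ i₂ j cur (ex b j) (mant b j) (ex b j ∸ ex b i₁) (scaled b j i₁) (ex b j ∸ ex b i₂) (scaled b j i₂) y₁₀ y₁₁) Q) refl (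
          (tt , tt , word sum≤V) ►
          branch (tt , tt , inj₁ (word (small (m∸n≤m j (ex b j * 2 ^ b)))))
            (λ test → relax (m≤m+n 3 12) (store-step meas test))
            (λ ¬test → advance-step ¬test meas))))
          where
          small : ∀ {v} → v ≤ j → v ≤ V
          small le = ≤-trans le (≤-trans j≤J J≤V)
          ex≤V : ∀ {i} → i ≤ j → ex b i ≤ V
          ex≤V {i} i≤j = small (≤-trans (m∸n≤m (shr i b) 1) (≤-trans (shr≤ i b) i≤j))
          scaled≤ : ∀ {i} → i ≤ j → scaled b j i ≤ suc J
          scaled≤ {i} i≤j = ≤-trans (shr≤ (mant b i) (ex b j ∸ ex b i)) (≤-trans (m∸n≤m i (ex b i * 2 ^ b)) (≤-trans i≤j (≤-trans j≤J (n≤1+n J))))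
          sum≤V : scaled b j i₁ + scaled b j i₂ ≤ V
          sum≤V = ≤-trans (+-mono-≤ (scaled≤ i₁≤j) (scaled≤ i₂≤j)) room

    MergeDone : Env → Set
    MergeDone e = ∃[ w ] ∃[ Q ] (e ≡ at w Q × Merged b (suc J) S₁ S₂ (λ i → Q (pw + i))
      × (∀ {z} → Outside pw J z → Q z ≡ Q₀ z) × (∀ z → Q z ≤ suc C))

    merge-run : ∀ w → Reach merge (at w Q₀) (4 + (suc (suc (3 * J)) * 34 + 1)) MergeDone
    merge-run w =
      (tt , word z≤n) ► (tt , word z≤n) ► (tt , word 1≤V) ► (tt , cap (≤-reflexive cap-reg)) ►
      for 33 Inv step (suc (suc (3 * J))) _
        (_ , _ , refl , progress (merging-start (λ i → cap≤ (Q₀≤ _)) (λ i → cap≤ (Q₀≤ _)))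
          (λ _ → refl) Q₀≤ (≤-reflexive cap-reg) , lem J)
      where
      cap≤ : ∀ {v} → v ≤ suc C → v ≤ lookup 0 ρ 16
      cap≤ {v} = subst (v ≤_) (sym cap-reg)
      lem : ∀ J → 0 + 0 + 1 + suc (suc (3 * J)) ≡ 3 * suc J
      lem = solve-∀
      step : ∀ r e → Inv r e → CheapT (reg 2 ≤' reg 17) e ×
        ((True (reg 2 ≤' reg 17) (toState e) × ∃[ r' ] (r ≡ suc r' × Reach mergeBody e 33 (Inv r')))
         ⊎ (False (reg 2 ≤' reg 17) (toState e) × MergeDone e))
      step r e (w , Q , refl , progress merging same bound cur≤ , meas) = (tt , tt , inj₂ (word J≤V)) , go (w₂ w ≤? J) r meas
        where
        open Merging merging
        go : Dec (w₂ w ≤ J) → ∀ r → w₀ w + w₁ w + w₂ w + r ≡ 3 * suc J →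
          (w₂ w ≤ J × ∃[ r' ] (r ≡ suc r' × Reach mergeBody (at w Q) 33 (Inv r')))
          ⊎ (¬ w₂ w ≤ J × MergeDone (at w Q))
        go (no ¬p)   r       meas = inj₂ (¬p , w , Q , refl , merging-end merging (≰⇒> ¬p) , same , bound)
        go (yes j≤J) (suc r) meas = inj₁ (j≤J , r , refl , body-step _ _ _ _ Q j≤J merging same bound cur≤ meas)
        go (yes j≤J) zero    meas = contradiction meas (<⇒≢ (subst (_< 3 * suc J) (sym (+-identityʳ _)) (begin-strict
          w₀ w + w₁ w + w₂ w ≤⟨ +-mono-≤ (+-mono-≤ (≤-trans i₁≤j j≤J) (≤-trans i₂≤j j≤J)) j≤J ⟩
          J + J + J <⟨ m<m+n (J + J + J) (s≤s z≤n) ⟩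
          J + J + J + 3 ≡⟨ lem′ J ⟩
          3 * suc J ∎)))
          where
          open ≤-Reasoning
          lem′ : ∀ J → J + J + J + 3 ≡ 3 * suc J
          lem′ = solve-∀

-- Merging the lists of all outgoing arcs

-- A list left without a partner is merged with the cells behind `Z`, which stay zero and represent
-- the zero function.
secondList rowStep rows level levels : Program
secondList = IF reg 18 <' reg 20 THEN (13 ≔ reg 12 ⊕ reg 19) ELSE (13 ≔ val (reg 33))
rowStep = 12 ≔ reg 12 ⊕ reg 19 ⨾ 12 ≔ reg 12 ⊕ reg 19 ⨾ 14 ≔ reg 14 ⊕ reg 17 ⨾ 18 ≔ lit 2 ⊕ reg 18
rows = WHILE reg 18 ≤' reg 20 DO (secondList ⨾ merge ⨾ rowStep)

-- Merges the y + 1 lists of length r17 starting at r21 in pairs; register 15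
-- tells whether the precision is to be raised by one bit.
level =
  19 ≔ val (reg 17) ⨾ 17 ≔ reg 17 ≪ reg 15 ⨾ 16 ≔ reg 16 ⊕ reg 15 ⨾
  12 ≔ val (reg 21) ⨾ 14 ≔ val (reg 22) ⨾ 18 ≔ val (lit 0) ⨾ rows ⨾
  21 ≔ val (reg 22) ⨾ 22 ≔ val (reg 14) ⨾ 20 ≔ reg 20 ≫ lit 1 ⨾ 15 ≔ lit 1 ⊖ reg 15

levels = WHILE lit 0 <' reg 20 DO level

mergeCost : ℕ → ℕ
mergeCost J = 4 + (suc (suc (3 * J)) * 34 + 1)

module LevelRun (n C V u : ℕ)
  (word-V : Timed.wordTime n C V ≤ u) (number-C : Timed.numberTime n C (suc C) ≤ u)
  (sr tg wt dn F : ℕ → ℕ) (Z : ℕ) (ρ : List ℕ)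
  (Z-reg : lookup 0 ρ 10 ≡ Z) (C-reg : lookup 0 ρ 11 ≡ suc C) (room : suc Z + suc Z ≤ V) where
  open Cost n C V u word-V number-C
  open MergeRun n C V u word-V number-C

  private
    Z<V : Z < V
    Z<V = ≤-trans (m≤m+n (suc Z) (suc Z)) room

    1≤V : 1 ≤ V
    1≤V = ≤-trans (s≤s z≤n) Z<V

  atL : Scratch → (p₁ p₂ pw σ b J q Jo y rd wr : ℕ) → (ℕ → ℕ) → Env
  atL w p₁ p₂ pw σ b J q Jo y rd wr Q =
    (w ⊹ p₁ ∷ p₂ ∷ pw ∷ σ ∷ b ∷ J ∷ q ∷ Jo ∷ y ∷ rd ∷ wr ∷ ρ) , (sr ∷ tg ∷ wt ∷ dn ∷ F ∷ Q ∷ [])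

  paired : (ℕ → ℕ → ℕ) → ℕ → ℕ → ℕ
  paired R p x = R (p * 2) x + R (suc (p * 2)) x

  -- The number of rows for `y + 1` lists, that is, half of `y + 1` rounded up. Counting lists minus
  -- one turns this into a shift of `y`.
  halves : ℕ → ℕ
  halves y = suc (shr y 1)

  module Rows (σ b₀ K Jo y rd wr : ℕ) (Q₀ : ℕ → ℕ) (R : ℕ → ℕ → ℕ)
    (σ≤1 : σ ≤ 1) (b≤V : b₀ + σ ≤ V) (Jo>0 : 1 ≤ Jo)
    (src-room : rd + suc y * Jo ≤ wr) (dst-room : wr + halves y * (Jo * 2 ^ σ) ≤ Z)
    (zeros : ∀ {z} → Z < z → Q₀ z ≡ 0) (Q₀≤ : ∀ z → Q₀ z ≤ suc C)
    (reps : ∀ {p} → p ≤ y → Represents b₀ K Jo (λ i → Q₀ (rd + p * Jo + i)) (R p))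
    (R-zero : ∀ {p} → y < p → ∀ x → R p x ≡ 0) where

    J b h : ℕ
    J = Jo * 2 ^ σ
    b = b₀ + σ
    h = halves y

    Results : ℕ → (ℕ → ℕ) → Set
    Results p Q = ∀ {p'} → p' < p → Represents b (2 ^ σ * K + σ + 3) J (λ i → Q (wr + p' * J + i)) (paired R p')

    Inv : ℕ → Env → Set
    Inv r e = ∃[ w ] ∃[ p₁ ] ∃[ p₂ ] ∃[ pw ] ∃[ p ] ∃[ Q ]
      (e ≡ atL w p₁ p₂ pw σ b J (p * 2) Jo y rd wr Q
       × p₁ ≡ rd + p * 2 * Jo × pw ≡ wr + p * J × p + r ≡ h
       × (∀ {z} → Outside wr (h * J) z → Q z ≡ Q₀ z) × (∀ z → Q z ≤ suc C) × Results p Q)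

    Jo≤J : Jo ≤ J
    Jo≤J = m≤m*n Jo (2 ^ σ) {{m^n≢0 2 σ}}

    wr≤Z : wr ≤ Z
    wr≤Z = ≤-trans (m≤m+n wr (h * J)) dst-room

    J≤Z : J ≤ Z
    J≤Z = ≤-trans (m≤n*m J h) (≤-trans (m≤n+m (h * J) wr) dst-room)

    2+y≤V : 2 + y ≤ V
    2+y≤V = ≤-trans (s≤s (≤-trans (m≤m*n (suc y) Jo {{>-nonZero Jo>0}})
      (≤-trans (m≤n+m (suc y * Jo) rd) (≤-trans src-room wr≤Z)))) Z<V

    module _ (w : Scratch) (p : ℕ) (Q : ℕ → ℕ) (p<h : p < h) (2p≤y : p * 2 ≤ y)
      (same : ∀ {z} → Outside wr (h * J) z → Q z ≡ Q₀ z) (Q≤ : ∀ z → Q z ≤ suc C) (done : Results p Q) where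
      private
        p₁ pw : ℕ
        p₁ = rd + p * 2 * Jo
        pw = wr + p * J
        list-end : ∀ {i} → i ≤ y → rd + i * Jo + Jo ≤ wr
        list-end {i} i≤y = begin
          rd + i * Jo + Jo ≡⟨ lem rd (i * Jo) Jo ⟩
          rd + suc i * Jo ≤⟨ +-monoʳ-≤ rd (*-monoˡ-≤ Jo (s≤s i≤y)) ⟩
          rd + suc y * Jo ≤⟨ src-room ⟩
          wr ∎
          where
          open ≤-Reasoning
          lem : ∀ a b c → a + b + c ≡ a + (c + b)
          lem = solve-∀
        pw-end : pw + J ≤ wr + h * J
        pw-end = begin
          wr + p * J + J ≡⟨ lem wr (p * J) J ⟩
          wr + suc p * J ≤⟨ +-monoʳ-≤ wr (*-monoˡ-≤ J p<h) ⟩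
          wr + h * J ∎
          where
          open ≤-Reasoning
          lem : ∀ a b c → a + b + c ≡ a + (c + b)
          lem = solve-∀
        pw+J≤Z : pw + J ≤ Z
        pw+J≤Z = ≤-trans pw-end dst-room
        source : ∀ {a} → a + Jo ≤ wr → ∀ {i} → i ≤ Jo → Q (a + i) ≡ Q₀ (a + i)
        source {a} le i≤ = same (inj₁ (≤-trans (+-monoʳ-≤ a i≤) le))

      module _ (p₂ : ℕ) (word₂ : p₂ + Jo ≤ V)
        (out₂ : ∀ {i} → 1 ≤ i → i ≤ Jo → Outside pw J (p₂ + i))
        (rep₂ : Represents b₀ K Jo (λ i → Q (p₂ + i)) (R (suc (p * 2)))) where

        row-rest : ∀ {r} → p + suc r ≡ h →
          Reach (merge ⨾ rowStep) (atL w p₁ p₂ pw σ b J (p * 2) Jo y rd wr Q) (mergeCost J + 4) (Inv r)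
        row-rest {r} meas = chain (conseq
          (merge-run sr tg wt dn F p₁ p₂ pw σ b J _ Q C-reg σ≤1 b≤V (≤-trans (+-mono-≤ (s≤s J≤Z) (s≤s J≤Z)) room)
            (λ i≤J → ≤-trans (+-monoʳ-≤ p₁ (shr-index σ≤1 i≤J)) (≤-trans (list-end 2p≤y) (≤-trans wr≤Z (<⇒≤ Z<V))))
            (λ i≤J → ≤-trans (+-monoʳ-≤ p₂ (shr-index σ≤1 i≤J)) word₂)
            (≤-trans pw+J≤Z (<⇒≤ Z<V))
            (λ 1≤i i≤J → inj₁ (≤-trans (+-monoʳ-≤ p₁ (shr-index σ≤1 i≤J)) (≤-trans (list-end 2p≤y) (m≤m+n wr (p * J)))))
            (λ 1≤i i≤J → out₂ (shr-index>0 σ≤1 1≤i) (shr-index σ≤1 i≤J))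
            Q≤ w)
          λ { _ (w' , Q' , refl , merged , same' , Q'≤) → after w' Q' merged same' Q'≤ })
          where
          after : ∀ w' Q' → Merged b (suc J) (virtual Q p₁ σ) (virtual Q p₂ σ) (λ i → Q' (pw + i)) →
                  (∀ {z} → Outside pw J z → Q' z ≡ Q z) → (∀ z → Q' z ≤ suc C) →
                  Reach rowStep (atL w' p₁ p₂ pw σ b J (p * 2) Jo y rd wr Q') 4 (Inv r)
          after w' Q' merged same' Q'≤ =
            (tt , tt , word (≤-trans (list-end 2p≤y) (≤-trans wr≤Z (<⇒≤ Z<V)))) ►
            (tt , tt , word (≤-trans (+-monoˡ-≤ Jo (≤-trans (list-end 2p≤y) wr≤Z)) (≤-trans (+-mono-≤ (n≤1+n Z) (≤-trans Jo≤J (m≤n⇒m≤1+n J≤Z))) room))) ►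
            (tt , tt , word (≤-trans pw+J≤Z (<⇒≤ Z<V))) ►
            set (tt , tt , word (≤-trans (+-monoʳ-≤ 2 2p≤y) 2+y≤V))
              (w' , _ , p₂ , _ , suc p , Q' , refl , lem₁ rd (p * 2) Jo , lem₂ wr (p * J) J , trans (sym (+-suc p r)) meas
              , (λ out → trans (same' (narrow out)) (same out)) , Q'≤ , results)
            where
            lem₁ : ∀ a q c → a + q * c + c + c ≡ a + suc (suc q) * c
            lem₁ = solve-∀
            lem₂ : ∀ a b c → a + b + c ≡ a + (c + b)
            lem₂ = solve-∀
            narrow : ∀ {z} → Outside wr (h * J) z → Outside pw J z
            narrow (inj₁ z≤) = inj₁ (≤-trans z≤ (m≤m+n wr (p * J)))
            narrow (inj₂ lt) = inj₂ (≤-<-trans pw-end lt)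
            rep₁ : Represents b₀ K Jo (λ i → Q (p₁ + i)) (R (p * 2))
            rep₁ = rep-cong {b₀} {K} {Jo} (λ i 1≤i i≤ → sym (source (list-end 2p≤y) i≤)) (λ _ _ → refl) (reps 2p≤y)
            results : Results (suc p) Q'
            results {p'} p'≤p with m≤n⇒m<n∨m≡n (s≤s⁻¹ p'≤p)
            ... | inj₂ refl = rep-merge {b} {2 ^ σ * K + σ} {J} {virtual Q p₁ σ} {virtual Q p₂ σ}
                                (rep-refine σ σ≤1 rep₁) (rep-refine σ σ≤1 rep₂) merged
            ... | inj₁ p'<p = rep-cong {b} {2 ^ σ * K + σ + 3} {J}
                                (λ i 1≤i i≤ → sym (same' (inj₁ (before i≤)))) (λ _ _ → refl) (done p'<p)
              where
              before : ∀ {i} → i ≤ J → wr + p' * J + i ≤ pw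
              before {i} i≤ = begin
                wr + p' * J + i ≤⟨ +-monoʳ-≤ (wr + p' * J) i≤ ⟩
                wr + p' * J + J ≡⟨ lem₂ wr (p' * J) J ⟩
                wr + suc p' * J ≤⟨ +-monoʳ-≤ wr (*-monoˡ-≤ J p'<p) ⟩
                pw ∎
                where open ≤-Reasoning

      module _ (p₁' pw' : ℕ) (p₁≡ : p₁' ≡ rd + p * 2 * Jo) (pw≡ : pw' ≡ wr + p * J) where

        row-run : ∀ {p₂ r} → p + suc r ≡ h →
          Reach (secondList ⨾ merge ⨾ rowStep) (atL w p₁' p₂ pw' σ b J (p * 2) Jo y rd wr Q) (2 + (mergeCost J + 4)) (Inv r)
        row-run meas rewrite p₁≡ | pw≡ = chain (branch (tt , tt , inj₂ (word (≤-trans (m≤n+m y 2) 2+y≤V)))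
          (λ lt → set (tt , tt , word (≤-trans (list-end 2p≤y) (≤-trans wr≤Z (<⇒≤ Z<V))))
            (row-rest (p₁ + Jo) (≤-trans (end lt) (≤-trans wr≤Z (<⇒≤ Z<V)))
              (λ 1≤i i≤ → inj₁ (≤-trans (+-monoʳ-≤ (p₁ + Jo) i≤) (≤-trans (end lt) (m≤m+n wr (p * J)))))
              (rep-cong {b₀} {K} {Jo} (λ i 1≤i i≤ → trans (cong (λ v → Q₀ (v + i)) (sym (lem rd (p * 2 * Jo) Jo))) (sym (source (end lt) i≤)))
                (λ _ _ → refl) (reps lt))
              meas))
          (λ ¬lt → set (tt , subst Num (sym Z-reg) (word (<⇒≤ Z<V)))
            (subst (λ v → Reach (merge ⨾ rowStep) (atL w p₁ v pw σ b J (p * 2) Jo y rd wr Q) (mergeCost J + 4) (Inv _)) (sym Z-reg)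
              (row-rest Z (≤-trans (+-mono-≤ (n≤1+n Z) (≤-trans Jo≤J (m≤n⇒m≤1+n J≤Z))) room)
                (λ 1≤i i≤ → inj₂ (≤-<-trans pw+J≤Z (m<m+n Z 1≤i)))
                (rep-cong {b₀} {K} {Jo} (λ _ _ _ → refl) (λ x _ → sym (R-zero (s≤s (≮⇒≥ ¬lt)) x))
                  (rep-zero b₀ λ i 1≤i i≤ → trans (same (inj₂ (≤-<-trans dst-room (m<m+n Z 1≤i)))) (zeros (m<m+n Z 1≤i))))
                meas))))
          where
          lem : ∀ a b c → a + b + c ≡ a + (c + b)
          lem = solve-∀
          end : p * 2 < y → p₁ + Jo + Jo ≤ wr
          end lt = ≤-trans (≤-reflexive (cong (_+ Jo) (lem rd (p * 2 * Jo) Jo))) (list-end lt)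

    RowsDone : Env → Set
    RowsDone e = ∃[ w ] ∃[ p₁ ] ∃[ p₂ ] ∃[ q ] ∃[ Q ]
      (e ≡ atL w p₁ p₂ (wr + h * J) σ b J q Jo y rd wr Q
       × (∀ {z} → Outside wr (h * J) z → Q z ≡ Q₀ z) × (∀ z → Q z ≤ suc C) × Results h Q)

    rows-run : ∀ w p₂ → Reach rows (atL w rd p₂ wr σ b J 0 Jo y rd wr Q₀) (h * (3 + (mergeCost J + 4)) + 1) RowsDone
    rows-run w p₂ = for (2 + (mergeCost J + 4)) Inv step h _
      (w , rd , p₂ , wr , 0 , Q₀ , refl , sym (+-identityʳ rd) , sym (+-identityʳ wr) , refl , (λ _ → refl) , Q₀≤ , λ ())
      where
      step : ∀ r e → Inv r e → CheapT (reg 18 ≤' reg 20) e ×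
        ((True (reg 18 ≤' reg 20) (toState e) × ∃[ r' ] (r ≡ suc r' × Reach (secondList ⨾ merge ⨾ rowStep) e (2 + (mergeCost J + 4)) (Inv r')))
         ⊎ (False (reg 18 ≤' reg 20) (toState e) × RowsDone e))
      step r _ (w , p₁ , p₂ , pw , p , Q , refl , p₁≡ , pw≡ , meas , same , Q≤ , done) =
        (tt , tt , inj₂ (word (≤-trans (m≤n+m y 2) 2+y≤V))) , go r meas (p * 2 ≤? y)
        where
        go : ∀ r → p + r ≡ h → Dec (p * 2 ≤ y) →
          (p * 2 ≤ y × ∃[ r' ] (r ≡ suc r' × Reach (secondList ⨾ merge ⨾ rowStep) (atL w p₁ p₂ pw σ b J (p * 2) Jo y rd wr Q) (2 + (mergeCost J + 4)) (Inv r')))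
           ⊎ (¬ p * 2 ≤ y × RowsDone (atL w p₁ p₂ pw σ b J (p * 2) Jo y rd wr Q))
        go zero meas _ = inj₂ (<⇒≱ (subst (λ v → y < v * 2) (sym p≡h) (shr-upper y 1))
          , w , p₁ , p₂ , p * 2 , Q
          , cong (λ v → atL w p₁ p₂ v σ b J (p * 2) Jo y rd wr Q) (trans pw≡ (cong (λ v → wr + v * J) p≡h))
          , same , Q≤ , subst (λ v → Results v Q) p≡h done)
          where
          p≡h : p ≡ h
          p≡h = trans (sym (+-identityʳ p)) meas
        go (suc r) meas (yes le) = inj₁ (le , r , refl ,
          row-run w p Q (≤-trans (s≤s (m≤m+n p r)) (≤-reflexive (trans (sym (+-suc p r)) meas))) le same Q≤ done p₁ pw p₁≡ pw≡ meas)
        go (suc r) meas (no ¬le) = contradiction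
          (≤-trans (*-monoˡ-≤ 2 (s≤s⁻¹ (≤-trans (s≤s (m≤m+n p r)) (≤-reflexive (trans (sym (+-suc p r)) meas))))) (shr-lower y 1)) ¬le

  -- Bounds the remaining time and work space: a level halves the number y + 1
  -- of lists, but only every other level doubles their length J.
  potential : (σ y J : ℕ) → ℕ
  potential σ y J = (4 + 2 * σ) * (y * J)

  private
    halves≤ : ∀ {y} → 1 ≤ y → halves y ≤ y
    halves≤ {y} 1≤y = by (shr y 1) (shr-lower y 1)
      where
      by : ∀ s → s * 2 ≤ y → suc s ≤ y
      by zero    _  = 1≤y
      by (suc s) le = ≤-trans (s≤s (s≤s (m≤m*n s 2))) le

    -- The coefficients 4 and 6 solve 4 = 1 + 6 / 2 and 6 = 2 + 4. A level writes at most `y` lists,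
    -- of doubled length if `σ` is 1. What is left has half the `y`, and in that case twice the `J`.
    -- Levels are written one behind the other, so this bounds the space as well.
    potential-step : ∀ {σ} y J → σ ≤ 1 → 1 ≤ y →
      halves y * (J * 2 ^ σ) + potential (1 ∸ σ) (shr y 1) (J * 2 ^ σ) ≤ potential σ y J
    potential-step {0} y J _ 1≤y = begin
      halves y * (J * 1) + 6 * (shr y 1 * (J * 1)) ≡⟨ lem₁ (halves y) (shr y 1) J ⟩
      halves y * J + 3 * (shr y 1 * 2 * J) ≤⟨ +-mono-≤ (*-monoˡ-≤ J (halves≤ 1≤y)) (*-monoʳ-≤ 3 (*-monoˡ-≤ J (shr-lower y 1))) ⟩
      y * J + 3 * (y * J) ≡⟨⟩
      4 * (y * J) ∎
      where
      open ≤-Reasoning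
      lem₁ : ∀ h s J → h * (J * 1) + 6 * (s * (J * 1)) ≡ h * J + 3 * (s * 2 * J)
      lem₁ = solve-∀
    potential-step {1} y J _ 1≤y = begin
      halves y * (J * 2) + 4 * (shr y 1 * (J * 2)) ≡⟨ lem₁ (halves y) (shr y 1) J ⟩
      2 * (halves y * J) + 4 * (shr y 1 * 2 * J) ≤⟨ +-mono-≤ (*-monoʳ-≤ 2 (*-monoˡ-≤ J (halves≤ 1≤y))) (*-monoʳ-≤ 4 (*-monoˡ-≤ J (shr-lower y 1))) ⟩
      2 * (y * J) + 4 * (y * J) ≡⟨ lem₂ (y * J) ⟩
      6 * (y * J) ∎
      where
      open ≤-Reasoning
      lem₁ : ∀ h s J → h * (J * 2) + 4 * (s * (J * 2)) ≡ 2 * (h * J) + 4 * (s * 2 * J)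
      lem₁ = solve-∀
      lem₂ : ∀ z → 2 * z + 4 * z ≡ 6 * z
      lem₂ = solve-∀
    potential-step {suc (suc σ)} y J (s≤s ()) 1≤y

    -- Refining turns an error K into 2 K + 1 and merging adds 3.
    error-step : ∀ {σ} K e k → σ ≤ 1 → K + 10 ≤ k * 2 ^ e + 3 * σ →
      2 ^ σ * K + σ + 3 + 10 ≤ k * 2 ^ (e + σ) + 3 * (1 ∸ σ)
    error-step {0} K e k _ le = begin
      1 * K + 0 + 3 + 10 ≡⟨ lem K ⟩
      K + 10 + 3 ≤⟨ +-monoˡ-≤ 3 le ⟩
      k * 2 ^ e + 0 + 3 ≡⟨ cong (_+ 3) (+-identityʳ (k * 2 ^ e)) ⟩
      k * 2 ^ e + 3 ≡⟨ cong (λ v → k * 2 ^ v + 3) (+-identityʳ e) ⟨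
      k * 2 ^ (e + 0) + 3 ∎
      where
      open ≤-Reasoning
      lem : ∀ K → 1 * K + 0 + 3 + 10 ≡ K + 10 + 3
      lem = solve-∀
    error-step {1} K e k _ le = +-cancelʳ-≤ 6 _ _ (begin
      2 * K + 1 + 3 + 10 + 6 ≡⟨ lem K ⟩
      2 * (K + 10) ≤⟨ *-monoʳ-≤ 2 le ⟩
      2 * (k * 2 ^ e + 3) ≡⟨ lem′ k (2 ^ e) ⟩
      k * (2 ^ e * 2) + 0 + 6 ≡⟨ cong (λ v → k * v + 0 + 6) (^-distribˡ-+-* 2 e 1) ⟨
      k * 2 ^ (e + 1) + 0 + 6 ∎)
      where
      open ≤-Reasoning
      lem : ∀ K → 2 * K + 1 + 3 + 10 + 6 ≡ 2 * (K + 10)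
      lem = solve-∀
      lem′ : ∀ k t → 2 * (k * t + 3) ≡ k * (t * 2) + 0 + 6
      lem′ = solve-∀
    error-step {suc (suc σ)} K e k (s≤s ()) le

    level-cost : ∀ h J → 1 ≤ h → 1 ≤ J → 12 + h * (3 + (mergeCost J + 4)) ≤ 200 * (h * J)
    level-cost h J 1≤h 1≤J = begin
      12 + h * (3 + (4 + (suc (suc (3 * J)) * 34 + 1) + 4)) ≡⟨ lem h J ⟩
      102 * (h * J) + (80 * h + 12) ≤⟨ +-monoʳ-≤ (102 * (h * J)) (+-mono-≤ (*-monoʳ-≤ 80 (m≤m*n h J {{>-nonZero 1≤J}})) (*-monoʳ-≤ 12 (*-mono-≤ 1≤h 1≤J))) ⟩
      102 * (h * J) + (80 * (h * J) + 12 * (h * J)) ≤⟨ m≤m+n _ (6 * (h * J)) ⟩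
      102 * (h * J) + (80 * (h * J) + 12 * (h * J)) + 6 * (h * J) ≡⟨ lem′ (h * J) ⟩
      200 * (h * J) ∎
      where
      open ≤-Reasoning
      lem : ∀ h J → 12 + h * (3 + (4 + ((2 + 3 * J) * 34 + 1) + 4)) ≡ 102 * (h * J) + (80 * h + 12)
      lem = solve-∀
      lem′ : ∀ z → 102 * z + (80 * z + 12 * z) + 6 * z ≡ 200 * z
      lem′ = solve-∀

  module Levels (b₀ k J₀ : ℕ) (T : ℕ → ℕ) (J₀≥ : 2 ^ b₀ ≤ J₀) where

    -- The shape of `err` makes the induction exact: the two recurrences `2 K + 4` and `K + 3` both
    -- multiply `K + 10 − 3 σ` by `2 ^ σ`. Starting with `σ` equal to 1 and `K` equal to `k`, this
    -- quantity is `k + 7`, whence a loss of 7 per vertex.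
    record Stage (σ y rd wr e K J : ℕ) (Q : ℕ → ℕ) (R : ℕ → ℕ → ℕ) : Set where
      field
        σ≤1    : σ ≤ 1
        J≡     : J ≡ J₀ * 2 ^ e
        err    : K + 10 ≤ (k + 7) * 2 ^ e + 3 * σ
        src    : rd + suc y * J ≤ wr
        space  : wr + potential σ y J ≤ Z
        zeros  : ∀ {z} → Z < z → Q z ≡ 0
        Q≤     : ∀ z → Q z ≤ suc C
        reps   : ∀ {p} → p ≤ y → Represents (b₀ + e) K J (λ i → Q (rd + p * J + i)) (R p)
        R-zero : ∀ {p} → y < p → ∀ x → R p x ≡ 0
        total  : ∀ x → sum (suc y) (λ p → R p x) ≡ T x

    Inv : ℕ → Env → Set
    Inv c e = ∃[ w ] ∃[ p₁ ] ∃[ p₂ ] ∃[ pw ] ∃[ σ ] ∃[ ε ] ∃[ J ] ∃[ q ] ∃[ Jo ] ∃[ y ] ∃[ rd ] ∃[ wr ] ∃[ Q ] ∃[ K ] ∃[ R ]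
      (e ≡ atL w p₁ p₂ pw σ (b₀ + ε) J q Jo y rd wr Q × Stage σ y rd wr ε K J Q R × 200 * potential σ y J + 1 ≤ c)

    LevelsDone : Env → Set
    LevelsDone e = ∃[ w ] ∃[ p₁ ] ∃[ p₂ ] ∃[ pw ] ∃[ σ ] ∃[ ε ] ∃[ q ] ∃[ Jo ] ∃[ rd ] ∃[ wr ] ∃[ Q ]
      (e ≡ atL w p₁ p₂ pw σ (b₀ + ε) (J₀ * 2 ^ ε) q Jo 0 rd wr Q
       × Represents (b₀ + ε) ((k + 7) * 2 ^ ε) (J₀ * 2 ^ ε) (λ i → Q (rd + i)) T
       × rd + J₀ * 2 ^ ε ≤ Z × (∀ {z} → Z < z → Q z ≡ 0) × (∀ z → Q z ≤ suc C))

    module _ {σ y rd wr ε K J Q R} (s : Stage σ y rd wr ε K J Q R) where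
      open Stage s
      private
        b J' h : ℕ
        b = b₀ + ε
        J' = J * 2 ^ σ
        h = halves y
        J>0 : 1 ≤ J
        J>0 = ≤-trans (*-mono-≤ (≤-trans (pow>0 b₀) J₀≥) (pow>0 ε)) (≤-reflexive (sym J≡))
        J'>0 : 1 ≤ J'
        J'>0 = *-mono-≤ J>0 (pow>0 σ)
        assoc : b₀ + ε + σ ≡ b₀ + (ε + σ)
        assoc = +-assoc b₀ ε σ
        wr≤Z : wr ≤ Z
        wr≤Z = ≤-trans (m≤m+n wr _) space

      level-run : ∀ {w p₁ p₂ pw q Jo} → 1 ≤ y →
        Reach level (atL w p₁ p₂ pw σ b J q Jo y rd wr Q) (6 + (h * (3 + (mergeCost J' + 4)) + 1 + 4))
          (Inv (200 * potential (1 ∸ σ) (shr y 1) J' + 1))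
      level-run {w} {p₁} {p₂} {pw} {q} {Jo} 1≤y =
        (tt , word (≤-trans J≤Z (<⇒≤ Z<V))) ►
        (tt , tt , ≤-trans σ≤1 1≤V , ≤-trans J'≤Z (<⇒≤ Z<V)) ►
        (tt , tt , word b≤V) ►
        (tt , word (≤-trans rd≤Z (<⇒≤ Z<V))) ►
        (tt , word (≤-trans wr≤Z (<⇒≤ Z<V))) ►
        (tt , word z≤n) ►
        from (atL w rd p₂ wr σ (b + σ) J' 0 J y rd wr Q) refl (chain (conseq
          (Rows.rows-run σ b K J y rd wr Q R σ≤1 b≤V J>0 src dst zeros Q≤ reps R-zero w p₂)
          λ { _ (w' , p₁' , p₂' , q' , Q' , refl , same , Q'≤ , done) → after w' p₁' p₂' q' Q' same Q'≤ done }))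
        where
        J≤Z : J ≤ Z
        J≤Z = ≤-trans (m≤n*m J (suc y)) (≤-trans (m≤n+m (suc y * J) rd) (≤-trans src wr≤Z))
        rd≤Z : rd ≤ Z
        rd≤Z = ≤-trans (m≤m+n rd _) (≤-trans src wr≤Z)
        space' : wr + (h * J' + potential (1 ∸ σ) (shr y 1) J') ≤ Z
        space' = ≤-trans (+-monoʳ-≤ wr (potential-step y J σ≤1 1≤y)) space
        dst : wr + h * J' ≤ Z
        dst = ≤-trans (+-monoʳ-≤ wr (m≤m+n (h * J') _)) space'
        J'≤Z : J' ≤ Z
        J'≤Z = ≤-trans (m≤n*m J' h) (≤-trans (m≤n+m (h * J') wr) dst)
        J'≡ : J' ≡ J₀ * 2 ^ (ε + σ)
        J'≡ = trans (cong (_* 2 ^ σ) J≡) (trans (*-assoc J₀ (2 ^ ε) (2 ^ σ)) (cong (J₀ *_) (sym (^-distribˡ-+-* 2 ε σ))))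
        b≤V : b + σ ≤ V
        b≤V = begin
          b + σ ≤⟨ <⇒≤ (n<2^n (b + σ)) ⟩
          2 ^ (b + σ) ≡⟨ cong (2 ^_) assoc ⟩
          2 ^ (b₀ + (ε + σ)) ≡⟨ ^-distribˡ-+-* 2 b₀ (ε + σ) ⟩
          2 ^ b₀ * 2 ^ (ε + σ) ≤⟨ *-monoˡ-≤ (2 ^ (ε + σ)) J₀≥ ⟩
          J₀ * 2 ^ (ε + σ) ≡⟨ J'≡ ⟨
          J' ≤⟨ J'≤Z ⟩
          Z ≤⟨ <⇒≤ Z<V ⟩
          V ∎
          where open ≤-Reasoning
        after : ∀ w' p₁' p₂' q' Q' → (∀ {z} → Outside wr (h * J') z → Q' z ≡ Q z) → (∀ z → Q' z ≤ suc C) →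
          (∀ {p'} → p' < h → Represents (b + σ) (2 ^ σ * K + σ + 3) J' (λ i → Q' (wr + p' * J' + i)) (paired R p')) →
          Reach (21 ≔ val (reg 22) ⨾ 22 ≔ val (reg 14) ⨾ 20 ≔ reg 20 ≫ lit 1 ⨾ 15 ≔ lit 1 ⊖ reg 15)
            (atL w' p₁' p₂' (wr + h * J') σ (b + σ) J' q' J y rd wr Q') 4 (Inv (200 * potential (1 ∸ σ) (shr y 1) J' + 1))
        after w' p₁' p₂' q' Q' same Q'≤ done =
          (tt , word (≤-trans wr≤Z (<⇒≤ Z<V))) ►
          (tt , word (≤-trans dst (<⇒≤ Z<V))) ►
          (tt , tt , 1≤V , y≤V) ►
          set (tt , tt , word 1≤V , word (≤-trans σ≤1 1≤V))
            (w' , p₁' , p₂' , wr + h * J' , 1 ∸ σ , ε + σ , J' , q' , J , shr y 1 , wr , wr + h * J' , Q' , 2 ^ σ * K + σ + 3 , paired R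
            , cong (λ v → atL w' p₁' p₂' (wr + h * J') (1 ∸ σ) v J' q' J (shr y 1) wr (wr + h * J') Q') assoc
            , stage , ≤-refl)
          where
          y≤V : y ≤ V
          y≤V = ≤-trans (≤-trans (n≤1+n y) (≤-trans (m≤m*n (suc y) J {{>-nonZero J>0}}) (≤-trans (m≤n+m _ rd) (≤-trans src wr≤Z)))) (<⇒≤ Z<V)
          y<2h : suc y ≤ h * 2
          y<2h = shr-upper y 1
          stage : Stage (1 ∸ σ) (shr y 1) wr (wr + h * J') (ε + σ) (2 ^ σ * K + σ + 3) J' Q' (paired R)
          stage = record
            { σ≤1 = m∸n≤m 1 σ ; J≡ = J'≡ ; err = error-step K ε (k + 7) σ≤1 err ; src = ≤-refl
            ; space = ≤-trans (≤-reflexive (+-assoc wr (h * J') _)) space'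
            ; zeros = λ lt → trans (same (inj₂ (≤-<-trans dst lt))) (zeros lt) ; Q≤ = Q'≤
            ; reps = λ {p} p≤ → subst (λ v → Represents v (2 ^ σ * K + σ + 3) J' (λ i → Q' (wr + p * J' + i)) (paired R p)) assoc (done (s≤s p≤))
            ; R-zero = λ {p} lt x → cong₂ _+_ (R-zero (≤-trans y<2h (*-monoˡ-≤ 2 lt)) x) (R-zero (m≤n⇒m≤1+n (≤-trans y<2h (*-monoˡ-≤ 2 lt))) x)
            ; total = λ x → trans (sum-pairs h (λ p → R p x)) (trans (sum-pad y<2h (λ p lt → R-zero lt x)) (total x)) }

    levels-run : ∀ {c} e → Inv c e → Reach levels e c LevelsDone
    levels-run e inv = while Inv step _ e inv
      where
      step : ∀ c e → Inv c e → CheapT (lit 0 <' reg 20) e ×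
        ((True (lit 0 <' reg 20) (toState e) × ∃[ k ] ∃[ c' ] (suc (k + c') ≤ c × Reach level e k (Inv c')))
         ⊎ (False (lit 0 <' reg 20) (toState e) × 1 ≤ c × LevelsDone e))
      step c _ (w , p₁ , p₂ , pw , σ , ε , J , q , Jo , zero , rd , wr , Q , K , R , refl , s , le) =
        (tt , tt , inj₁ (word z≤n)) , inj₂ ((λ ()) , ≤-trans (m≤n+m 1 _) le
        , w , p₁ , p₂ , pw , σ , ε , q , Jo , rd , wr , Q
        , cong (λ v → atL w p₁ p₂ pw σ (b₀ + ε) v q Jo 0 rd wr Q) J≡
        , subst (λ v → Represents (b₀ + ε) ((k + 7) * 2 ^ ε) v (λ i → Q (rd + i)) T) J≡
            (rep-weaken {b₀ + ε} {K} K≤ (rep-cong {b₀ + ε} {K} (λ i _ _ → cong (λ v → Q (v + i)) (+-identityʳ rd)) (λ x _ → total x) (reps z≤n)))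
        , subst (λ v → rd + v ≤ Z) J≡ (≤-trans (≤-reflexive (cong (rd +_) (sym (+-identityʳ J)))) (≤-trans src (≤-trans (m≤m+n wr _) space)))
        , zeros , Q≤)
        where
        open Stage s
        K≤ : K ≤ (k + 7) * 2 ^ ε
        K≤ = +-cancelʳ-≤ 10 _ _ (≤-trans err (+-monoʳ-≤ ((k + 7) * 2 ^ ε) (≤-trans (*-monoʳ-≤ 3 σ≤1) (m≤m+n 3 7))))
      step c _ (w , p₁ , p₂ , pw , σ , ε , J , q , Jo , y@(suc _) , rd , wr , Q , K , R , refl , s , le) =
        (tt , tt , inj₁ (word z≤n)) , inj₁ (s≤s z≤n , _ , _ , ≤-trans pay le , level-run s (s≤s z≤n))
        where
        open Stage s
        h = halves y
        J' = J * 2 ^ σ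
        P = potential (1 ∸ σ) (shr y 1) J'
        J'>0 : 1 ≤ J'
        J'>0 = *-mono-≤ (≤-trans (*-mono-≤ (≤-trans (pow>0 b₀) J₀≥) (pow>0 ε)) (≤-reflexive (sym J≡))) (pow>0 σ)
        pay : suc (6 + (h * (3 + (mergeCost J' + 4)) + 1 + 4) + (200 * P + 1)) ≤ 200 * potential σ y J + 1
        pay = begin
          suc (6 + (h * (3 + (mergeCost J' + 4)) + 1 + 4) + (200 * P + 1)) ≡⟨ lem (h * (3 + (mergeCost J' + 4))) (200 * P) ⟩
          12 + h * (3 + (mergeCost J' + 4)) + 200 * P + 1 ≤⟨ +-monoˡ-≤ 1 (+-monoˡ-≤ (200 * P) (level-cost h J' (s≤s z≤n) J'>0)) ⟩
          200 * (h * J') + 200 * P + 1 ≡⟨ cong (_+ 1) (*-distribˡ-+ 200 (h * J') P) ⟨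
          200 * (h * J' + P) + 1 ≤⟨ +-monoˡ-≤ 1 (*-monoʳ-≤ 200 (potential-step y J σ≤1 (s≤s z≤n))) ⟩
          200 * potential σ y J + 1 ∎
          where
          open ≤-Reasoning
          lem : ∀ a b → suc (6 + (a + 1 + 4) + (b + 1)) ≡ 12 + a + b + 1
          lem = solve-∀

-- Processing all vertices

copyShifted leaf leaves copyCoarse build : Program
copyShifted = 2 ≔ val (lit 1) ⨾
  (WHILE reg 2 ≤' reg 32 DO (
    10 ≔ reg 26 ⊕ reg 2 ⨾ 10 ≔ val (cell 4 10) ⨾
    -- The comparison comes first because a subtraction is charged for its longer operand: a weight
    -- that exceeds the entry may be arbitrarily long and must not be subtracted.
    (IF cell 2 23 <' reg 10 THEN (10 ≔ reg 10 ⊖ cell 2 23) ELSE (10 ≔ val (lit 0))) ⨾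
    11 ≔ reg 22 ⊕ reg 2 ⨾ 5 [ 11 ]≔ val (reg 10) ⨾ 2 ≔ lit 1 ⊕ reg 2))

leaf = 26 ≔ val (cell 1 23) ⨾ 26 ≔ reg 26 ≪ reg 30 ⨾ copyShifted ⨾ 22 ≔ reg 22 ⊕ reg 32

leaves = WHILE reg 23 <' reg 36 DO (27 ≔ val (cell 0 23) ⨾ ifEq 27 28 leaf ⨾ 23 ≔ lit 1 ⊕ reg 23)

copyCoarse = 2 ≔ val (lit 1) ⨾
  (WHILE reg 2 ≤' reg 32 DO (
    10 ≔ reg 2 ≪ reg 23 ⨾ 10 ≔ reg 21 ⊕ reg 10 ⨾ 10 ≔ val (cell 5 10) ⨾
    11 ≔ reg 26 ⊕ reg 2 ⨾ 4 [ 11 ]≔ val (reg 10) ⨾ 2 ≔ lit 1 ⊕ reg 2))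

-- Computes the list of vertex r28, which has r24 > 0 outgoing arcs, in array 4.
build =
  22 ≔ val (lit 0) ⨾ 23 ≔ val (lit 0) ⨾ leaves ⨾
  20 ≔ reg 24 ⊖ lit 1 ⨾ 21 ≔ val (lit 0) ⨾ 15 ≔ val (lit 1) ⨾ 16 ≔ val (reg 31) ⨾ 17 ≔ val (reg 32) ⨾
  levels ⨾
  23 ≔ reg 16 ⊖ reg 31 ⨾ 26 ≔ reg 28 ≪ reg 30 ⨾ copyCoarse

scan vertex visit wrap rounds : Program
scan = 24 ≔ val (lit 0) ⨾ 25 ≔ val (lit 1) ⨾ 23 ≔ val (lit 0) ⨾
  (WHILE reg 23 <' reg 36 DO (27 ≔ val (cell 0 23) ⨾ ifEq 27 28 (
    24 ≔ lit 1 ⊕ reg 24 ⨾ 27 ≔ val (cell 1 23) ⨾ 27 ≔ val (cell 3 27) ⨾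
    (IF lit 0 <' reg 27 THEN skip ELSE (25 ≔ val (lit 0)))) ⨾
    23 ≔ lit 1 ⊕ reg 23))

vertex = scan ⨾
  (IF lit 0 <' reg 25 THEN (3 [ 28 ]≔ val (lit 1) ⨾ (IF lit 0 <' reg 24 THEN build ELSE skip)) ELSE skip)

visit = 27 ≔ val (cell 3 28) ⨾ (IF lit 0 <' reg 27 THEN skip ELSE vertex) ⨾ 28 ≔ lit 1 ⊕ reg 28

wrap = IF reg 28 <' reg 35 THEN skip ELSE (28 ≔ val (lit 0) ⨾ 29 ≔ lit 1 ⊕ reg 29)

-- In n rounds every vertex is visited n times, and it is processed at the
-- first visit at which all heads of its outgoing arcs have been processed.
rounds = 29 ≔ val (lit 0) ⨾ 28 ≔ val (lit 0) ⨾
  (WHILE reg 29 <' reg 35 DO (visit ⨾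
    wrap))

record Filled (base J : ℕ) (f A₀ A : ℕ → ℕ) (j : ℕ) : Set where
  field
    cells : ∀ {i} → 1 ≤ i → i < j → A (base + i) ≡ f i
    same  : ∀ {z} → Outside base J z → A z ≡ A₀ z

filled-start : ∀ {base J f A} → Filled base J f A A 1
filled-start = record { cells = λ 1≤i i<1 → contradiction i<1 (≤⇒≯ 1≤i) ; same = λ _ → refl }

filled-step : ∀ {base J f A₀ A j v} → 1 ≤ j → j ≤ J → v ≡ f j → Filled base J f A₀ A j →
              Filled base J f A₀ (A [ base + j ↦ v ]) (suc j)
filled-step {base} {J} {f} {A₀} {A} {j} {v} 1≤j j≤J v≡ fl = record
  { cells = cells′ ; same = λ out → trans ([↦]-other A v (outside-≢ out 1≤j j≤J)) (same out) }
  where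
  open Filled fl
  cells′ : ∀ {i} → 1 ≤ i → i < suc j → (A [ base + j ↦ v ]) (base + i) ≡ f i
  cells′ {i} 1≤i i≤j with m≤n⇒m<n∨m≡n (s≤s⁻¹ i≤j)
  ... | inj₁ i<j  = trans ([↦]-other A v λ e → <⇒≢ i<j (+-cancelˡ-≡ base i j e)) (cells 1≤i i<j)
  ... | inj₂ refl = trans ([↦]-same A (base + j) v) v≡

other-list : ∀ {J v v' i} → v' ≢ v → 1 ≤ i → i ≤ J → Outside (v * J) J (v' * J + i)
other-list {J} {v} {v'} {i} v'≢v 1≤i i≤J with <-cmp v' v
... | tri< v'<v _ _ = inj₁ (begin
    v' * J + i ≤⟨ +-monoʳ-≤ (v' * J) i≤J ⟩
    v' * J + J ≡⟨ +-comm (v' * J) J ⟩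
    suc v' * J ≤⟨ *-monoˡ-≤ J v'<v ⟩
    v * J ∎)
  where open ≤-Reasoning
... | tri≈ _ eq _ = contradiction eq v'≢v
... | tri> _ _ v<v' = inj₂ (begin-strict
    v * J + J ≡⟨ +-comm (v * J) J ⟩
    suc v * J ≤⟨ *-monoˡ-≤ J v<v' ⟩
    v' * J <⟨ m<m+n (v' * J) 1≤i ⟩
    v' * J + i ∎)
  where open ≤-Reasoning

select : ℕ → ℕ → ℕ → ℕ
select a b x = if a ≡ᵇ b then x else 0

select-yes : ∀ {a b} x → a ≡ b → select a b x ≡ x
select-yes {zero}  x refl = refl
select-yes {suc a} x refl = select-yes {a} x refl

select-no : ∀ {a b} x → a ≢ b → select a b x ≡ 0
select-no {zero}  {zero}  x a≢b = contradiction refl a≢b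
select-no {zero}  {suc b} x a≢b = refl
select-no {suc a} {zero}  x a≢b = refl
select-no {suc a} {suc b} x a≢b = select-no {a} {b} x (a≢b ∘ cong suc)

select-≤ : ∀ a b x → select a b x ≤ x
select-≤ a b x with a ≡ᵇ b
... | true  = ≤-refl
... | false = z≤n

-- Double counting: every arc is counted for at most one vertex.
degree-sum : ∀ n m (f : ℕ → ℕ) → sum n (λ v → sum m (λ e → select (f e) v 1)) ≤ m
degree-sum n m f = begin
  sum n (λ v → sum m (λ e → select (f e) v 1)) ≡⟨ sum-swap n m (λ v e → select (f e) v 1) ⟩
  sum m (λ e → sum n (λ v → select (f e) v 1)) ≤⟨ sum-mono m (λ e _ → once n (f e)) ⟩
  sum m (λ _ → 1) ≡⟨ trans (sum-const m 1) (*-identityʳ m) ⟩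
  m ∎
  where
  open ≤-Reasoning
  once : ∀ k i → sum k (λ v → select i v 1) ≤ 1
  once zero    i = z≤n
  once (suc k) i with i ≟ k
  ... | no i≢k   = ≤-trans (≤-reflexive (trans (cong (sum k (λ v → select i v 1) +_) (select-no 1 i≢k)) (+-identityʳ _))) (once k i)
  ... | yes refl = ≤-reflexive (cong₂ _+_
          (trans (sum-cong k λ v v<k → select-no 1 λ eq → <-irrefl (sym eq) v<k) (sum-zero k)) (select-yes {k} 1 refl))

-- Registers 12–21.
record Junk : Set where
  constructor junk
  field
    z₀ z₁ z₂ z₃ z₄ z₅ z₆ z₇ z₈ z₉ : ℕ
open Junk

private
  advance-index : ∀ a v s → a + suc v + s ≡ a + v + suc s
  advance-index = solve-∀

  idle-credit : ∀ i m a b → i ≤ 13 → i + (a + b + 1) ≤ (20 * m + 20) + a + b + 1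
  idle-credit i m a b le = ≤-trans (+-monoˡ-≤ (a + b + 1) le) (≤-trans (m≤m+n _ (20 * m + 7)) (≤-reflexive (lem m a b)))
    where
    lem : ∀ m a b → 13 + (a + b + 1) + (20 * m + 7) ≡ (20 * m + 20) + a + b + 1
    lem = solve-∀

  wait-credit : ∀ m a b → suc (suc (suc (3 + (m * 10 + 1) + 2) + 1) + 3 + (a + b + 1)) ≤ (20 * m + 20) + a + b + 1
  wait-credit m a b = ≤-trans (m≤m+n _ (10 * m + 7)) (≤-reflexive (lem m a b))
    where
    lem : ∀ m a b → suc (suc (suc (3 + (m * 10 + 1) + 2) + 1) + 3 + (a + b + 1)) + (10 * m + 7) ≡ (20 * m + 20) + a + b + 1
    lem = solve-∀

  process-credit : ∀ m a d {q q'} J → d + q' ≤ q →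
    suc (suc (suc (3 + (m * 10 + 1) + (4 + (6 * m + 1300 * (d * J)))) + 1) + 3 + (a + 1300 * (q' * J) + 1)) ≤ (20 * m + 20) + a + 1300 * (q * J) + 1
  process-credit m a d {q} {q'} J le = begin
    _ ≤⟨ m≤m+n _ (4 * m + 5) ⟩
    suc (suc (suc (3 + (m * 10 + 1) + (4 + (6 * m + 1300 * (d * J)))) + 1) + 3 + (a + 1300 * (q' * J) + 1)) + (4 * m + 5)
                                                                 ≡⟨ lem m a d q' J ⟩
    (20 * m + 20) + a + 1300 * ((d + q') * J) + 1 ≤⟨ +-monoˡ-≤ 1 (+-monoʳ-≤ ((20 * m + 20) + a) (*-monoʳ-≤ 1300 (*-monoˡ-≤ J le))) ⟩
    (20 * m + 20) + a + 1300 * (q * J) + 1 ∎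
    where
    open ≤-Reasoning
    lem : ∀ m a d q J → suc (suc (suc (3 + (m * 10 + 1) + (4 + (6 * m + 1300 * (d * J)))) + 1) + 3 + (a + 1300 * (q * J) + 1)) + (4 * m + 5)
          ≡ (20 * m + 20) + a + 1300 * ((d + q) * J) + 1
    lem = solve-∀

-- The data and the memory layout of a run: u bounds the time of an operation on
-- words, which are at most V; the work space in array 5 ends at Z.
record Layout : Set where
  field
    n C V u  : ℕ
    word-V   : Timed.wordTime n C V ≤ u
    number-C : Timed.numberTime n C (suc C) ≤ u
    m a b Z  : ℕ
    sr tg wt : ℕ → ℕ
    RR       : ℕ → ℕ → ℕ
    ht       : ℕ → ℕ
    ρ        : List ℕ
    tg<n     : ∀ {e} → e < m → tg e < n
    sr<n     : ∀ {e} → e < m → sr e < n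
    ht-arc   : ∀ {e} → e < m → ht (tg e) < ht (sr e)
    b≤a      : b ≤ a
    a≤V      : a ≤ V
    nm≤V     : n + m ≤ V
    lists≤V  : n * 2 ^ a ≤ V
    queue≤Z  : 8 * (m * 2 ^ a) ≤ Z
    room     : suc Z + suc Z ≤ V

-- The list of one vertex, and the order of processing

module BuildRun (layout : Layout) where
  open Layout layout
  open Cost n C V u word-V number-C

  J : ℕ
  J = 2 ^ a

  at : Scratch → Junk → (wr e d ok p x v r : ℕ) → (dn F Q : ℕ → ℕ) → Env
  at w k wr e d ok p x v r dn F Q =
    (w ⊹ z₀ k ∷ z₁ k ∷ z₂ k ∷ z₃ k ∷ z₄ k ∷ z₅ k ∷ z₆ k ∷ z₇ k ∷ z₈ k ∷ z₉ k ∷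
      wr ∷ e ∷ d ∷ ok ∷ p ∷ x ∷ v ∷ r ∷ a ∷ b ∷ J ∷ Z ∷ suc C ∷ n ∷ m ∷ ρ)
    , (sr ∷ tg ∷ wt ∷ dn ∷ F ∷ Q ∷ [])

  degree : ℕ → ℕ → ℕ
  degree v k = sum k (λ e → select (sr e) v 1)

  outflow : ℕ → ℕ → ℕ → ℕ
  outflow v x k = sum k (λ e → select (sr e) v (RR (tg e) (x + wt e)))

  -- The error grows with the height and not with the number of vertices processed before, as only
  -- the heads of outgoing arcs feed into a list.
  ListOf : (ℕ → ℕ) → ℕ → Set
  ListOf F v = Represents b (7 * ht v) J (λ i → F (v * J + i)) (RR v)

  private
    Z≤V : Z ≤ V
    Z≤V = ≤-trans (n≤1+n Z) (≤-trans (m≤m+n (suc Z) (suc Z)) room)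

    1≤V : 1 ≤ V
    1≤V = ≤-trans (s≤s z≤n) (≤-trans (m≤m+n (suc Z) (suc Z)) room)

    m≤V : m ≤ V
    m≤V = ≤-trans (m≤n+m m n) nm≤V

    n≤V : n ≤ V
    n≤V = ≤-trans (m≤m+n n m) nm≤V

    J>0 : 1 ≤ J
    J>0 = pow>0 a

    b≤V : b ≤ V
    b≤V = ≤-trans b≤a a≤V

    list-end : ∀ {v} → v < n → v * J + J ≤ V
    list-end {v} v<n = ≤-trans (≤-reflexive (+-comm (v * J) J)) (≤-trans (*-monoˡ-≤ J v<n) lists≤V)

  module _ {e p wr d ok x v r : ℕ} {dn F : ℕ → ℕ} {k : Junk} {Q₀ : ℕ → ℕ}
    (e<m : e < m) (src : p + J ≤ V) (dst : wr + J ≤ V) (J<V : suc J ≤ V)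
    (F≤ : ∀ z → F z ≤ suc C) (Q₀≤ : ∀ z → Q₀ z ≤ suc C) where

    ShiftedDone : Env → Set
    ShiftedDone e' = ∃[ w ] ∃[ Q ] (e' ≡ at w k wr e d ok p x v r dn F Q
      × Filled wr J (λ i → F (p + i) ∸ wt e) Q₀ Q (suc J) × (∀ z → Q z ≤ suc C))

    private
      Inv : ℕ → Env → Set
      Inv s e' = ∃[ w ] ∃[ Q ] (e' ≡ at w k wr e d ok p x v r dn F Q × 1 ≤ Scratch.w₂ w × Scratch.w₂ w + s ≡ suc J
        × Filled wr J (λ i → F (p + i) ∸ wt e) Q₀ Q (Scratch.w₂ w) × (∀ z → Q z ≤ suc C))

    copyShifted-run : ∀ w → Reach copyShifted (at w k wr e d ok p x v r dn F Q₀) (1 + (J * 8 + 1)) ShiftedDone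
    copyShifted-run w = (tt , word 1≤V) ►
      for 7 Inv step J _ (_ , _ , refl , ≤-refl , refl , filled-start , Q₀≤)
      where
      step : ∀ s e' → Inv s e' → CheapT (reg 2 ≤' reg 32) e' ×
        ((True (reg 2 ≤' reg 32) (toState e') × ∃[ s' ] (s ≡ suc s' × Reach _ e' 7 (Inv s')))
         ⊎ (False (reg 2 ≤' reg 32) (toState e') × ShiftedDone e'))
      step zero _ (w , Q , refl , 1≤j , j≡ , fl , Q≤) = (tt , tt , inj₂ (word (<⇒≤ J<V)))
        , inj₂ ((λ j≤J → <-irrefl refl (≤-trans (s≤s j≤J) (≤-reflexive j≡J)))
        , w , Q , refl , subst (Filled wr J _ Q₀ Q) (sym j≡J) fl , Q≤)
        where
        j≡J : suc J ≡ Scratch.w₂ w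
        j≡J = trans (sym j≡) (+-identityʳ _)
      step (suc s) _ (w@(scratch i₀ i₁ j i₃ i₄ i₅ i₆ i₇ i₈ i₉ i₁₀ i₁₁) , Q , refl , 1≤j , j≡ , fl , Q≤) =
        (tt , tt , inj₂ (word (<⇒≤ J<V))) , inj₁ (j≤J , s , refl
        , (tt , tt , word p+j≤V) ► (p+j≤V , cap (F≤ _)) ►
          chain {k = 2} {k' = 3} (branch (≤-trans (<⇒≤ e<m) m≤V , tt , inj₂ (cap (F≤ _)))
            (λ lt → set (tt , ≤-trans (<⇒≤ e<m) m≤V , cap (F≤ _) , cap (≤-trans (<⇒≤ lt) (F≤ _))) (rest _ refl))
            (λ ¬lt → set (tt , word z≤n) (rest 0 (sym (m≤n⇒m∸n≡0 (≮⇒≥ ¬lt)))))))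
        where
        j≤J : j ≤ J
        j≤J = s≤s⁻¹ (≤-trans (s≤s (m≤m+n j s)) (≤-reflexive (trans (sym (+-suc j s)) j≡)))
        p+j≤V : p + j ≤ V
        p+j≤V = ≤-trans (+-monoʳ-≤ p j≤J) src
        wr+j≤V : wr + j ≤ V
        wr+j≤V = ≤-trans (+-monoʳ-≤ wr j≤J) dst
        rest : ∀ y → y ≡ F (p + j) ∸ wt e →
          Reach (11 ≔ reg 22 ⊕ reg 2 ⨾ 5 [ 11 ]≔ val (reg 10) ⨾ 2 ≔ lit 1 ⊕ reg 2)
            (at (scratch i₀ i₁ j i₃ i₄ i₅ i₆ i₇ i₈ i₉ y i₁₁) k wr e d ok p x v r dn F Q) 3 (Inv s)
        rest y y≡ = (tt , tt , word wr+j≤V) ► chain (put wr+j≤V (tt , cap y≤)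
          (set (tt , tt , word (≤-trans (s≤s j≤J) J<V))
            (_ , _ , refl , s≤s z≤n , trans (sym (+-suc j s)) j≡ , filled-step 1≤j j≤J y≡ fl , [↦]-bound Q y≤ Q≤)))
          where
          y≤ : y ≤ suc C
          y≤ = ≤-trans (≤-reflexive y≡) (≤-trans (m∸n≤m (F (p + j)) (wt e)) (F≤ _))

  J≤Z : 1 ≤ m → J ≤ Z
  J≤Z 1≤m = ≤-trans (m≤n*m J m {{>-nonZero 1≤m}}) (≤-trans (m≤n*m (m * J) 8) queue≤Z)

  J<V : 1 ≤ m → J < V
  J<V 1≤m = ≤-trans (s≤s (J≤Z 1≤m)) (≤-trans (m≤m+n (suc Z) (suc Z)) room)

  module _ (v hv : ℕ) (v<n : v < n) (hv≡ : ht v ≡ suc hv) (rec : ∀ x → RR v x ≡ outflow v x m)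
    (F : ℕ → ℕ) (F≤ : ∀ z → F z ≤ suc C)
    (targets : ∀ {e} → e < m → sr e ≡ v → ListOf F (tg e))
    (y ok r : ℕ) (dn : ℕ → ℕ) (degree≡ : degree v m ≡ suc y) where

    private
      d : ℕ
      d = suc y

    record Gathered (e wr c : ℕ) (R : ℕ → ℕ → ℕ) (Q : ℕ → ℕ) : Set where
      field
        wr≡    : wr ≡ c * J
        c≡     : c ≡ degree v e
        reps   : ∀ {i} → i < c → Represents b (7 * hv) J (λ j → Q (i * J + j)) (R i)
        R-zero : ∀ {i} → c ≤ i → ∀ x → R i x ≡ 0
        total  : ∀ x → sum c (λ i → R i x) ≡ outflow v x e
        zeros  : ∀ {z} → Z < z → Q z ≡ 0
        Q≤     : ∀ z → Q z ≤ suc C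

    private
      Inv : ℕ → Env → Set
      Inv c e' = ∃[ w ] ∃[ k ] ∃[ wr ] ∃[ e ] ∃[ p ] ∃[ x ] ∃[ s ] ∃[ f ] ∃[ l ] ∃[ R ] ∃[ Q ]
        (e' ≡ at w k wr e d ok p x v r dn F Q × e + s ≡ m × l + f ≡ d × Gathered e wr l R Q
         × 6 * s + 20 * (f * J) + 1 ≤ c)

    LeavesDone : Env → Set
    LeavesDone e' = ∃[ w ] ∃[ k ] ∃[ p ] ∃[ x ] ∃[ R ] ∃[ Q ]
      (e' ≡ at w k (d * J) m d ok p x v r dn F Q × Gathered m (d * J) d R Q)

    degree≤m : degree v m ≤ m
    degree≤m = ≤-trans (sum-mono m (λ e _ → select-≤ (sr e) v 1)) (≤-reflexive (trans (sum-const m 1) (*-identityʳ m)))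

    1≤m : 1 ≤ m
    1≤m = ≤-trans (s≤s z≤n) (≤-trans (≤-reflexive (sym degree≡)) degree≤m)

    d≤m : d ≤ m
    d≤m = ≤-trans (≤-reflexive (sym degree≡)) degree≤m

    v≤V : v ≤ V
    v≤V = ≤-trans (<⇒≤ v<n) n≤V

    module _ {e wr l R Q} (e<m : e < m) (g : Gathered e wr l R Q) where
      open Gathered g

      gather-no : sr e ≢ v → Gathered (suc e) wr l R Q
      gather-no ≢v = record
        { wr≡ = wr≡ ; reps = reps ; R-zero = R-zero ; zeros = zeros ; Q≤ = Q≤
        ; c≡ = trans c≡ (sym (trans (cong (degree v e +_) (select-no 1 ≢v)) (+-identityʳ _)))
        ; total = λ x → trans (total x) (sym (trans (cong (outflow v x e +_) (select-no _ ≢v)) (+-identityʳ _))) }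

      degree-yes : sr e ≡ v → suc l ≡ degree v (suc e)
      degree-yes ≡v = trans (cong suc c≡) (trans (+-comm 1 _) (cong (degree v e +_) (sym (select-yes 1 ≡v))))

      l<d : sr e ≡ v → l < d
      l<d ≡v = ≤-trans (≤-reflexive (degree-yes ≡v)) (≤-trans (sum-≤ {suc e} {m} (λ i → select (sr i) v 1) e<m) (≤-reflexive degree≡))

      wr+J≤Z : sr e ≡ v → wr + J ≤ Z
      wr+J≤Z ≡v = begin
        wr + J ≡⟨ cong (_+ J) wr≡ ⟩
        l * J + J ≡⟨ +-comm (l * J) J ⟩
        suc l * J ≤⟨ *-monoˡ-≤ J (≤-trans (l<d ≡v) d≤m) ⟩
        m * J ≤⟨ m≤n*m (m * J) 8 ⟩
        8 * (m * J) ≤⟨ queue≤Z ⟩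
        Z ∎
        where open ≤-Reasoning

      gather-yes : ∀ {Q'} → sr e ≡ v → Filled wr J (λ i → F (tg e * J + i) ∸ wt e) Q Q' (suc J) → (∀ z → Q' z ≤ suc C) →
        Gathered (suc e) (wr + J) (suc l) (R [ l ↦ (λ x → RR (tg e) (x + wt e)) ]) Q'
      gather-yes {Q'} ≡v fl Q'≤ = record
        { wr≡ = trans (cong (_+ J) wr≡) (+-comm (l * J) J) ; Q≤ = Q'≤
        ; c≡ = degree-yes ≡v
        ; reps = reps′
        ; R-zero = λ {i} l<i x → trans (cong (λ f → f x) ([↦]-other R new (<⇒≢ l<i ∘ sym))) (R-zero (<⇒≤ l<i) x)
        ; total = λ x → cong₂ _+_
            (trans (sum-cong l λ i i<l → cong (λ f → f x) ([↦]-other R new (<⇒≢ i<l))) (total x))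
            (trans (cong (λ f → f x) ([↦]-same R l new)) (sym (select-yes (RR (tg e) (x + wt e)) ≡v)))
        ; zeros = λ lt → trans (Filled.same fl (inj₂ (≤-<-trans (wr+J≤Z ≡v) lt))) (zeros lt) }
        where
        new : ℕ → ℕ
        new x = RR (tg e) (x + wt e)
        -- The heads may have different heights, but all are at most `hv`; the lists are brought to
        -- this common error before they are merged.
        ht≤ : 7 * ht (tg e) ≤ 7 * hv
        ht≤ = *-monoʳ-≤ 7 (s≤s⁻¹ (≤-trans (ht-arc e<m) (≤-reflexive (trans (cong ht ≡v) hv≡))))
        reps′ : ∀ {i} → i < suc l → Represents b (7 * hv) J (λ j → Q' (i * J + j)) ((R [ l ↦ new ]) i)
        reps′ {i} i≤l with m≤n⇒m<n∨m≡n (s≤s⁻¹ i≤l)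
        ... | inj₁ i<l = rep-cong {b} {7 * hv} {J}
              (λ j 1≤j j≤J → sym (Filled.same fl (inj₁ (before j≤J))))
              (λ x _ → cong (λ f → f x) (sym ([↦]-other R new (<⇒≢ i<l)))) (reps i<l)
          where
          before : ∀ {j} → j ≤ J → i * J + j ≤ wr
          before {j} j≤J = begin
            i * J + j ≤⟨ +-monoʳ-≤ (i * J) j≤J ⟩
            i * J + J ≡⟨ +-comm (i * J) J ⟩
            suc i * J ≤⟨ *-monoˡ-≤ J i<l ⟩
            l * J ≡⟨ wr≡ ⟨
            wr ∎
            where open ≤-Reasoning
        ... | inj₂ refl = rep-cong {b} {7 * hv} {J}
              (λ j 1≤j j≤J → sym (trans (cong (λ v → Q' (v + j)) (sym wr≡)) (Filled.cells fl 1≤j (s≤s j≤J))))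
              (λ x _ → cong (λ f → f x) (sym ([↦]-same R l new)))
              (rep-shift (wt e) (rep-weaken {b} ht≤ (targets e<m ≡v)))

    leaves-run : ∀ {w k p x Q} → (∀ {z} → Z < z → Q z ≡ 0) → (∀ z → Q z ≤ suc C) →
      Reach leaves (at w k 0 0 d ok p x v r dn F Q) (6 * m + 20 * (d * J) + 1) LeavesDone
    leaves-run {w} {k} {p} {x} {Q} zeros Q≤ = while Inv step _ _
      (w , k , 0 , 0 , p , x , m , d , 0 , (λ _ _ → 0) , Q , refl , refl , refl
      , record { wr≡ = refl ; c≡ = refl ; reps = λ () ; R-zero = λ _ _ → refl ; total = λ _ → refl ; zeros = zeros ; Q≤ = Q≤ }
      , ≤-refl)
      where
      step : ∀ c e' → Inv c e' → CheapT (reg 23 <' reg 36) e' ×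
        ((True (reg 23 <' reg 36) (toState e') × ∃[ k ] ∃[ c' ] (suc (k + c') ≤ c × Reach _ e' k (Inv c')))
         ⊎ (False (reg 23 <' reg 36) (toState e') × 1 ≤ c × LeavesDone e'))
      step c _ (w , k , wr , e , p , x , zero , f , l , R , Q , refl , e≡ , l≡ , g , le) =
        (tt , tt , inj₂ (word m≤V)) , inj₂ ((λ lt → <-irrefl e≡m lt) , ≤-trans (m≤n+m 1 _) le
        , w , k , p , x , R , Q
        , cong₂ (λ a b → at w k a b d ok p x v r dn F Q) (trans (Gathered.wr≡ g) (cong (_* J) l≡d)) e≡m
        , subst₂ (λ a b → Gathered m a b R Q) (trans (Gathered.wr≡ g) (cong (_* J) l≡d)) l≡d (subst (λ a → Gathered a wr l R Q) e≡m g))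
        where
        e≡m : e ≡ m
        e≡m = trans (sym (+-identityʳ e)) e≡
        l≡d : l ≡ d
        l≡d = trans (Gathered.c≡ g) (trans (cong (degree v) e≡m) degree≡)
      step c _ (w , k , wr , e , p , x , suc s , f , l , R , Q , refl , e≡ , l≡ , g , le) =
        (tt , tt , inj₂ (word m≤V)) , inj₁ (e<m , go (sr e ≟ v) f l≡ le)
        where
        e<m : e < m
        e<m = ≤-trans (s≤s (m≤m+n e s)) (≤-reflexive (trans (sym (+-suc e s)) e≡))
        e≤V : e ≤ V
        e≤V = ≤-trans (<⇒≤ e<m) m≤V
        e+1≤V : suc e ≤ V
        e+1≤V = ≤-trans e<m m≤V
        go : Dec (sr e ≡ v) → ∀ f → l + f ≡ d → 6 * suc s + 20 * (f * J) + 1 ≤ c →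
          ∃[ k' ] ∃[ c' ] (suc (k' + c') ≤ c × Reach (27 ≔ val (cell 0 23) ⨾ ifEq 27 28 leaf ⨾ 23 ≔ lit 1 ⊕ reg 23)
                                                 (at w k wr e d ok p x v r dn F Q) k' (Inv c'))
        go (no ≢v) f l≡ le = 5 , 6 * s + 20 * (f * J) + 1 , ≤-trans (≤-reflexive (lem s (20 * (f * J)))) le
          , (e≤V , word (≤-trans (<⇒≤ (sr<n e<m)) n≤V)) ► chain (ifEq-no ≢v (word v≤V)
              (set (tt , tt , word e+1≤V)
                (w , k , wr , suc e , p , sr e , s , f , l , R , Q , refl , trans (sym (+-suc e s)) e≡ , l≡ , gather-no e<m g ≢v , ≤-refl)))
          where
          lem : ∀ s t → 6 + (6 * s + t + 1) ≡ 6 * suc s + t + 1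
          lem = solve-∀
        go (yes ≡v) zero l≡ le = contradiction (trans (sym (+-identityʳ l)) l≡) (<⇒≢ (l<d e<m g ≡v))
        go (yes ≡v) (suc f) l≡ le = _ , 6 * s + 20 * (f * J) + 1 , ≤-trans pay le
          , (e≤V , word (≤-trans (<⇒≤ (sr<n e<m)) n≤V)) ► chain (ifEq-yes ≡v (word v≤V)
              ((e≤V , word (≤-trans (<⇒≤ (tg<n e<m)) n≤V)) ► (tt , tt , a≤V , ≤-trans (m≤m+n _ J) (list-end (tg<n e<m))) ►
               from (at w k wr e d ok (tg e * J) (sr e) v r dn F Q) refl (chain (conseq
                 (copyShifted-run e<m (list-end (tg<n e<m)) (≤-trans (wr+J≤Z e<m g ≡v) Z≤V) (J<V 1≤m) F≤ (Gathered.Q≤ g) w)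
                 λ { _ (w' , Q' , refl , fl , Q'≤) → set (tt , tt , word (≤-trans (wr+J≤Z e<m g ≡v) Z≤V))
                   (set (tt , tt , word e+1≤V)
                     (w' , k , wr + J , suc e , tg e * J , sr e , s , f , suc l , _ , Q' , refl , trans (sym (+-suc e s)) e≡
                     , trans (sym (+-suc l f)) l≡ , gather-yes e<m g ≡v fl Q'≤ , ≤-refl)) }))))
          where
          pay : suc (1 + (2 + (2 + (1 + (J * 8 + 1) + 1)) + 1) + (6 * s + 20 * (f * J) + 1)) ≤ 6 * suc s + 20 * (suc f * J) + 1
          pay = begin
            suc (1 + (2 + (2 + (1 + (J * 8 + 1) + 1)) + 1) + (6 * s + 20 * (f * J) + 1)) ≡⟨ lem s J (f * J) ⟩
            6 * s + 20 * (f * J) + 11 + 8 * J ≤⟨ +-monoˡ-≤ (8 * J) (+-monoʳ-≤ (6 * s + 20 * (f * J)) (+-monoʳ-≤ 7 (*-monoʳ-≤ 4 J>0))) ⟩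
            6 * s + 20 * (f * J) + (7 + 4 * J) + 8 * J ≤⟨ m≤m+n _ (8 * J) ⟩
            6 * s + 20 * (f * J) + (7 + 4 * J) + 8 * J + 8 * J ≡⟨ lem′ s J (f * J) ⟩
            6 * suc s + 20 * (suc f * J) + 1 ∎
            where
            open ≤-Reasoning
            lem : ∀ s J t → suc (1 + (2 + (2 + (1 + (J * 8 + 1) + 1)) + 1) + (6 * s + 20 * t + 1)) ≡ 6 * s + 20 * t + 11 + 8 * J
            lem = solve-∀
            lem′ : ∀ s J t → 6 * s + 20 * t + (7 + 4 * J) + 8 * J + 8 * J ≡ 6 * suc s + 20 * (J + t) + 1
            lem′ = solve-∀

    module _ {wr ε p x : ℕ} {k : Junk} {Q : ℕ → ℕ} (Q≤ : ∀ z → Q z ≤ suc C)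
      (dst : p + J ≤ V) (src : z₉ k + J * 2 ^ ε ≤ Z) where

      CoarseDone : Env → Set
      CoarseDone e' = ∃[ w ] ∃[ F' ] (e' ≡ at w k wr ε d ok p x v r dn F' Q
        × Filled p J (λ i → Q (z₉ k + i * 2 ^ ε)) F F' (suc J) × (∀ z → F' z ≤ suc C))

      private
        CoarseInv : ℕ → Env → Set
        CoarseInv s e' = ∃[ w ] ∃[ F' ] (e' ≡ at w k wr ε d ok p x v r dn F' Q × 1 ≤ Scratch.w₂ w × Scratch.w₂ w + s ≡ suc J
          × Filled p J (λ i → Q (z₉ k + i * 2 ^ ε)) F F' (Scratch.w₂ w) × (∀ z → F' z ≤ suc C))

      copyCoarse-run : ∀ w → Reach copyCoarse (at w k wr ε d ok p x v r dn F Q) (1 + (J * 7 + 1)) CoarseDone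
      copyCoarse-run w = (tt , word 1≤V) ►
        for 6 CoarseInv step J _ (_ , _ , refl , ≤-refl , refl , filled-start , F≤)
        where
        step : ∀ s e' → CoarseInv s e' → CheapT (reg 2 ≤' reg 32) e' ×
          ((True (reg 2 ≤' reg 32) (toState e') × ∃[ s' ] (s ≡ suc s' × Reach _ e' 6 (CoarseInv s')))
           ⊎ (False (reg 2 ≤' reg 32) (toState e') × CoarseDone e'))
        step zero _ (w , F' , refl , 1≤j , j≡ , fl , F'≤) = (tt , tt , inj₂ (word (<⇒≤ (J<V 1≤m))))
          , inj₂ ((λ j≤J → <-irrefl refl (≤-trans (s≤s j≤J) (≤-reflexive j≡J)))
          , w , F' , refl , subst (Filled p J _ F F') (sym j≡J) fl , F'≤)
          where
          j≡J : suc J ≡ Scratch.w₂ w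
          j≡J = trans (sym j≡) (+-identityʳ _)
        step (suc s) _ (w@(scratch i₀ i₁ j i₃ i₄ i₅ i₆ i₇ i₈ i₉ i₁₀ i₁₁) , F' , refl , 1≤j , j≡ , fl , F'≤) =
          (tt , tt , inj₂ (word (<⇒≤ (J<V 1≤m)))) , inj₁ (j≤J , s , refl
          , (tt , tt , ε≤V , ≤-trans (m≤n+m _ (z₉ k)) from≤V) ► (tt , tt , word from≤V) ► (from≤V , cap (Q≤ _)) ►
            from (at (scratch i₀ i₁ j i₃ i₄ i₅ i₆ i₇ i₈ i₉ (Q (z₉ k + j * 2 ^ ε)) i₁₁) k wr ε d ok p x v r dn F' Q) refl
            ((tt , tt , word to≤V) ► chain (put to≤V (tt , cap (Q≤ _))
              (set (tt , tt , word (≤-trans (s≤s j≤J) (J<V 1≤m)))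
                (_ , _ , refl , s≤s z≤n , trans (sym (+-suc j s)) j≡ , filled-step 1≤j j≤J refl fl , [↦]-bound F' (Q≤ _) F'≤)))))
          where
          j≤J : j ≤ J
          j≤J = s≤s⁻¹ (≤-trans (s≤s (m≤m+n j s)) (≤-reflexive (trans (sym (+-suc j s)) j≡)))
          from≤V : z₉ k + j * 2 ^ ε ≤ V
          from≤V = ≤-trans (+-monoʳ-≤ (z₉ k) (*-monoˡ-≤ (2 ^ ε) j≤J)) (≤-trans src Z≤V)
          to≤V : p + j ≤ V
          to≤V = ≤-trans (+-monoʳ-≤ p j≤J) dst
          ε≤V : ε ≤ V
          ε≤V = ≤-trans (<⇒≤ (n<2^n ε)) (≤-trans (m≤n*m (2 ^ ε) J {{m^n≢0 2 a}}) (≤-trans (m≤n+m _ (z₉ k)) (≤-trans src Z≤V)))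

    BuildDone : Env → Set
    BuildDone e' = ∃[ w ] ∃[ k ] ∃[ wr ] ∃[ e ] ∃[ p ] ∃[ x ] ∃[ F' ] ∃[ Q ]
      (e' ≡ at w k wr e d ok p x v r dn F' Q × ListOf F' v
       × (∀ {z} → Outside (v * J) J z → F' z ≡ F z) × (∀ z → F' z ≤ suc C)
       × (∀ {z} → Z < z → Q z ≡ 0) × (∀ z → Q z ≤ suc C))

    private
      -- Of the 1300, the merging levels take 200 times the initial potential factor 6, and
      -- gathering the lists takes 20; the rest covers the copy back and constant overhead.
      build-cost : ∀ m y J → 1 ≤ J →
        2 + ((6 * m + 20 * (suc y * J) + 1) + (5 + ((200 * (6 * (y * J)) + 1) + (2 + (1 + (J * 7 + 1)))))) ≤ 6 * m + 1300 * (suc y * J)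
      build-cost m y J 1≤J = begin
        2 + ((6 * m + 20 * (suc y * J) + 1) + (5 + ((200 * (6 * (y * J)) + 1) + (2 + (1 + (J * 7 + 1))))))
          ≡⟨ lem m y J ⟩
        6 * m + 1220 * (y * J) + 27 * J + 13 * 1
          ≤⟨ +-monoʳ-≤ (6 * m + 1220 * (y * J) + 27 * J) (*-monoʳ-≤ 13 1≤J) ⟩
        6 * m + 1220 * (y * J) + 27 * J + 13 * J
          ≤⟨ m≤m+n _ (80 * (y * J) + 1260 * J) ⟩
        6 * m + 1220 * (y * J) + 27 * J + 13 * J + (80 * (y * J) + 1260 * J)
          ≡⟨ lem′ m y J ⟩
        6 * m + 1300 * (suc y * J) ∎
        where
        open ≤-Reasoning
        lem : ∀ m y J → 2 + ((6 * m + 20 * (suc y * J) + 1) + (5 + ((200 * (6 * (y * J)) + 1) + (2 + (1 + (J * 7 + 1))))))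
                        ≡ 6 * m + 1220 * (y * J) + 27 * J + 13 * 1
        lem = solve-∀
        lem′ : ∀ m y J → 6 * m + 1220 * (y * J) + 27 * J + 13 * J + (80 * (y * J) + 1260 * J) ≡ 6 * m + 1300 * (suc y * J)
        lem′ = solve-∀

    build-run : ∀ {w k wr e p x Q} → (∀ {z} → Z < z → Q z ≡ 0) → (∀ z → Q z ≤ suc C) →
      Reach build (at w k wr e d ok p x v r dn F Q) (6 * m + 1300 * (d * J)) BuildDone
    build-run {w} {k} {wr} {e} {p} {x} {Q} zeros Q≤ = relax (build-cost m y J J>0)
      ((tt , word z≤n) ► (tt , word z≤n) ► chain (conseq (leaves-run {w} {k} {p} {x} {Q} zeros Q≤)
        λ { _ (w , k , p , x , R , Q , refl , g) → middle w k p x R Q g }))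
      where
      module L = LevelRun n C V u word-V number-C sr tg wt dn F Z
      final : Program
      final = 23 ≔ reg 16 ⊖ reg 31 ⨾ 26 ≔ reg 28 ≪ reg 30 ⨾ copyCoarse
      tail : ℕ → ℕ → List ℕ
      tail p x = m ∷ d ∷ ok ∷ p ∷ x ∷ v ∷ r ∷ a ∷ b ∷ J ∷ Z ∷ suc C ∷ n ∷ m ∷ ρ
      finish : ∀ w p₁ p₂ pw σ ε q Jo rd wr Q p x →
        Represents (b + ε) ((7 * hv + 7) * 2 ^ ε) (J * 2 ^ ε) (λ i → Q (rd + i)) (RR v) →
        rd + J * 2 ^ ε ≤ Z → (∀ {z} → Z < z → Q z ≡ 0) → (∀ z → Q z ≤ suc C) →
        Reach final (at w (junk p₁ p₂ pw σ (b + ε) (J * 2 ^ ε) q Jo 0 rd) wr m d ok p x v r dn F Q) (2 + (1 + (J * 7 + 1))) BuildDone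
      finish w p₁ p₂ pw σ ε q Jo rd wr Q p x rep src zeros Q≤ =
        (tt , tt , word b+ε≤V , word b≤V) ► (tt , tt , a≤V , ≤-trans (m≤m+n _ J) (list-end v<n)) ►
        from (at w k' wr ε d ok (v * J) x v r dn F Q)
          (cong (λ i → at w k' wr i d ok (v * J) x v r dn F Q) (m+n∸m≡n b ε))
          (conseq (copyCoarse-run Q≤ (list-end v<n) src w)
            λ { _ (w' , F' , refl , fl , F'≤) → w' , k' , wr , ε , v * J , x , F' , Q , refl
              , rep-cong {b} {7 * ht v} {J} (λ i 1≤i i≤J → sym (Filled.cells fl 1≤i (s≤s i≤J))) (λ _ _ → refl)
                  (rep-coarsen {b} {7 * ht v} {(7 * hv + 7) * 2 ^ ε} ε (*-monoˡ-≤ (2 ^ ε) (≤-reflexive k≡)) ≤-refl rep)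
              , Filled.same fl , F'≤ , zeros , Q≤ })
        where
        k' : Junk
        k' = junk p₁ p₂ pw σ (b + ε) (J * 2 ^ ε) q Jo 0 rd
        k≡ : 7 * hv + 7 ≡ 7 * ht v
        k≡ = trans (+-comm (7 * hv) 7) (trans (sym (*-suc 7 hv)) (cong (7 *_) (sym hv≡)))
        b+ε≤V : b + ε ≤ V
        b+ε≤V = begin
          b + ε ≤⟨ +-monoˡ-≤ ε b≤a ⟩
          a + ε ≤⟨ <⇒≤ (n<2^n (a + ε)) ⟩
          2 ^ (a + ε) ≡⟨ ^-distribˡ-+-* 2 a ε ⟩
          J * 2 ^ ε ≤⟨ m≤n+m _ rd ⟩
          rd + J * 2 ^ ε ≤⟨ src ⟩
          Z ≤⟨ Z≤V ⟩
          V ∎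
          where open ≤-Reasoning
      middle : ∀ w k p x R Q → Gathered m (d * J) d R Q →
        Reach (20 ≔ reg 24 ⊖ lit 1 ⨾ 21 ≔ val (lit 0) ⨾ 15 ≔ val (lit 1) ⨾ 16 ≔ val (reg 31) ⨾ 17 ≔ val (reg 32) ⨾ levels ⨾ final)
          (at w k (d * J) m d ok p x v r dn F Q) (5 + ((200 * (6 * (y * J)) + 1) + (2 + (1 + (J * 7 + 1))))) BuildDone
      middle w k p x R Q g =
        (tt , tt , word (≤-trans d≤m m≤V) , word 1≤V) ► (tt , word z≤n) ► (tt , word 1≤V) ► (tt , word b≤V) ► (tt , word (<⇒≤ (J<V 1≤m))) ►
        from (L.atL (tail p x) refl refl room w (z₀ k) (z₁ k) (z₂ k) 1 b J (z₆ k) (z₇ k) y 0 (d * J) Q) refl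
        (chain (conseq
          (L.Levels.levels-run (tail p x) refl refl room b (7 * hv) J (RR v) (^-monoʳ-≤ 2 b≤a) _
            (w , z₀ k , z₁ k , z₂ k , 1 , 0 , J , z₆ k , z₇ k , y , 0 , d * J , Q , 7 * hv , R
            , cong (λ i → L.atL (tail p x) refl refl room w (z₀ k) (z₁ k) (z₂ k) 1 i J (z₆ k) (z₇ k) y 0 (d * J) Q) (sym (+-identityʳ b))
            -- The first level already gains a bit, so `σ` starts at 1, and the error bound starts
            -- with equality.
            , record { σ≤1 = ≤-refl ; J≡ = sym (*-identityʳ J) ; err = ≤-reflexive (lem hv) ; src = ≤-refl
                     ; space = space ; zeros = Gathered.zeros g ; Q≤ = Gathered.Q≤ g
                     ; reps = λ {i} i≤y → subst (λ c → Represents c (7 * hv) J (λ j → Q (i * J + j)) (R i)) (sym (+-identityʳ b)) (Gathered.reps g (s≤s i≤y))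
                     ; R-zero = Gathered.R-zero g ; total = λ x → trans (Gathered.total g x) (sym (rec x)) }
            , ≤-refl))
          λ { _ (w , p₁ , p₂ , pw , σ , ε , q , Jo , rd , wr , Q , refl , rep , src , zeros , Q≤) →
                finish w p₁ p₂ pw σ ε q Jo rd wr Q p x rep src zeros Q≤ }))
        where
        lem : ∀ h → 7 * h + 10 ≡ (7 * h + 7) * 1 + 3
        lem = solve-∀
        -- The gathered lists and the initial potential need less than `7 * (m * J)` cells in total
        -- or exactly that much; the work space takes 8 instead, a power of two that a shift
        -- computes.
        space : d * J + 6 * (y * J) ≤ Z
        space = begin
          d * J + 6 * (y * J) ≤⟨ +-monoʳ-≤ (d * J) (*-monoʳ-≤ 6 (*-monoˡ-≤ J (n≤1+n y))) ⟩
          7 * (d * J) ≤⟨ *-mono-≤ (n≤1+n 7) (*-monoˡ-≤ J d≤m) ⟩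
          8 * (m * J) ≤⟨ queue≤Z ⟩
          Z ∎
          where open ≤-Reasoning

  module Rounds (t : ℕ) (n>0 : 1 ≤ n) (ht<n : ∀ {v} → v < n → ht v < n)
    (rec : ∀ {v} → v ≢ t → ∀ x → RR v x ≡ outflow v x m) where

    -- By `fresh` an unwritten list is zero, so a vertex without outgoing arcs only has to be
    -- marked. The target is marked from the start, hence its list is never rebuilt from its
    -- outgoing arcs.
    record Good (dn F Q : ℕ → ℕ) : Set where
      field
        dn≤1  : ∀ z → dn z ≤ 1
        dn-t  : dn t ≢ 0
        built : ∀ {v} → v < n → dn v ≢ 0 → ListOf F v
        fresh : ∀ {v} → v < n → dn v ≡ 0 → ∀ {i} → 1 ≤ i → i ≤ J → F (v * J + i) ≡ 0
        F≤    : ∀ z → F z ≤ suc C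
        zeros : ∀ {z} → Z < z → Q z ≡ 0
        Q≤    : ∀ z → Q z ≤ suc C

    Ready : (ℕ → ℕ) → ℕ → ℕ → Set
    Ready dn v k = ∀ e → e < k → sr e ≡ v → dn (tg e) ≢ 0

    private
      degree≤ : ∀ v {k} → k ≤ m → degree v k ≤ m
      degree≤ v {k} k≤m = ≤-trans (sum-mono k (λ e _ → select-≤ (sr e) v 1))
        (≤-trans (≤-reflexive (trans (sum-const k 1) (*-identityʳ k))) k≤m)

    module _ {v r : ℕ} {dn F Q : ℕ → ℕ} (v<n : v < n) (g : Good dn F Q) where
      open Good g

      private
        vertex≤V : v ≤ V
        vertex≤V = ≤-trans (<⇒≤ v<n) n≤V

      record Scanned (e d ok : ℕ) : Set where
        field
          d≡    : d ≡ degree v e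
          ok≤1  : ok ≤ 1
          sound : 1 ≤ ok → Ready dn v e
          compl : Ready dn v e → 1 ≤ ok

      private
        ScanInv : ℕ → Env → Set
        ScanInv s e' = ∃[ w ] ∃[ k ] ∃[ wr ] ∃[ e ] ∃[ d ] ∃[ ok ] ∃[ p ] ∃[ x ]
          (e' ≡ at w k wr e d ok p x v r dn F Q × e + s ≡ m × Scanned e d ok)

      ScanDone : Env → Set
      ScanDone e' = ∃[ w ] ∃[ k ] ∃[ wr ] ∃[ ok ] ∃[ p ] ∃[ x ]
        (e' ≡ at w k wr m (degree v m) ok p x v r dn F Q × Scanned m (degree v m) ok)

      module _ {e d ok : ℕ} (sc : Scanned e d ok) where
        open Scanned sc

        skip-arc : sr e ≢ v → Scanned (suc e) d ok
        skip-arc ≢v = record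
          { d≡ = trans d≡ (sym (trans (cong (degree v e +_) (select-no 1 ≢v)) (+-identityʳ _))) ; ok≤1 = ok≤1
          ; sound = λ 1≤ok → extend (sound 1≤ok)
          ; compl = λ rdy → compl λ i i<e → rdy i (m≤n⇒m≤1+n i<e) }
          where
          extend : Ready dn v e → Ready dn v (suc e)
          extend rdy i i≤e ≡v with m≤n⇒m<n∨m≡n (s≤s⁻¹ i≤e)
          ... | inj₁ i<e  = rdy i i<e ≡v
          ... | inj₂ refl = contradiction ≡v ≢v

        d-suc : sr e ≡ v → suc d ≡ degree v (suc e)
        d-suc ≡v = trans (cong suc d≡) (trans (+-comm 1 _) (cong (degree v e +_) (sym (select-yes 1 ≡v))))

        done-arc : sr e ≡ v → dn (tg e) ≢ 0 → Scanned (suc e) (suc d) ok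
        done-arc ≡v dn≢ = record
          { d≡ = d-suc ≡v ; ok≤1 = ok≤1
          ; sound = λ 1≤ok → extend (sound 1≤ok)
          ; compl = λ rdy → compl λ i i<e → rdy i (m≤n⇒m≤1+n i<e) }
          where
          extend : Ready dn v e → Ready dn v (suc e)
          extend rdy i i≤e ≡v with m≤n⇒m<n∨m≡n (s≤s⁻¹ i≤e)
          ... | inj₁ i<e  = rdy i i<e ≡v
          ... | inj₂ refl = dn≢

        undone-arc : sr e ≡ v → dn (tg e) ≡ 0 → Scanned (suc e) (suc d) 0
        undone-arc ≡v dn≡ = record
          { d≡ = d-suc ≡v ; ok≤1 = z≤n ; sound = λ () ; compl = λ rdy → contradiction dn≡ (rdy e ≤-refl ≡v) }

      scan-run : ∀ {w k wr e d ok p x} → Reach scan (at w k wr e d ok p x v r dn F Q) (3 + (m * 10 + 1)) ScanDone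
      scan-run {w} {k} {wr} {e} {d} {ok} {p} {x} =
        (tt , word z≤n) ► (tt , word 1≤V) ► (tt , word z≤n) ► for 9 ScanInv step m _
          (w , k , wr , 0 , 0 , 1 , p , x , refl , refl
          , record { d≡ = refl ; ok≤1 = ≤-refl ; sound = λ _ _ () ; compl = λ _ → ≤-refl })
        where
        step : ∀ s e' → ScanInv s e' → CheapT (reg 23 <' reg 36) e' ×
          ((True (reg 23 <' reg 36) (toState e') × ∃[ s' ] (s ≡ suc s' × Reach _ e' 9 (ScanInv s')))
           ⊎ (False (reg 23 <' reg 36) (toState e') × ScanDone e'))
        step zero _ (w , k , wr , e , d , ok , p , x , refl , e≡ , sc) =
          (tt , tt , inj₂ (word m≤V)) , inj₂ ((λ lt → <-irrefl e≡m lt)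
          , w , k , wr , ok , p , x , cong₂ (λ a b → at w k wr a b ok p x v r dn F Q) e≡m d≡
          , subst₂ (λ a b → Scanned a b ok) e≡m d≡ sc)
          where
          e≡m : e ≡ m
          e≡m = trans (sym (+-identityʳ e)) e≡
          d≡ : d ≡ degree v m
          d≡ = trans (Scanned.d≡ sc) (cong (degree v) e≡m)
        step (suc s) _ (w , k , wr , e , d , ok , p , x , refl , e≡ , sc) =
          (tt , tt , inj₂ (word m≤V)) , inj₁ (e<m , s , refl
          , (e≤V , word (≤-trans (<⇒≤ (sr<n e<m)) n≤V)) ► go (sr e ≟ v))
          where
          e<m : e < m
          e<m = ≤-trans (s≤s (m≤m+n e s)) (≤-reflexive (trans (sym (+-suc e s)) e≡))
          e≤V : e ≤ V
          e≤V = ≤-trans (<⇒≤ e<m) m≤V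
          e+1≤V : suc e ≤ V
          e+1≤V = ≤-trans e<m m≤V
          e≡' : suc e + s ≡ m
          e≡' = trans (sym (+-suc e s)) e≡
          d+1≤V : sr e ≡ v → suc d ≤ V
          d+1≤V ≡v = ≤-trans (≤-reflexive (d-suc sc ≡v)) (≤-trans (degree≤ v e<m) m≤V)
          go : Dec (sr e ≡ v) → Reach (ifEq 27 28 (24 ≔ lit 1 ⊕ reg 24 ⨾ 27 ≔ val (cell 1 23) ⨾ 27 ≔ val (cell 3 27) ⨾
                 (IF lit 0 <' reg 27 THEN skip ELSE (25 ≔ val (lit 0)))) ⨾ 23 ≔ lit 1 ⊕ reg 23)
                 (at w k wr e d ok p (sr e) v r dn F Q) 8 (ScanInv s)
          go (no ≢v) = relax (m≤m+n 4 4) (chain (ifEq-no ≢v (word vertex≤V) (set (tt , tt , word e+1≤V)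
            (w , k , wr , suc e , d , ok , p , sr e , refl , e≡' , skip-arc sc ≢v))))
          go (yes ≡v) = chain {k = 7} {k' = 1} (ifEq-yes ≡v (word vertex≤V)
            ((tt , tt , word (d+1≤V ≡v)) ►
             (e≤V , word (≤-trans (<⇒≤ (tg<n e<m)) n≤V)) ►
             (≤-trans (<⇒≤ (tg<n e<m)) n≤V , word (≤-trans (dn≤1 (tg e)) 1≤V)) ►
             from (at w k wr e (suc d) ok p (dn (tg e)) v r dn F Q) refl (branch (tt , tt , inj₁ (word z≤n))
               (λ lt → nothing (set (tt , tt , word e+1≤V)
                 (w , k , wr , suc e , suc d , ok , p , dn (tg e) , refl , e≡' , done-arc sc ≡v (λ e → <⇒≢ lt (sym e)))))
               (λ ¬lt → set (tt , word z≤n) (set (tt , tt , word e+1≤V)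
                 (w , k , wr , suc e , suc d , 0 , p , dn (tg e) , refl , e≡' , undone-arc sc ≡v (n≤0⇒n≡0 (≮⇒≥ ¬lt))))))))

      private
        no-arc : degree v m ≡ 0 → ∀ {e} → e < m → sr e ≢ v
        no-arc deg≡0 {e} e<m ≡v = contradiction
          (≤-trans (≤-reflexive (sym (select-yes 1 ≡v))) (≤-trans (sum-term {m} {λ i → select (sr i) v 1} e<m) (≤-reflexive deg≡0)))
          λ ()

        marked : ∀ {F' Q'} → ListOf F' v → (∀ {z} → Outside (v * J) J z → F' z ≡ F z) → (∀ z → F' z ≤ suc C) →
                 (∀ {z} → Z < z → Q' z ≡ 0) → (∀ z → Q' z ≤ suc C) → Good (dn [ v ↦ 1 ]) F' Q'
        marked {F'} lst same F'≤ zeros' Q'≤ = record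
          { dn≤1 = [↦]-bound dn ≤-refl dn≤1
          ; dn-t = one-or t dn-t
          ; built = built′
          ; fresh = λ {v'} v'<n eq 1≤i i≤J → trans (same (other-list (≢v eq) 1≤i i≤J))
                      (fresh v'<n (trans (sym ([↦]-other dn 1 (≢v eq))) eq) 1≤i i≤J)
          ; F≤ = F'≤ ; zeros = zeros' ; Q≤ = Q'≤ }
          where
          one-or : ∀ v' → dn v' ≢ 0 → (dn [ v ↦ 1 ]) v' ≢ 0
          one-or v' dn≢ with v' ≡ᵇ v
          ... | true  = λ ()
          ... | false = dn≢
          ≢v : ∀ {v'} → (dn [ v ↦ 1 ]) v' ≡ 0 → v' ≢ v
          ≢v eq refl = contradiction (trans (sym ([↦]-same dn v 1)) eq) λ ()
          built′ : ∀ {v'} → v' < n → (dn [ v ↦ 1 ]) v' ≢ 0 → ListOf F' v'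
          built′ {v'} v'<n dn≢ with v' ≟ v
          ... | yes refl = lst
          ... | no v'≢v  = rep-cong {b} {7 * ht v'} {J} (λ i 1≤i i≤J → sym (same (other-list v'≢v 1≤i i≤J))) (λ _ _ → refl)
                             (built v'<n (λ eq → dn≢ (trans ([↦]-other dn 1 v'≢v) eq)))

      VertexAt : (ℕ → ℕ) → (F' Q' : ℕ → ℕ) → Env → Set
      VertexAt dn' F' Q' e' = ∃[ w ] ∃[ k ] ∃[ wr ] ∃[ e ] ∃[ d ] ∃[ ok ] ∃[ p ] ∃[ x ]
        (e' ≡ at w k wr e d ok p x v r dn' F' Q')

      module _ (dn≡0 : dn v ≡ 0) where
        private
          v≢t : v ≢ t
          v≢t refl = dn-t dn≡0

        vertex-wait : ∀ {w k wr e d ok p x} → ¬ Ready dn v m →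
          Reach vertex (at w k wr e d ok p x v r dn F Q) (3 + (m * 10 + 1) + 2) (VertexAt dn F Q)
        vertex-wait {w} {k} {wr} {e} {d} {ok} {p} {x} ¬rdy = chain (conseq (scan-run {w} {k} {wr} {e} {d} {ok} {p} {x})
          λ { _ (w , k , wr , ok , p , x , refl , sc) → branch (tt , tt , inj₁ (word z≤n))
                (λ lt → contradiction (Scanned.sound sc lt) ¬rdy)
                (λ _ → nothing (w , k , wr , m , degree v m , ok , p , x , refl)) })

        vertex-process : ∀ {w k wr e d ok p x} → Ready dn v m →
          Reach vertex (at w k wr e d ok p x v r dn F Q) (3 + (m * 10 + 1) + (4 + (6 * m + 1300 * (degree v m * J))))
            (λ e' → ∃[ F' ] ∃[ Q' ] (VertexAt (dn [ v ↦ 1 ]) F' Q' e' × Good (dn [ v ↦ 1 ]) F' Q'))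
        vertex-process {w} {k} {wr} {e} {d} {ok} {p} {x} rdy = chain (conseq (scan-run {w} {k} {wr} {e} {d} {ok} {p} {x})
          λ { _ (w , k , wr , ok , p , x , refl , sc) → branch (tt , tt , inj₁ (word z≤n))
                (λ _ → chain (put vertex≤V (tt , word 1≤V) (from (at w k wr m (degree v m) ok p x v r (dn [ v ↦ 1 ]) F Q) refl
                  (branch (tt , tt , inj₁ (word z≤n))
                    (λ lt → relax (n≤1+n _) (go w k wr ok p x (degree v m) refl lt))
                    (λ ¬lt → relax (s≤s z≤n) (nothing (F , Q , (w , k , wr , m , degree v m , ok , p , x , refl)
                      , marked (empty (n≤0⇒n≡0 (≮⇒≥ ¬lt))) (λ _ → refl) F≤ zeros Q≤)))))))
                (λ ¬lt → contradiction (Scanned.compl sc rdy) ¬lt) })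
          where
          empty : degree v m ≡ 0 → ListOf F v
          empty deg≡0 = rep-cong {b} {7 * ht v} {J} (λ _ _ _ → refl)
            (λ x _ → sym (trans (rec v≢t x) (trans (sum-cong m λ e e<m → select-no _ (no-arc deg≡0 e<m)) (sum-zero m))))
            (rep-zero b λ i → fresh v<n dn≡0)
          go : ∀ w k wr ok p x d → degree v m ≡ d → 0 < d →
            Reach build (at w k wr m d ok p x v r (dn [ v ↦ 1 ]) F Q) (6 * m + 1300 * (d * J))
              (λ e' → ∃[ F' ] ∃[ Q' ] (VertexAt (dn [ v ↦ 1 ]) F' Q' e' × Good (dn [ v ↦ 1 ]) F' Q'))
          go w k wr ok p x (suc y) deg≡ _ = conseq
            (build-run v (pred (ht v)) v<n (sym (suc-pred (ht v) {{≢-nonZero ht≢0}})) (rec v≢t) F F≤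
              (λ e<m ≡v → built (tg<n e<m) (rdy _ e<m ≡v)) y ok r (dn [ v ↦ 1 ]) deg≡ {w} {k} {wr} {m} {p} {x} {Q} zeros Q≤)
            λ { _ (w , k , wr , e , p , x , F' , Q' , refl , lst , same , F'≤ , zeros' , Q'≤) →
                  F' , Q' , (w , k , wr , e , suc y , ok , p , x , refl) , marked lst same F'≤ zeros' Q'≤ }
            where
            ht≢0 : ht v ≢ 0
            ht≢0 ht≡0 = contradiction (trans (sym deg≡) (trans (sum-cong m λ e e<m → select-no 1 λ ≡v →
              contradiction (ht-arc e<m) (subst (λ h → ¬ ht (tg e) < h) (sym (trans (cong ht ≡v) ht≡0)) λ ())) (sum-zero m))) λ ()

    pending : (ℕ → ℕ) → ℕ
    pending dn = sum n (λ v → select (dn v) 0 (degree v m))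

    pending-mark : ∀ {dn v} → v < n → dn v ≡ 0 → degree v m + pending (dn [ v ↦ 1 ]) ≤ pending dn
    pending-mark {dn} {v} v<n dn≡0 = sum-gap v<n le (≤-reflexive (trans
        (cong (degree v m +_) (trans (cong (λ d → select d 0 (degree v m)) ([↦]-same dn v 1)) refl))
        (trans (+-identityʳ _) (sym (select-yes (degree v m) dn≡0)))))
      where
      le : ∀ j → j < n → select ((dn [ v ↦ 1 ]) j) 0 (degree j m) ≤ select (dn j) 0 (degree j m)
      le j _ with j ≡ᵇ v
      ... | true  = z≤n
      ... | false = ≤-refl

    -- A vertex of height `h` is processed in round `h` at the latest, because its heads have
    -- smaller heights and were processed in earlier rounds. Heights are below `n`, so `n` rounds
    -- suffice; `now` is the part of the current round already done.
    record Progress (v r : ℕ) (dn : ℕ → ℕ) : Set where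
      field
        before : ∀ {v'} → v' < n → ht v' < r → dn v' ≢ 0
        now    : ∀ {v'} → v' < v → v' < n → ht v' ≤ r → dn v' ≢ 0

    private
      -- Each of the `s` remaining visits pays for scanning all arcs. Building a list is paid from
      -- the out-degrees of the unmarked vertices, which sum to at most `m`.
      credit : ℕ → (ℕ → ℕ) → ℕ
      credit s dn = s * (20 * m + 20) + 1300 * (pending dn * J) + 1

      Inv : ℕ → Env → Set
      Inv c e' = ∃[ w ] ∃[ k ] ∃[ wr ] ∃[ e ] ∃[ d ] ∃[ ok ] ∃[ p ] ∃[ x ] ∃[ v ] ∃[ r ] ∃[ dn ] ∃[ F ] ∃[ Q ] ∃[ s ]
        (e' ≡ at w k wr e d ok p x v r dn F Q × Good dn F Q × Progress v r dn × v < n × r ≤ n × r * n + v + s ≡ n * n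
         × credit s dn ≤ c)

    RoundsDone : Env → Set
    RoundsDone e' = ∃[ w ] ∃[ k ] ∃[ wr ] ∃[ e ] ∃[ d ] ∃[ ok ] ∃[ p ] ∃[ x ] ∃[ v ] ∃[ r ] ∃[ dn ] ∃[ F ] ∃[ Q ]
      (e' ≡ at w k wr e d ok p x v r dn F Q × (∀ z → F z ≤ suc C) × (∀ {v} → v < n → ListOf F v))

    wrap-run : ∀ {c w k wr e d ok p x v r dn F Q s} → Good dn F Q → Progress (suc v) r dn → v < n → r < n →
      r * n + v + suc s ≡ n * n → credit s dn ≤ c →
      Reach wrap (at w k wr e d ok p x (suc v) r dn F Q) 3 (Inv c)
    wrap-run {v = v} {r} {dn} {s = s} g pr v<n r<n meas le = branch (tt , tt , inj₂ (word n≤V))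
      (λ lt → relax (n≤1+n 1) (nothing (_ , _ , _ , _ , _ , _ , _ , _ , _ , _ , _ , _ , _ , s , refl , g , pr , lt , <⇒≤ r<n
        , trans (advance-index (r * n) v s) meas , le)))
      (λ ¬lt → (tt , word z≤n) ► set (tt , tt , word (≤-trans r<n n≤V))
        (_ , _ , _ , _ , _ , _ , _ , _ , _ , _ , _ , _ , _ , s , refl , g
        , record { before = λ v'<n lt → Progress.now pr (≤-trans v'<n (≮⇒≥ ¬lt)) v'<n (s≤s⁻¹ lt) ; now = λ () }
        , n>0 , r<n
        , trans (cong (_+ s) (trans (+-identityʳ _) (trans (+-comm n (r * n)) (cong (r * n +_) (sym (≤-antisym v<n (≮⇒≥ ¬lt)))))))
            (trans (advance-index (r * n) v s) meas)
        , le))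

    Step : ℕ → Env → Set
    Step c e = ∃[ k ] ∃[ c' ] (suc (k + c') ≤ c × Reach (visit ⨾ wrap) e k (Inv c'))

    module _ {v r s : ℕ} {dn F Q : ℕ → ℕ} (g : Good dn F Q) (pr : Progress v r dn) (v<n : v < n) (r<n : r < n)
      (meas : r * n + v + suc s ≡ n * n) where
      private
        visited : ∀ {dn'} → (∀ {v'} → dn v' ≢ 0 → dn' v' ≢ 0) → (ht v ≤ r → dn' v ≢ 0) → Progress (suc v) r dn'
        visited {dn'} keep new = record
          { before = λ v'<n lt → keep (Progress.before pr v'<n lt)
          ; now = λ v'≤v → now′ (m≤n⇒m<n∨m≡n (s≤s⁻¹ v'≤v)) }
          where
          now′ : ∀ {v'} → v' < v ⊎ v' ≡ v → v' < n → ht v' ≤ r → dn' v' ≢ 0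
          now′ (inj₁ v'<v) v'<n ht≤ = keep (Progress.now pr v'<v v'<n ht≤)
          now′ (inj₂ refl) _    ht≤ = new ht≤

        ready : ht v ≤ r → Ready dn v m
        ready ht≤ e e<m ≡v = Progress.before pr (tg<n e<m) (<-≤-trans (ht-arc e<m) (subst (λ i → ht i ≤ r) (sym ≡v) ht≤))

        visit-from : ∀ {w k wr e d ok p x j k' c} → Reach ((IF lit 0 <' reg 27 THEN skip ELSE vertex) ⨾ 28 ≔ lit 1 ⊕ reg 28)
          (at w k wr e d ok p (dn v) v r dn F Q) j (λ e → Reach wrap e k' (Inv c)) →
          Reach (visit ⨾ wrap) (at w k wr e d ok p x v r dn F Q) (suc j + k') (Inv c)
        visit-from rest = chain (chain {k = 1} (set (≤-trans (<⇒≤ v<n) n≤V , word (≤-trans (Good.dn≤1 g v) 1≤V)) rest))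

        next≤V : suc v ≤ V
        next≤V = ≤-trans v<n n≤V

        visit-done : ∀ {w k wr e d ok p x} → dn v ≢ 0 → Step (credit (suc s) dn) (at w k wr e d ok p x v r dn F Q)
        visit-done dn≢0 = 7 , credit s dn , idle-credit 8 m (s * (20 * m + 20)) (1300 * (pending dn * J)) (m≤m+n 8 5)
          , visit-from (chain {k = 2} (branch (tt , tt , inj₁ (word z≤n))
              (λ _ → nothing (set (tt , tt , word next≤V) (wrap-run g (visited id (λ _ → dn≢0)) v<n r<n meas ≤-refl)))
              (λ ¬lt → contradiction (n≤0⇒n≡0 (≮⇒≥ ¬lt)) dn≢0)))

        visit-wait : ∀ {w k wr e d ok p x} → dn v ≡ 0 → ¬ Ready dn v m → Step (credit (suc s) dn) (at w k wr e d ok p x v r dn F Q)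
        visit-wait {w} {k} {wr} {e} {d} {ok} {p} dn≡0 ¬rdy = suc (suc (3 + (m * 10 + 1) + 2) + 1) + 3 , credit s dn , wait-credit m (s * (20 * m + 20)) (1300 * (pending dn * J))
          , visit-from (chain (branch (tt , tt , inj₁ (word z≤n))
              (λ lt → contradiction (sym dn≡0) (<⇒≢ lt))
              (λ _ → conseq (vertex-wait v<n g dn≡0 {w} {k} {wr} {e} {d} {ok} {p} {dn v} ¬rdy)
                λ { _ (w , k , wr , e , d , ok , p , x , refl) → set (tt , tt , word next≤V)
                    (wrap-run g (visited id (λ ht≤ → contradiction (ready ht≤) ¬rdy)) v<n r<n meas ≤-refl) })))

        visit-process : ∀ {w k wr e d ok p x} → dn v ≡ 0 → Ready dn v m → Step (credit (suc s) dn) (at w k wr e d ok p x v r dn F Q)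
        visit-process {w} {k} {wr} {e} {d} {ok} {p} dn≡0 rdy = suc (suc (3 + (m * 10 + 1) + (4 + (6 * m + 1300 * (degree v m * J)))) + 1) + 3 , credit s (dn [ v ↦ 1 ])
          , process-credit m (s * (20 * m + 20)) (degree v m) J (pending-mark v<n dn≡0)
          , visit-from (chain (branch (tt , tt , inj₁ (word z≤n))
              (λ lt → contradiction (sym dn≡0) (<⇒≢ lt))
              (λ _ → conseq (vertex-process v<n g dn≡0 {w} {k} {wr} {e} {d} {ok} {p} {dn v} rdy)
                λ { _ (F' , Q' , (w , k , wr , e , d , ok , p , x , refl) , g') → set (tt , tt , word next≤V)
                    (wrap-run g' (visited kept (λ _ eq → contradiction (trans (sym ([↦]-same dn v 1)) eq) λ ())) v<n r<n meas ≤-refl) })))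
          where
          kept : ∀ {v'} → dn v' ≢ 0 → (dn [ v ↦ 1 ]) v' ≢ 0
          kept {v'} dn≢ with v' ≡ᵇ v
          ... | true  = λ ()
          ... | false = dn≢

        ready? : ∀ e → Dec (sr e ≡ v → dn (tg e) ≢ 0)
        ready? e with sr e ≟ v | dn (tg e) ≟ 0
        ... | no ≢v  | _      = yes λ ≡v → contradiction ≡v ≢v
        ... | yes _  | no ≢0  = yes λ _ → ≢0
        ... | yes ≡v | yes ≡0 = no λ f → f ≡v ≡0

      visit-step : ∀ {w k wr e d ok p x} → Step (credit (suc s) dn) (at w k wr e d ok p x v r dn F Q)
      visit-step {w} {k} {wr} {e} {d} {ok} {p} {x} = by (dn v ≟ 0) (allUpTo? ready? m)
        where
        by : Dec (dn v ≡ 0) → Dec (∀ {e} → e < m → sr e ≡ v → dn (tg e) ≢ 0) → Step (credit (suc s) dn) (at w k wr e d ok p x v r dn F Q)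
        by (no dn≢0)  _         = visit-done dn≢0
        by (yes dn≡0) (no ¬rdy) = visit-wait dn≡0 λ rdy → ¬rdy λ {e} → rdy e
        by (yes dn≡0) (yes rdy) = visit-process dn≡0 λ e → rdy {e}

    rounds-run : ∀ {w k wr e d ok p x v r dn F Q} → Good dn F Q →
      Reach rounds (at w k wr e d ok p x v r dn F Q) (2 + (n * n * (20 * m + 20) + 1300 * (pending dn * J) + 1)) RoundsDone
    rounds-run {w} {k} {wr} {e} {d} {ok} {p} {x} {dn = dn} {F} {Q} g = (tt , word z≤n) ► (tt , word z≤n) ►
      while Inv step _ _ (w , k , wr , e , d , ok , p , x , 0 , 0 , dn , F , Q , n * n , refl , g
        , record { before = λ _ () ; now = λ () } , n>0 , z≤n , refl , ≤-refl)
      where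
      inside : ∀ {r v s} → r < n → v < n → r * n + v + s ≡ n * n → s ≢ 0
      inside {r} {v} r<n v<n meas refl = <⇒≢ (begin-strict
          r * n + v + 0 ≡⟨ +-identityʳ _ ⟩
          r * n + v <⟨ +-monoʳ-< (r * n) v<n ⟩
          r * n + n ≡⟨ +-comm (r * n) n ⟩
          suc r * n ≤⟨ *-monoˡ-≤ n r<n ⟩
          n * n ∎) meas
        where open ≤-Reasoning
      go : ∀ {c w k wr e d ok p x v r dn F Q} s → Good dn F Q → Progress v r dn → v < n → r * n + v + s ≡ n * n → credit s dn ≤ c → Dec (r < n) →
        (r < n × Step c (at w k wr e d ok p x v r dn F Q)) ⊎ (¬ r < n × 1 ≤ c × RoundsDone (at w k wr e d ok p x v r dn F Q))
      go s g pr v<n meas le (no ¬lt) = inj₂ (¬lt , ≤-trans (m≤n+m 1 _) le , _ , _ , _ , _ , _ , _ , _ , _ , _ , _ , _ , _ , _ , refl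
          , Good.F≤ g , λ v<n → Good.built g v<n (Progress.before pr v<n (<-≤-trans (ht<n v<n) (≮⇒≥ ¬lt))))
      go zero    g pr v<n meas le (yes r<n) = contradiction refl (inside r<n v<n meas)
      go (suc s) g pr v<n meas le (yes r<n) = let k , c' , pay , run = visit-step g pr v<n r<n meas in inj₁ (r<n , k , c' , ≤-trans pay le , run)
      step : ∀ c e' → Inv c e' → CheapT (reg 29 <' reg 35) e' ×
        ((True (reg 29 <' reg 35) (toState e') × Step c e')
         ⊎ (False (reg 29 <' reg 35) (toState e') × 1 ≤ c × RoundsDone e'))
      step c _ (w , k , wr , e , d , ok , p , x , v , r , dn , F , Q , s , refl , g , pr , v<n , r≤n , meas , le) =
        (tt , tt , inj₂ (word n≤V)) , go s g pr v<n meas le (r <? n)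

-- Parameters and output

-- A logarithm by repeated doubling. Adding `inc` in each round, and not just 1, also yields the
-- product of the logarithm with `n`, in a machine that multiplies by powers of two only.
double : Var → Var → Operand → Program
double acc target inc = WHILE reg 12 <' reg target DO (12 ≔ reg 12 ⊕ reg 12 ⨾ acc ≔ reg acc ⊕ inc)

-- The empty path is counted for every `x` up to `suc C`, and the value 1 is the grid value of index
-- `2 ^ b` in units of 2 ^ -b; later entries stay 0.
fillTarget : Program
fillTarget =
  3 [ 38 ]≔ val (lit 1) ⨾ 26 ≔ reg 38 ≪ reg 30 ⨾ 16 ≔ lit 1 ≪ reg 31 ⨾ 2 ≔ val (lit 1) ⨾
  (WHILE reg 2 ≤' reg 16 DO (11 ≔ reg 26 ⊕ reg 2 ⨾ 4 [ 11 ]≔ val (reg 34) ⨾ 2 ≔ lit 1 ⊕ reg 2))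

-- An entry is positive exactly if the list claims its value at `x = 1`, that is, for the full
-- capacity.
lastEntry : Program
lastEntry = 26 ≔ reg 37 ≪ reg 30 ⨾ 3 ≔ val (lit 0) ⨾ 2 ≔ val (lit 1) ⨾
  (WHILE reg 2 ≤' reg 32 DO (10 ≔ reg 26 ⊕ reg 2 ⨾
    (IF lit 0 <' cell 4 10 THEN (3 ≔ val (reg 2)) ELSE skip) ⨾ 2 ≔ lit 1 ⊕ reg 2))

-- The one place that computes with numbers of the size of a path count. Rounding up is safe, as the
-- grid value is at most `2 ^ b * N` and `N` is an integer; it also loses nothing from below.
roundUp : Program
roundUp =
  4 ≔ reg 3 ≫ reg 31 ⨾ 4 ≔ reg 4 ⊖ lit 1 ⨾ 5 ≔ reg 4 ≪ reg 31 ⨾ 5 ≔ reg 3 ⊖ reg 5 ⨾ 6 ≔ lit 1 ≪ reg 31 ⨾ 6 ≔ reg 6 ⊖ lit 1 ⨾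
  5 ≔ reg 5 ≪ reg 4 ⨾ 5 ≔ reg 5 ⊕ reg 6 ⨾ 0 ≔ reg 5 ≫ reg 31

-- Computes b = r31, a = r30, J = 2 ^ a = r32 and the end Z = r33 of the work
-- space, from 8 n ⌈1/ε⌉ ≤ 2 ^ b and log₂ N < X + 1 ≤ 2 ^ (a − b).
parameters : Program
parameters =
  38 ≔ val (reg 3) ⨾ 37 ≔ val (reg 2) ⨾ 36 ≔ val (reg 1) ⨾ 35 ≔ val (reg 0) ⨾ 34 ≔ lit 1 ⊕ reg 4 ⨾
  31 ≔ val (lit 3) ⨾ 12 ≔ val (lit 1) ⨾ double 31 35 (lit 1) ⨾ 12 ≔ val (lit 1) ⨾ double 31 5 (lit 1) ⨾
  23 ≔ val (reg 35) ⨾ 12 ≔ val (reg 35) ⨾ double 23 36 (reg 35) ⨾ 13 ≔ lit 1 ⊕ reg 23 ⨾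
  30 ≔ val (reg 31) ⨾ 12 ≔ val (lit 1) ⨾ double 30 13 (lit 1) ⨾
  32 ≔ lit 1 ≪ reg 30 ⨾ 33 ≔ reg 36 ≪ lit 3 ⨾ 33 ≔ reg 33 ≪ reg 30

approximate : Program
approximate = parameters ⨾ fillTarget ⨾ rounds ⨾ lastEntry ⨾ roundUp

record Doublings (p x k : ℕ) : Set where
  field
    enough : x ≤ 2 ^ k * p
    least  : ∀ {j} → j < k → 2 ^ j * p < x

doublings : ∀ {p} x → 1 ≤ p → ∃[ k ] Doublings p x k
doublings {p} x 1≤p = go x 0 (≤-trans (≤-trans (m≤m+n x 0) (<⇒≤ (n<2^n (x + 0)))) (m≤m*n (2 ^ (x + 0)) p {{>-nonZero 1≤p}})) λ ()
  where
  go : ∀ f k → x ≤ 2 ^ (f + k) * p → (∀ {j} → j < k → 2 ^ j * p < x) → ∃[ k ] Doublings p x k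
  go f k le below with x ≤? 2 ^ k * p
  ... | yes q = k , record { enough = q ; least = below }
  go zero    k le below | no ¬q = contradiction le ¬q
  go (suc f) k le below | no ¬q = go f (suc k) (subst (λ i → x ≤ 2 ^ i * p) (sym (+-suc f k)) le) below′
    where
    below′ : ∀ {j} → j < suc k → 2 ^ j * p < x
    below′ j≤k with m≤n⇒m<n∨m≡n (s≤s⁻¹ j≤k)
    ... | inj₁ j<k  = below j<k
    ... | inj₂ refl = ≰⇒> ¬q

module DoubleRun (n C V u : ℕ)
  (word-V : Timed.wordTime n C V ≤ u) (number-C : Timed.numberTime n C (suc C) ≤ u) where
  open Cost n C V u word-V number-C

  -- Here `at p a` is the environment with `p` in register 12 and `a` in the accumulator. The
  -- equations on it let one proof serve all uses, whichever register accumulates.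
  double-run : ∀ acc target inc (at : ℕ → ℕ → Env) {p₀ a₀ x i k} → Doublings p₀ x k →
    (∀ p a → regs (toState (at p a)) 12 ≡ p) → (∀ p a → regs (toState (at p a)) target ≡ x) →
    (∀ p a → regs (toState (setR 12 (p + p) (at p a))) acc ≡ a) → (∀ p a → ⟦ inc ⟧ₒ (toState (setR 12 (p + p) (at p a))) ≡ i) →
    (∀ p a v w → setR acc v (setR 12 w (at p a)) ≡ at w v) → (∀ e → Fetch inc e) →
    2 ^ k * p₀ ≤ V → a₀ + k * i ≤ V → x ≤ V →
    Reach (double acc target inc) (at p₀ a₀) (k * 3 + 1) (λ e → ∃[ p ] (e ≡ at p (a₀ + k * i)))
  double-run acc target inc at {p₀} {a₀} {x} {i} {k} db get₁₂ get-t get-a get-i set-at fetch p≤V a≤V x≤V =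
    for 2 Inv step k _ (0 , refl , cong₂ at (sym (+-identityʳ p₀)) (sym (+-identityʳ a₀)))
    where
    open Doublings db
    Inv : ℕ → Env → Set
    Inv s e = ∃[ j ] (j + s ≡ k × e ≡ at (2 ^ j * p₀) (a₀ + j * i))
    step : ∀ s e → Inv s e → CheapT (reg 12 <' reg target) e ×
      ((True (reg 12 <' reg target) (toState e) × ∃[ s' ] (s ≡ suc s' × Reach _ e 2 (Inv s')))
       ⊎ (False (reg 12 <' reg target) (toState e) × ∃[ p ] (e ≡ at p (a₀ + k * i))))
    step s _ (j , meas , refl) = (tt , tt , inj₂ (subst Num (sym (get-t _ _)) (word x≤V))) , go s meas
      where
      p = 2 ^ j * p₀
      a = a₀ + j * i
      go : ∀ s → j + s ≡ k → (True (reg 12 <' reg target) (toState (at p a)) × ∃[ s' ] (s ≡ suc s' × Reach _ (at p a) 2 (Inv s')))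
             ⊎ (False (reg 12 <' reg target) (toState (at p a)) × ∃[ p ] (at (2 ^ j * p₀) a ≡ at p (a₀ + k * i)))
      go zero meas = inj₂ (subst₂ (λ y z → ¬ y < z) (sym (get₁₂ p a)) (sym (get-t p a))
          (≤⇒≯ (≤-trans enough (≤-reflexive (cong (λ j → 2 ^ j * p₀) (sym j≡k)))))
        , p , cong (λ j → at p (a₀ + j * i)) j≡k)
        where
        j≡k : j ≡ k
        j≡k = trans (sym (+-identityʳ j)) meas
      go (suc s) meas = inj₁ (subst₂ _<_ (sym (get₁₂ p a)) (sym (get-t p a)) (least j<k) , s , refl
        , (tt , tt , subst Num (sym twice) (word (≤-trans (≤-reflexive p+p) (≤-trans (*-monoˡ-≤ p₀ (^-monoʳ-≤ 2 j<k)) p≤V)))) ►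
          from (setR 12 (p + p) (at p a)) (cong (λ v → setR 12 v (at p a)) twice)
          (set (tt , fetch _ , subst Num (sym step≡) (word (≤-trans (≤-reflexive a+i) (≤-trans (+-monoʳ-≤ a₀ (*-monoˡ-≤ i j<k)) a≤V))))
            (suc j , trans (sym (+-suc j s)) meas
            , trans (cong (λ v → setR acc v (setR 12 (p + p) (at p a))) step≡)
                (trans (set-at p a (a + i) (p + p)) (cong₂ at p+p a+i)))))
        where
        j<k : j < k
        j<k = ≤-trans (s≤s (m≤m+n j s)) (≤-reflexive (trans (sym (+-suc j s)) meas))
        twice : regs (toState (at p a)) 12 + regs (toState (at p a)) 12 ≡ p + p
        twice = cong₂ _+_ (get₁₂ p a) (get₁₂ p a)
        step≡ : regs (toState (setR 12 (p + p) (at p a))) acc + ⟦ inc ⟧ₒ (toState (setR 12 (p + p) (at p a))) ≡ a + i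
        step≡ = cong₂ _+_ (get-a p a) (get-i p a)
        p+p : p + p ≡ 2 ^ suc j * p₀
        p+p = lem (2 ^ j) p₀
          where
          lem : ∀ t p → t * p + t * p ≡ 2 * t * p
          lem = solve-∀
        a+i : a + i ≡ a₀ + suc j * i
        a+i = trans (+-assoc a₀ (j * i) i) (cong (a₀ +_) (+-comm (j * i) i))

-- Correctness of the main program

bits≤ : ∀ {v k} → v < 2 ^ k → bits v ≤ k
bits≤ {v} {k} lt = ≤-trans (⌈log₂⌉-mono-≤ {suc v} {2 ^ k} lt) (≤-reflexive (⌈log₂2^n⌉≡n k))

opTime≤ : ∀ w {v k} → v < 2 ^ k → opTime w v ≤ suc k
opTime≤ w {v} {k} lt = s≤s (≤-trans (m/n≤m (bits v) (suc w)) (bits≤ {v} {k} lt))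

-- An upper bound for all addresses and all numbers that are not capacities.
wordBound : (n m κ a : ℕ) → ℕ
wordBound n m κ a = suc (m * 8 * 2 ^ a) + suc (m * 8 * 2 ^ a) + (n * 2 ^ a + (2 ^ κ * n + (n + m)))

startEnv : (n m s t C q : ℕ) (sr tg wt : ℕ → ℕ) → Env
startEnv n m s t C q sr tg wt =
  n ∷ m ∷ s ∷ t ∷ C ∷ q ∷ replicate 33 0 , sr ∷ tg ∷ wt ∷ Array₀ ∷ Array₀ ∷ Array₀ ∷ []

record Instance : Set where
  field
    n C V u       : ℕ
    word-V        : Timed.wordTime n C V ≤ u
    number-C      : Timed.numberTime n C (suc C) ≤ u
    m s t q       : ℕ
    β₁ β₂ κ α     : ℕ
    sr tg wt      : ℕ → ℕ
    RR            : ℕ → ℕ → ℕ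
    ht            : ℕ → ℕ
    n>0           : 1 ≤ n
    m>0           : 1 ≤ m
    s<n           : s < n
    t<n           : t < n
    db₁           : Doublings 1 n β₁
    db₂           : Doublings 1 q β₂
    dbX           : Doublings n m κ
    dbA           : Doublings 1 (suc (n + κ * n)) α
    tg<n          : ∀ {e} → e < m → tg e < n
    sr<n          : ∀ {e} → e < m → sr e < n
    ht-arc        : ∀ {e} → e < m → ht (tg e) < ht (sr e)
    ht<n          : ∀ {v} → v < n → ht v < n
    rec           : ∀ {v} → v ≢ t → ∀ x → RR v x ≡ sum m (λ e → select (sr e) v (RR (tg e) (x + wt e)))
    RR-t          : ∀ {x} → x ≤ suc C → RR t x ≡ 1
    RR-t′         : ∀ {x} → suc C < x → RR t x ≡ 0
    N≤            : RR s 1 ≤ 2 ^ (n + κ * n)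
    V≥            : wordBound n m κ (3 + β₁ + β₂ + α) ≤ V

module MainRun (inst : Instance) where
  open Instance inst
  open Cost n C V u word-V number-C

  private
    X b a J Z : ℕ
    X = n + κ * n
    b = 3 + β₁ + β₂
    a = b + α
    J = 2 ^ a
    Z = m * 8 * J

    room : suc Z + suc Z ≤ V
    room = ≤-trans (m≤m+n _ _) V≥
    rest≤V : n * J + (2 ^ κ * n + (n + m)) ≤ V
    rest≤V = ≤-trans (m≤n+m _ (suc Z + suc Z)) V≥
    lists≤V : n * J ≤ V
    lists≤V = ≤-trans (m≤m+n _ _) rest≤V
    κ≤V : 2 ^ κ * n ≤ V
    κ≤V = ≤-trans (≤-trans (m≤m+n (2 ^ κ * n) (n + m)) (m≤n+m _ (n * J))) rest≤V
    nm≤V : n + m ≤ V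
    nm≤V = ≤-trans (≤-trans (m≤n+m (n + m) (2 ^ κ * n)) (m≤n+m _ (n * J))) rest≤V
    n≤V : n ≤ V
    n≤V = ≤-trans (m≤m+n n m) nm≤V
    m≤V : m ≤ V
    m≤V = ≤-trans (m≤n+m m n) nm≤V
    J≤V : J ≤ V
    J≤V = ≤-trans (m≤n*m J n {{>-nonZero n>0}}) lists≤V
    a<J : a < J
    a<J = n<2^n a
    a≤V : a ≤ V
    a≤V = ≤-trans (<⇒≤ a<J) J≤V
    b≤a : b ≤ a
    b≤a = m≤m+n b α
    b≤V : b ≤ V
    b≤V = ≤-trans b≤a a≤V
    1≤V : 1 ≤ V
    1≤V = ≤-trans n>0 n≤V
    pow≤V : ∀ {k} → k ≤ a → 2 ^ k ≤ V
    pow≤V k≤a = ≤-trans (^-monoʳ-≤ 2 k≤a) J≤V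
    β₁≤b : β₁ ≤ b
    β₁≤b = ≤-trans (m≤m+n β₁ β₂) (m≤n+m (β₁ + β₂) 3)
    β₂≤b : β₂ ≤ b
    β₂≤b = m≤n+m β₂ (3 + β₁)
    q≤V : q ≤ V
    q≤V = ≤-trans (Doublings.enough db₂) (≤-trans (≤-reflexive (*-identityʳ (2 ^ β₂))) (pow≤V (≤-trans β₂≤b b≤a)))
    X<2^α : suc X ≤ 2 ^ α
    X<2^α = ≤-trans (Doublings.enough dbA) (≤-reflexive (*-identityʳ (2 ^ α)))
    X<J : X < J
    X<J = ≤-trans X<2^α (^-monoʳ-≤ 2 (m≤n+m α b))
    X+1≤V : suc X ≤ V
    X+1≤V = ≤-trans X<J J≤V
    m*8≤V : m * 8 ≤ V
    m*8≤V = ≤-trans (m≤m*n (m * 8) J {{m^n≢0 2 a}}) (≤-trans (n≤1+n Z) (≤-trans (m≤m+n (suc Z) (suc Z)) room))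
    Z≤V : Z ≤ V
    Z≤V = ≤-trans (n≤1+n Z) (≤-trans (m≤m+n (suc Z) (suc Z)) room)
    queue≤Z : 8 * (m * J) ≤ Z
    queue≤Z = ≤-reflexive (lem m J)
      where
      lem : ∀ m J → 8 * (m * J) ≡ m * 8 * J
      lem = solve-∀

    layout : Layout
    layout = record
      { n = n ; C = C ; V = V ; u = u ; word-V = word-V ; number-C = number-C ; m = m ; a = a ; b = b ; Z = Z
      ; sr = sr ; tg = tg ; wt = wt ; RR = RR ; ht = ht ; ρ = s ∷ t ∷ [] ; tg<n = tg<n ; sr<n = sr<n ; ht-arc = ht-arc
      ; b≤a = b≤a ; a≤V = a≤V ; nm≤V = nm≤V ; lists≤V = lists≤V ; queue≤Z = queue≤Z ; room = room }

  open BuildRun layout hiding (J)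
  open Rounds t n>0 ht<n rec
  open DoubleRun n C V u word-V number-C

  start : Env
  start = startEnv n m s t C q sr tg wt

  private
    pre : (p y X a b J Z : ℕ) → Env
    pre p y X a b J Z = (scratch n m s t C q 0 0 0 0 0 0 ⊹ p ∷ y ∷ 0 ∷ 0 ∷ 0 ∷ 0 ∷ 0 ∷ 0 ∷ 0 ∷ 0 ∷ 0 ∷ X ∷ 0 ∷ 0 ∷ 0 ∷ 0 ∷ 0 ∷ 0 ∷
      a ∷ b ∷ J ∷ Z ∷ suc C ∷ n ∷ m ∷ s ∷ t ∷ []) , (sr ∷ tg ∷ wt ∷ Array₀ ∷ Array₀ ∷ Array₀ ∷ [])

    Configured : Env → Set
    Configured e = ∃[ p ] (e ≡ at (scratch n m s t C q 0 0 0 0 0 0) (junk p (suc X) 0 0 0 0 0 0 0 0) 0 X 0 0 0 0 0 0 Array₀ Array₀ Array₀)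

    configure : Reach parameters start
      (7 + ((β₁ * 3 + 1) + (1 + ((β₂ * 3 + 1) + (2 + ((κ * 3 + 1) + (3 + ((α * 3 + 1) + 3)))))))) Configured
    configure =
      (tt , word (≤-trans (<⇒≤ t<n) n≤V)) ► (tt , word (≤-trans (<⇒≤ s<n) n≤V)) ► (tt , word m≤V) ► (tt , word n≤V) ►
      (tt , tt , cap ≤-refl) ► (tt , word (≤-trans (≤-trans (m≤m+n 3 (β₁ + β₂)) b≤a) a≤V)) ► (tt , word 1≤V) ►
      from (pre 1 0 0 0 3 0 0) refl (chain (conseq
        (double-run 31 35 (lit 1) (λ p b → pre p 0 0 0 b 0 0) db₁
          (λ _ _ → refl) (λ _ _ → refl) (λ _ _ → refl) (λ _ _ → refl) (λ _ _ _ _ → refl) (λ _ → tt)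
          (one β₁ (≤-trans β₁≤b b≤a)) (≤-trans (+-monoʳ-≤ 3 (≤-trans (≤-reflexive (*-identityʳ β₁)) (m≤m+n β₁ β₂))) b≤V) n≤V)
        λ { _ (p , refl) → step₂ p }))
      where
      one : ∀ k → k ≤ a → 2 ^ k * 1 ≤ V
      one k k≤a = ≤-trans (≤-reflexive (*-identityʳ (2 ^ k))) (pow≤V k≤a)
      step₅ : ∀ p → Reach (32 ≔ lit 1 ≪ reg 30 ⨾ 33 ≔ reg 36 ≪ lit 3 ⨾ 33 ≔ reg 33 ≪ reg 30)
        (pre p (suc X) X (b + α * 1) b 0 0) 3 Configured
      step₅ p = from (pre p (suc X) X a b 0 0) (cong (λ v → pre p (suc X) X (b + v) b 0 0) (*-identityʳ α))
        ((tt , tt , a≤V , ≤-trans (≤-reflexive (*-identityˡ J)) J≤V) ► (tt , tt , three≤V , m*8≤V) ►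
         set (tt , tt , a≤V , Z≤V) (p , cong (λ v → pre p (suc X) X a b v Z) (*-identityˡ J)))
        where
        three≤V : 3 ≤ V
        three≤V = ≤-trans (≤-trans (m≤m+n 3 (β₁ + β₂)) b≤a) a≤V
      step₄ : ∀ p → Reach (13 ≔ lit 1 ⊕ reg 23 ⨾ 30 ≔ val (reg 31) ⨾ 12 ≔ val (lit 1) ⨾ double 30 13 (lit 1) ⨾
          32 ≔ lit 1 ≪ reg 30 ⨾ 33 ≔ reg 36 ≪ lit 3 ⨾ 33 ≔ reg 33 ≪ reg 30)
        (pre p 0 X 0 b 0 0) (3 + ((α * 3 + 1) + 3)) Configured
      step₄ p = (tt , tt , word X+1≤V) ► (tt , word b≤V) ► (tt , word 1≤V) ►
        from (pre 1 (suc X) X b b 0 0) refl (chain (conseq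
          (double-run 30 13 (lit 1) (λ p a → pre p (suc X) X a b 0 0) dbA
            (λ _ _ → refl) (λ _ _ → refl) (λ _ _ → refl) (λ _ _ → refl) (λ _ _ _ _ → refl) (λ _ → tt)
            (one α (m≤n+m α b)) (≤-trans (≤-reflexive (cong (b +_) (*-identityʳ α))) a≤V) X+1≤V)
          λ { _ (p , refl) → step₅ p }))
      step₃ : ∀ p → Reach (23 ≔ val (reg 35) ⨾ 12 ≔ val (reg 35) ⨾ double 23 36 (reg 35) ⨾
          13 ≔ lit 1 ⊕ reg 23 ⨾ 30 ≔ val (reg 31) ⨾ 12 ≔ val (lit 1) ⨾ double 30 13 (lit 1) ⨾
          32 ≔ lit 1 ≪ reg 30 ⨾ 33 ≔ reg 36 ≪ lit 3 ⨾ 33 ≔ reg 33 ≪ reg 30)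
        (pre p 0 0 0 (3 + β₁ * 1 + β₂ * 1) 0 0) (2 + ((κ * 3 + 1) + (3 + ((α * 3 + 1) + 3)))) Configured
      step₃ p = from (pre p 0 0 0 b 0 0) (cong₂ (λ v w → pre p 0 0 0 (3 + v + w) 0 0) (*-identityʳ β₁) (*-identityʳ β₂))
        ((tt , word n≤V) ► (tt , word n≤V) ► from (pre n 0 n 0 b 0 0) refl (chain (conseq
          (double-run 23 36 (reg 35) (λ p X → pre p 0 X 0 b 0 0) dbX
            (λ _ _ → refl) (λ _ _ → refl) (λ _ _ → refl) (λ _ _ → refl) (λ _ _ _ _ → refl) (λ _ → tt)
            κ≤V (≤-trans (n≤1+n X) X+1≤V) m≤V)
          λ { _ (p , refl) → step₄ p })))
      step₂ : ∀ p → Reach (12 ≔ val (lit 1) ⨾ double 31 5 (lit 1) ⨾ 23 ≔ val (reg 35) ⨾ 12 ≔ val (reg 35) ⨾ double 23 36 (reg 35) ⨾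
          13 ≔ lit 1 ⊕ reg 23 ⨾ 30 ≔ val (reg 31) ⨾ 12 ≔ val (lit 1) ⨾ double 30 13 (lit 1) ⨾
          32 ≔ lit 1 ≪ reg 30 ⨾ 33 ≔ reg 36 ≪ lit 3 ⨾ 33 ≔ reg 33 ≪ reg 30)
        (pre p 0 0 0 (3 + β₁ * 1) 0 0) (1 + ((β₂ * 3 + 1) + (2 + ((κ * 3 + 1) + (3 + ((α * 3 + 1) + 3)))))) Configured
      step₂ p = (tt , word 1≤V) ► from (pre 1 0 0 0 (3 + β₁ * 1) 0 0) refl (chain (conseq
          (double-run 31 5 (lit 1) (λ p b → pre p 0 0 0 b 0 0) db₂
            (λ _ _ → refl) (λ _ _ → refl) (λ _ _ → refl) (λ _ _ → refl) (λ _ _ _ _ → refl) (λ _ → tt)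
            (one β₂ (≤-trans β₂≤b b≤a)) (≤-trans (≤-reflexive (cong₂ (λ v w → 3 + v + w) (*-identityʳ β₁) (*-identityʳ β₂))) b≤V) q≤V)
          λ { _ (p , refl) → step₃ p }))

    2^b≤J : 2 ^ b ≤ J
    2^b≤J = ^-monoʳ-≤ 2 b≤a

    J+1≤V : suc J ≤ V
    J+1≤V = J<V m>0

    list-end : ∀ {v i} → v < n → i ≤ J → v * J + i ≤ V
    list-end {v} v<n i≤J = ≤-trans (+-monoʳ-≤ (v * J) i≤J) (≤-trans (≤-reflexive (+-comm (v * J) J)) (≤-trans (*-monoˡ-≤ J v<n) lists≤V))

    initial : ∀ {F} → Filled (t * J) (2 ^ b) (λ _ → suc C) Array₀ F (suc (2 ^ b)) → (∀ z → F z ≤ suc C) →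
              Good (Array₀ [ t ↦ 1 ]) F Array₀
    initial {F} fl F≤ = record
      { dn≤1 = [↦]-bound Array₀ ≤-refl (λ _ → z≤n)
      ; dn-t = λ eq → contradiction (trans (sym ([↦]-same Array₀ t 1)) eq) λ ()
      ; built = λ {v} v<n dn≢0 → built′ v dn≢0
      ; fresh = λ {v} v<n dn≡0 1≤i i≤J → Filled.same fl (wider (other-list {J} {t} {v} (≢t {v} dn≡0) 1≤i i≤J))
      ; F≤ = F≤ ; zeros = λ _ → refl ; Q≤ = λ _ → z≤n }
      where
      ≢t : ∀ {v} → (Array₀ [ t ↦ 1 ]) v ≡ 0 → v ≢ t
      ≢t {v} eq refl = contradiction (trans (sym ([↦]-same Array₀ t 1)) eq) λ ()
      wider : ∀ {z} → Outside (t * J) J z → Outside (t * J) (2 ^ b) z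
      wider (inj₁ le) = inj₁ le
      wider (inj₂ lt) = inj₂ (≤-<-trans (+-monoʳ-≤ (t * J) 2^b≤J) lt)
      target : ListOf F t
      target = record { sound = snd ; compl = cmp }
        where
        snd : ∀ {i x} → 1 ≤ i → i ≤ J → 1 ≤ x → x ≤ F (t * J + i) → grid b i ≤ 2 ^ b * RR t x
        snd {i} {x} 1≤i i≤J 1≤x le with i ≤? 2 ^ b
        ... | yes i≤ = ≤-trans (grid-mono b i≤) (≤-reflexive (trans (grid-one b)
                (trans (sym (*-identityʳ (2 ^ b))) (cong (2 ^ b *_) (sym (RR-t (≤-trans le (≤-reflexive (Filled.cells fl 1≤i (s≤s i≤))))))))))
        ... | no i≰  = contradiction (≤-trans 1≤x (≤-trans le (≤-reflexive (Filled.same fl (inj₂ (+-monoʳ-< (t * J) (≰⇒> i≰))))))) λ ()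
        cmp : ∀ {i x} → 1 ≤ i → i ≤ J → 1 ≤ x → grid b i + 7 * ht t * RR t x ≤ 2 ^ b * RR t x → x ≤ F (t * J + i)
        cmp {i} {x} 1≤i i≤J 1≤x le with x ≤? suc C
        ... | no x≰  = contradiction (≤-trans (m≤m+n (grid b i) _) le)
                (<⇒≱ (subst (_< grid b i) (sym (trans (cong (2 ^ b *_) (RR-t′ (≰⇒> x≰))) (*-zeroʳ (2 ^ b)))) (grid>0 b 1≤i)))
        ... | yes x≤ = ≤-trans x≤ (≤-reflexive (sym (Filled.cells fl 1≤i (s≤s (grid-cancel-≤ b
                (≤-trans (m≤m+n (grid b i) _) (≤-trans le (≤-reflexive (trans (cong (2 ^ b *_) (RR-t x≤))
                  (trans (*-identityʳ (2 ^ b)) (sym (grid-one b))))))))))))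
      built′ : ∀ v → (Array₀ [ t ↦ 1 ]) v ≢ 0 → ListOf F v
      built′ v dn≢0 with v ≟ t
      ... | yes refl = target
      ... | no v≢t   = contradiction ([↦]-other Array₀ 1 v≢t) dn≢0

    FillDone : Env → Set
    FillDone e = ∃[ w ] ∃[ k ] ∃[ F ] (e ≡ at w k 0 X 0 0 (t * J) 0 0 0 (Array₀ [ t ↦ 1 ]) F Array₀ × Good (Array₀ [ t ↦ 1 ]) F Array₀)

    fill-run : ∀ p → Reach fillTarget (at (scratch n m s t C q 0 0 0 0 0 0) (junk p (suc X) 0 0 0 0 0 0 0 0) 0 X 0 0 0 0 0 0 Array₀ Array₀ Array₀)
      (4 + (2 ^ b * 4 + 1)) FillDone
    fill-run p = chain (put (≤-trans (<⇒≤ t<n) n≤V) (tt , word 1≤V)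
      (from (at (scratch n m s t C q 0 0 0 0 0 0) (junk p (suc X) 0 0 0 0 0 0 0 0) 0 X 0 0 0 0 0 0 (Array₀ [ t ↦ 1 ]) Array₀ Array₀) refl (
      (tt , tt , a≤V , ≤-trans (m≤m+n (t * J) J) (list-end t<n ≤-refl)) ►
      (tt , tt , b≤V , ≤-trans (≤-reflexive (*-identityˡ (2 ^ b))) (≤-trans 2^b≤J J≤V)) ► (tt , word 1≤V) ►
      from (at (scratch n m 1 t C q 0 0 0 0 0 0) k 0 X 0 0 (t * J) 0 0 0 (Array₀ [ t ↦ 1 ]) Array₀ Array₀)
        (cong (λ v → at (scratch n m 1 t C q 0 0 0 0 0 0) (junk p (suc X) 0 0 v 0 0 0 0 0) 0 X 0 0 (t * J) 0 0 0 (Array₀ [ t ↦ 1 ]) Array₀ Array₀) (*-identityˡ (2 ^ b)))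
      (for 3 Inv step (2 ^ b) _ (_ , _ , refl , ≤-refl , refl , filled-start , λ _ → z≤n)))))
      where
      k : Junk
      k = junk p (suc X) 0 0 (2 ^ b) 0 0 0 0 0
      Inv : ℕ → Env → Set
      Inv r e = ∃[ w ] ∃[ F ] (e ≡ at w k 0 X 0 0 (t * J) 0 0 0 (Array₀ [ t ↦ 1 ]) F Array₀ × 1 ≤ Scratch.w₂ w × Scratch.w₂ w + r ≡ suc (2 ^ b)
        × Filled (t * J) (2 ^ b) (λ _ → suc C) Array₀ F (Scratch.w₂ w) × (∀ z → F z ≤ suc C))
      step : ∀ r e → Inv r e → CheapT (reg 2 ≤' reg 16) e ×
        ((True (reg 2 ≤' reg 16) (toState e) × ∃[ r' ] (r ≡ suc r' × Reach _ e 3 (Inv r')))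
         ⊎ (False (reg 2 ≤' reg 16) (toState e) × FillDone e))
      step zero _ (w , F , refl , 1≤j , j≡ , fl , F≤) = (tt , tt , inj₂ (word (≤-trans 2^b≤J J≤V)))
        , inj₂ ((λ j≤ → <-irrefl refl (≤-trans (s≤s j≤) (≤-reflexive j≡B)))
        , w , k , F , refl , initial (subst (Filled (t * J) (2 ^ b) _ Array₀ F) (sym j≡B) fl) F≤)
        where
        j≡B : suc (2 ^ b) ≡ Scratch.w₂ w
        j≡B = trans (sym j≡) (+-identityʳ _)
      step (suc r) _ (w@(scratch i₀ i₁ j i₃ i₄ i₅ i₆ i₇ i₈ i₉ i₁₀ i₁₁) , F , refl , 1≤j , j≡ , fl , F≤) =
        (tt , tt , inj₂ (word (≤-trans 2^b≤J J≤V))) , inj₁ (j≤ , r , refl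
        , (tt , tt , word to≤V) ► chain (put to≤V (tt , cap ≤-refl)
            (set (tt , tt , word (≤-trans (s≤s (≤-trans j≤ 2^b≤J)) J+1≤V))
              (_ , _ , refl , s≤s z≤n , trans (sym (+-suc j r)) j≡ , filled-step 1≤j j≤ refl fl , [↦]-bound F ≤-refl F≤))))
        where
        j≤ : j ≤ 2 ^ b
        j≤ = s≤s⁻¹ (≤-trans (s≤s (m≤m+n j r)) (≤-reflexive (trans (sym (+-suc j r)) j≡)))
        to≤V : t * J + j ≤ V
        to≤V = list-end t<n (≤-trans j≤ 2^b≤J)

    record Last (S : ℕ → ℕ) (l j : ℕ) : Set where
      field
        l<j   : l < j
        found : 1 ≤ l → 1 ≤ S l
        empty : ∀ {i} → l < i → i < j → S i ≡ 0

    module _ {k : Junk} {wr e d ok x v r : ℕ} {dn F Q : ℕ → ℕ} (F≤ : ∀ z → F z ≤ suc C) where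
      private
        S : ℕ → ℕ
        S i = F (s * J + i)

      LastDone : Env → Set
      LastDone e' = ∃[ w ] (e' ≡ at w k wr e d ok (s * J) x v r dn F Q × Last S (Scratch.w₃ w) (suc J))

      last-run : ∀ {w p} → Reach lastEntry (at w k wr e d ok p x v r dn F Q) (3 + (J * 5 + 1)) LastDone
      last-run = (tt , tt , a≤V , ≤-trans (m≤m+n (s * J) J) (list-end s<n ≤-refl)) ► (tt , word z≤n) ► (tt , word 1≤V) ►
        for 4 Inv step J _ (_ , refl , refl , record { l<j = ≤-refl ; found = λ () ; empty = λ 1≤i i<1 → contradiction i<1 (≤⇒≯ 1≤i) })
        where
        Inv : ℕ → Env → Set
        Inv i e' = ∃[ w ] (e' ≡ at w k wr e d ok (s * J) x v r dn F Q × Scratch.w₂ w + i ≡ suc J × Last S (Scratch.w₃ w) (Scratch.w₂ w))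
        step : ∀ i e' → Inv i e' → CheapT (reg 2 ≤' reg 32) e' ×
          ((True (reg 2 ≤' reg 32) (toState e') × ∃[ i' ] (i ≡ suc i' × Reach _ e' 4 (Inv i')))
           ⊎ (False (reg 2 ≤' reg 32) (toState e') × LastDone e'))
        step zero _ (w , refl , j≡ , la) = (tt , tt , inj₂ (word J≤V))
          , inj₂ ((λ j≤ → <-irrefl refl (≤-trans (s≤s j≤) (≤-reflexive j≡J))) , w , refl , subst (Last S (Scratch.w₃ w)) (sym j≡J) la)
          where
          j≡J : suc J ≡ Scratch.w₂ w
          j≡J = trans (sym j≡) (+-identityʳ _)
        step (suc i) _ (w@(scratch i₀ i₁ j l i₄ i₅ i₆ i₇ i₈ i₉ i₁₀ i₁₁) , refl , j≡ , la) =
          (tt , tt , inj₂ (word J≤V)) , inj₁ (j≤J , i , refl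
          , (tt , tt , word (list-end s<n j≤J)) ► chain {k = 2} {k' = 1} (branch (tt , list-end s<n j≤J , inj₁ (word z≤n))
              (λ lt → set (tt , word (≤-trans j≤J J≤V)) (set (tt , tt , word (≤-trans (s≤s j≤J) J+1≤V))
                (_ , refl , j≡' , record { l<j = ≤-refl ; found = λ _ → lt ; empty = λ l<i i≤l → contradiction i≤l (≤⇒≯ l<i) })))
              (λ ¬lt → nothing (set (tt , tt , word (≤-trans (s≤s j≤J) J+1≤V))
                (_ , refl , j≡' , record { l<j = m≤n⇒m≤1+n (Last.l<j la) ; found = Last.found la
                  ; empty = λ l<i i≤j → none ¬lt l<i (m≤n⇒m<n∨m≡n (s≤s⁻¹ i≤j)) })))))
          where
          j≤J : j ≤ J
          j≤J = s≤s⁻¹ (≤-trans (s≤s (m≤m+n j i)) (≤-reflexive (trans (sym (+-suc j i)) j≡)))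
          j≡' : suc j + i ≡ suc J
          j≡' = trans (sym (+-suc j i)) j≡
          none : ¬ 0 < S j → ∀ {i} → l < i → i < j ⊎ i ≡ j → S i ≡ 0
          none ¬lt l<i (inj₁ i<j)  = Last.empty la l<i i<j
          none ¬lt l<i (inj₂ refl) = n≤0⇒n≡0 (≮⇒≥ ¬lt)

    N : ℕ
    N = RR s 1

    module _ {S : ℕ → ℕ} {l : ℕ} (rep : Represents b (7 * ht s) J S (RR s)) (la : Last S l (suc J)) where
      open Last la

      l≤J : l ≤ J
      l≤J = s≤s⁻¹ l<j

      grid≤ : grid b l ≤ 2 ^ b * N
      grid≤ = by l refl
        where
        by : ∀ i → l ≡ i → grid b i ≤ 2 ^ b * N
        by zero    eq = ≤-trans (≤-reflexive (grid-zero b)) z≤n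
        by (suc i) refl = Represents.sound rep (s≤s z≤n) l≤J ≤-refl (found (s≤s z≤n))

      -- If the list is positive up to its end, its last value is at least `2 ^ b * 2 ^ X`, as
      -- `suc X ≤ 2 ^ α`, and this bounds every possible count. Otherwise entry `l + 1` is 0, so
      -- completeness fails for it at `x = 1`; going back to `l` costs one more spacing, at most
      -- `N`.
      grid≥ : 2 ^ b * N ≤ grid b l + (7 * ht s + 1) * N
      grid≥ with m≤n⇒m<n∨m≡n l≤J
      ... | inj₂ refl = begin
        2 ^ b * N ≤⟨ *-monoʳ-≤ (2 ^ b) N≤ ⟩
        2 ^ b * 2 ^ X ≡⟨ grid-top b X ⟨
        grid b (suc X * 2 ^ b) ≤⟨ grid-mono b (≤-trans (*-monoˡ-≤ (2 ^ b) X<2^α) (≤-reflexive (trans (*-comm (2 ^ α) (2 ^ b)) (sym (^-distribˡ-+-* 2 b α))))) ⟩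
        grid b l ≤⟨ m≤m+n _ _ ⟩
        grid b l + (7 * ht s + 1) * N ∎
        where open ≤-Reasoning
      ... | inj₁ l<J with N ≟ 0
      ...   | yes N≡0 = ≤-trans (≤-reflexive (trans (cong (2 ^ b *_) N≡0) (*-zeroʳ (2 ^ b)))) z≤n
      ...   | no N≢0  = begin
        2 ^ b * N ≤⟨ <⇒≤ (≰⇒> λ le → contradiction (≤-trans (Represents.compl rep (s≤s z≤n) l<J ≤-refl le) (≤-reflexive (empty ≤-refl (s≤s l<J)))) λ ()) ⟩
        grid b (suc l) + 7 * ht s * N ≡⟨ cong (_+ 7 * ht s * N) (grid-suc b l) ⟩
        grid b l + 2 ^ ex b l + 7 * ht s * N ≤⟨ +-monoˡ-≤ (7 * ht s * N) (+-monoʳ-≤ (grid b l) (ulp≤ b l (n≢0⇒n>0 N≢0) grid≤)) ⟩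
        grid b l + N + 7 * ht s * N ≡⟨ lem (grid b l) N (ht s) ⟩
        grid b l + (7 * ht s + 1) * N ∎
        where
        open ≤-Reasoning
        lem : ∀ g N h → g + N + 7 * h * N ≡ g + (7 * h + 1) * N
        lem = solve-∀

      rounded : ℕ
      rounded = shr (grid b l + (1 * 2 ^ b ∸ 1)) b

      private
        2^b-1 : 1 * 2 ^ b ∸ 1 < 2 ^ b
        2^b-1 = ≤-trans (≤-reflexive (cong (λ v → suc (v ∸ 1)) (*-identityˡ (2 ^ b)))) (≤-reflexive (suc-pred (2 ^ b) {{m^n≢0 2 b}}))

      rounded≤ : rounded ≤ N
      rounded≤ = s≤s⁻¹ (*-cancelʳ-< (2 ^ b) rounded (suc N) (begin-strict
        rounded * 2 ^ b ≤⟨ shr-lower _ b ⟩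
        grid b l + (1 * 2 ^ b ∸ 1) <⟨ +-mono-≤-< grid≤ 2^b-1 ⟩
        2 ^ b * N + 2 ^ b ≡⟨ lem (2 ^ b) N ⟩
        suc N * 2 ^ b ∎))
        where
        open ≤-Reasoning
        lem : ∀ t N → t * N + t ≡ suc N * t
        lem = solve-∀

      rounded≥ : grid b l ≤ 2 ^ b * rounded
      rounded≥ = +-cancelʳ-≤ (2 ^ b) _ _ (begin
        grid b l + 2 ^ b ≡⟨ cong (grid b l +_) (trans (cong (λ v → suc (v ∸ 1)) (*-identityˡ (2 ^ b))) (suc-pred (2 ^ b) {{m^n≢0 2 b}})) ⟨
        grid b l + suc (1 * 2 ^ b ∸ 1) ≡⟨ +-suc (grid b l) _ ⟩
        suc (grid b l + (1 * 2 ^ b ∸ 1)) ≤⟨ shr-upper _ b ⟩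
        suc rounded * 2 ^ b ≡⟨ lem (2 ^ b) rounded ⟩
        2 ^ b * rounded + 2 ^ b ∎)
        where
        open ≤-Reasoning
        lem : ∀ t N → suc N * t ≡ t * N + t
        lem = solve-∀

      -- The total error is `7 * ht s + 1`, at most `8 * n` units, and `2 ^ b` is at least
      -- `8 * (n * q)`; the relative error is thus at most 1 / q. This is where the summand 3 in `b`
      -- comes from.
      accurate : q * N ≤ q * rounded + N
      accurate = *-cancelˡ-≤ (2 ^ b) {{m^n≢0 2 b}} (begin
        2 ^ b * (q * N) ≡⟨ lem₁ (2 ^ b) q N ⟩
        q * (2 ^ b * N) ≤⟨ *-monoʳ-≤ q (≤-trans grid≥ (+-monoˡ-≤ _ rounded≥)) ⟩
        q * (2 ^ b * rounded + (7 * ht s + 1) * N) ≤⟨ *-monoʳ-≤ q (+-monoʳ-≤ (2 ^ b * rounded) (*-monoˡ-≤ N 7h+1≤)) ⟩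
        q * (2 ^ b * rounded + 8 * n * N) ≡⟨ lem₂ q (2 ^ b) rounded n N ⟩
        2 ^ b * (q * rounded) + 8 * (n * q) * N ≤⟨ +-monoʳ-≤ (2 ^ b * (q * rounded)) (*-monoˡ-≤ N precise) ⟩
        2 ^ b * (q * rounded) + 2 ^ b * N ≡⟨ *-distribˡ-+ (2 ^ b) (q * rounded) N ⟨
        2 ^ b * (q * rounded + N) ∎)
        where
        open ≤-Reasoning
        lem₁ : ∀ t q N → t * (q * N) ≡ q * (t * N)
        lem₁ = solve-∀
        lem₂ : ∀ q t r n N → q * (t * r + 8 * n * N) ≡ t * (q * r) + 8 * (n * q) * N
        lem₂ = solve-∀
        7h+1≤ : 7 * ht s + 1 ≤ 8 * n
        7h+1≤ = ≤-trans (+-mono-≤ (*-monoʳ-≤ 7 (<⇒≤ (ht<n s<n))) n>0) (≤-reflexive (+-comm (7 * n) n))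
        precise : 8 * (n * q) ≤ 2 ^ b
        precise = begin
          8 * (n * q) ≤⟨ *-monoʳ-≤ 8 (*-mono-≤ (≤-trans (Doublings.enough db₁) (≤-reflexive (*-identityʳ (2 ^ β₁)))) (≤-trans (Doublings.enough db₂) (≤-reflexive (*-identityʳ (2 ^ β₂))))) ⟩
          8 * (2 ^ β₁ * 2 ^ β₂) ≡⟨ cong (8 *_) (^-distribˡ-+-* 2 β₁ β₂) ⟨
          8 * 2 ^ (β₁ + β₂) ≡⟨ ^-distribˡ-+-* 2 3 (β₁ + β₂) ⟨
          2 ^ b ∎

      sum<  : grid b l + (1 * 2 ^ b ∸ 1) < 2 ^ suc (b + X)
      sum< = begin-strict
        grid b l + (1 * 2 ^ b ∸ 1) <⟨ +-mono-≤-< (≤-trans grid≤ (*-monoʳ-≤ (2 ^ b) N≤)) 2^b-1 ⟩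
        2 ^ b * 2 ^ X + 2 ^ b ≡⟨ cong (_+ 2 ^ b) (^-distribˡ-+-* 2 b X) ⟨
        2 ^ (b + X) + 2 ^ b ≤⟨ +-monoʳ-≤ (2 ^ (b + X)) (^-monoʳ-≤ 2 (m≤m+n b X)) ⟩
        2 ^ (b + X) + 2 ^ (b + X) ≡⟨ cong (2 ^ (b + X) +_) (+-identityʳ _) ⟨
        2 ^ suc (b + X) ∎
        where open ≤-Reasoning

    Result : Env → Set
    Result e = regs (toState e) 0 ≤ N × q * N ≤ q * regs (toState e) 0 + N

    B : ℕ
    B = suc (suc (b + X))

    unit>0 : 1 ≤ unit
    unit>0 = ≤-trans (≤-trans (s≤s z≤n) word-V) (m≤m+n u _)

    -- The long operations are charged one unit per bit. This crude bound suffices, since there are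
    -- O(b + X) bits, less than the length of a single list up to a constant.
    round-run : ∀ {k wr e d ok p x v r dn F Q w} → Represents b (7 * ht s) J (λ i → F (s * J + i)) (RR s) →
      Last (λ i → F (s * J + i)) (Scratch.w₃ w) (suc J) →
      Reach roundUp (at w k wr e d ok p x v r dn F Q) (6 + (suc B + (B + suc B))) Result
    round-run {k} {wr} {e} {d} {ok} {p} {x} {v} {r} {dn} {F} {Q} {scratch i₀ i₁ i₂ l i₄ i₅ i₆ i₇ i₈ i₉ i₁₀ i₁₁} rep la =
      (tt , tt , b≤V , l≤V) ► (tt , tt , word (≤-trans (shr≤ l b) l≤V) , word 1≤V) ►
      (tt , tt , b≤V , ≤-trans (ex-lower b l) l≤V) ► (tt , tt , word l≤V , word (≤-trans (ex-lower b l) l≤V)) ►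
      (tt , tt , b≤V , one≤V) ► (tt , tt , word one≤V , word 1≤V) ►
      from (at (scratch i₀ i₁ i₂ l (ex b l) (mant b l) (1 * 2 ^ b ∸ 1) i₇ i₈ i₉ i₁₀ i₁₁) k wr e d ok p x v r dn F Q) refl
      (chain (assignₖ (suc B) (+-mono-≤ (≤-trans (wordTime≤ (≤-trans (m∸n≤m (shr l b) 1) (≤-trans (shr≤ l b) l≤V))) (m≤m+n u (4 * u)))
                                       (≤-trans (opTime≤ _ {k = suc (b + X)} (≤-<-trans (m≤m+n (grid b l) (1 * 2 ^ b ∸ 1)) (sum< rep la))) (scale B)))
        (from (at (scratch i₀ i₁ i₂ l (ex b l) (grid b l) (1 * 2 ^ b ∸ 1) i₇ i₈ i₉ i₁₀ i₁₁) k wr e d ok p x v r dn F Q) refl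
        (chain (assignₖ B (≤-trans (opTime≤ _ {k = suc (b + X)} (sum< rep la)) (scale B))
          (assignₖ (suc B) (+-mono-≤ (≤-trans (wordTime≤ b≤V) (m≤m+n u (4 * u)))
                                    (≤-trans (opTime≤ _ {k = suc (b + X)} (sum< rep la)) (scale B)))
            (rounded≤ rep la , accurate rep la)))))))
      where
      l≤V : l ≤ V
      l≤V = ≤-trans (l≤J rep la) J≤V
      one≤V : 1 * 2 ^ b ≤ V
      one≤V = ≤-trans (≤-reflexive (*-identityˡ (2 ^ b))) (≤-trans 2^b≤J J≤V)
      scale : ∀ k → k ≤ k * unit
      scale k = m≤m*n k unit {{>-nonZero unit>0}}

    pending≤m : ∀ dn → pending dn ≤ m
    pending≤m dn = ≤-trans (sum-mono n (λ v _ → select-≤ (dn v) 0 (degree v m))) (degree-sum n m sr)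

  approximate-run : Reach approximate start (40 * (n * n * m) + 1400 * (m * J)) Result
  approximate-run = relax budget (chain (conseq configure λ { _ (p , refl) →
    chain (conseq (fill-run p) λ { _ (w , k , F , refl , g) →
    chain (conseq (rounds-run {w} {k} {0} {X} {0} {0} {t * J} {0} {0} {0} g) λ { _ (w , k , wr , e , d , ok , p , x , v , r , dn , F , Q , refl , F≤ , lists) →
    chain (conseq (last-run F≤) λ { _ (w , refl , la) → round-run {w = w} (lists s<n) la }) }) }) }))
    where
    b<J : b < J
    b<J = ≤-<-trans b≤a a<J
    κ≤J : κ ≤ J
    κ≤J = ≤-trans (m≤m*n κ n {{>-nonZero n>0}}) (≤-trans (m≤n+m (κ * n) n) (<⇒≤ X<J))
    B≤2J : B ≤ J + J
    B≤2J = ≤-trans (≤-reflexive (cong suc (sym (+-suc b X)))) (+-mono-≤ b<J X<J)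
    dn₀ : ℕ → ℕ
    dn₀ = Array₀ [ t ↦ 1 ]
    -- What is charged neither to visits nor to list building is at most `67 * J`; it disappears in
    -- `m * J` because there is an arc.
    budget : (7 + ((β₁ * 3 + 1) + (1 + ((β₂ * 3 + 1) + (2 + ((κ * 3 + 1) + (3 + ((α * 3 + 1) + 3))))))))
      + ((4 + (2 ^ b * 4 + 1)) + ((2 + (n * n * (20 * m + 20) + 1300 * (pending dn₀ * J) + 1)) + ((3 + (J * 5 + 1)) + (6 + (suc B + (B + suc B))))))
      ≤ 40 * (n * n * m) + 1400 * (m * J)
    budget = begin
      _ ≡⟨ lem₁ β₁ β₂ κ α (2 ^ b) (n * n) m (pending dn₀ * J) J B ⟩
      (20 * (n * n * m) + 20 * (n * n * 1) + 1300 * (pending dn₀ * J)) + (3 * (β₁ + β₂ + κ + α + B) + 4 * 2 ^ b + 5 * J + 40)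
        ≤⟨ +-mono-≤ (+-mono-≤ (+-monoʳ-≤ (20 * (n * n * m)) (*-monoʳ-≤ 20 (*-monoʳ-≤ (n * n) m>0))) (*-monoʳ-≤ 1300 (*-monoˡ-≤ J (pending≤m dn₀))))
             (+-mono-≤ (+-monoˡ-≤ (5 * J) (+-mono-≤ (*-monoʳ-≤ 3 (+-mono-≤ (+-mono-≤ (+-mono-≤ (+-mono-≤
               (≤-trans β₁≤b (<⇒≤ b<J)) (≤-trans β₂≤b (<⇒≤ b<J))) κ≤J) (≤-trans (m≤n+m α b) (<⇒≤ a<J))) B≤2J)) (*-monoʳ-≤ 4 2^b≤J)))
               (*-monoʳ-≤ 40 (pow>0 a))) ⟩
      (20 * (n * n * m) + 20 * (n * n * m) + 1300 * (m * J)) + (3 * (J + J + J + J + (J + J)) + 4 * J + 5 * J + 40 * J)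
        ≡⟨ lem₂ (n * n * m) (m * J) J ⟩
      40 * (n * n * m) + 1300 * (m * J) + 67 * J
        ≤⟨ +-monoʳ-≤ (40 * (n * n * m) + 1300 * (m * J)) (*-mono-≤ (m≤m+n 67 33) (m≤n*m J m {{>-nonZero m>0}})) ⟩
      40 * (n * n * m) + 1300 * (m * J) + 100 * (m * J)
        ≡⟨ lem₃ (n * n * m) (m * J) ⟩
      40 * (n * n * m) + 1400 * (m * J) ∎
      where
      open ≤-Reasoning
      lem₁ : ∀ β₁ β₂ κ α t w m pJ J B →
        (7 + ((β₁ * 3 + 1) + (1 + ((β₂ * 3 + 1) + (2 + ((κ * 3 + 1) + (3 + ((α * 3 + 1) + 3))))))))
        + ((4 + (t * 4 + 1)) + ((2 + (w * (20 * m + 20) + 1300 * pJ + 1)) + ((3 + (J * 5 + 1)) + (6 + (suc B + (B + suc B))))))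
        ≡ (20 * (w * m) + 20 * (w * 1) + 1300 * pJ) + (3 * (β₁ + β₂ + κ + α + B) + 4 * t + 5 * J + 40)
      lem₁ = solve-∀
      lem₂ : ∀ x y J → (20 * x + 20 * x + 1300 * y) + (3 * (J + J + J + J + (J + J)) + 4 * J + 5 * J + 40 * J) ≡ 40 * x + 1300 * y + 67 * J
      lem₂ = solve-∀
      lem₃ : ∀ x y → 40 * x + 1300 * y + 100 * y ≡ 40 * x + 1400 * y
      lem₃ = solve-∀

-- Heights and path counts in a DAG

open import Axiom.UniquenessOfIdentityProofs.WithK using (uip)
open import Data.Fin as Fin using (zero; suc)
open import Data.Fin.Properties as Fin using (pigeonhole; toℕ<n; toℕ-fromℕ<; fromℕ<-toℕ; toℕ-injective)
open import Data.Product.Function.Dependent.Propositional using (Σ-↔)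
open import Function.Bundles using (mk↔ₛ′; Inverse)
open import Function.Properties.Inverse using (↔-refl; ↔-trans)
open import Relation.Binary.Construct.Closure.ReflexiveTransitive using (Star; _◅_)
open import Relation.Binary.Construct.Closure.Transitive using (TransClosure) renaming ([_] to one; _∷_ to _◂_)

entries-< : ∀ {m} (f : Fin m → ℕ) {i} (i<m : i < m) → entries f i ≡ f (fromℕ< i<m)
entries-< {m} f {i} i<m with i <? m
... | yes p = cong f (cong (λ q → fromℕ< q) (<-irrelevant p i<m))
... | no ¬p = contradiction i<m ¬p

entries-toℕ : ∀ {m} (f : Fin m → ℕ) e → entries f (toℕ e) ≡ f e
entries-toℕ f e = trans (entries-< f (toℕ<n e)) (cong f (fromℕ<-toℕ e (toℕ<n e)))

max : ℕ → (ℕ → ℕ) → ℕ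
max zero    f = 0
max (suc k) f = max k f ⊔ f k

max-≥ : ∀ {k i} (f : ℕ → ℕ) → i < k → f i ≤ max k f
max-≥ {suc k} {i} f i<1+k with m≤n⇒m<n∨m≡n (s≤s⁻¹ i<1+k)
... | inj₁ i<k  = ≤-trans (max-≥ f i<k) (m≤m⊔n (max k f) (f k))
... | inj₂ refl = m≤n⊔m (max k f) (f k)

max-≤ : ∀ k {f c} → (∀ {i} → i < k → f i ≤ c) → max k f ≤ c
max-≤ zero    le = z≤n
max-≤ (suc k) le = ⊔-lub (max-≤ k λ i<k → le (m≤n⇒m≤1+n i<k)) (le ≤-refl)

max-attained : ∀ k f → max k f ≡ 0 ⊎ ∃[ i ] (i < k × max k f ≡ f i)
max-attained zero    f = inj₁ refl
max-attained (suc k) f with ⊔-sel (max k f) (f k) | max-attained k f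
... | inj₂ eq | _                    = inj₂ (k , ≤-refl , eq)
... | inj₁ eq | inj₁ z               = inj₁ (trans eq z)
... | inj₁ eq | inj₂ (i , i<k , eq') = inj₂ (i , m≤n⇒m≤1+n i<k , trans eq eq')

sum-front : ∀ k f → sum (suc k) f ≡ f 0 + sum k (λ i → f (suc i))
sum-front zero    f = +-comm 0 (f 0)
sum-front (suc k) f = trans (cong (_+ f (suc k)) (sum-front k f)) (+-assoc (f 0) _ _)

-- The program numbers arcs by ℕ, the graph by `Fin`; this bijection leads from the computed sums
-- back to disjoint unions of path sets.
Fin-sum : ∀ k (f : ℕ → ℕ) → Fin (sum k f) ↔ Σ (Fin k) (λ i → Fin (f (toℕ i)))
Fin-sum zero    f = mk↔ₛ′ (λ ()) (λ ()) (λ ()) (λ ())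
Fin-sum (suc k) f = ↔-trans (subst (λ v → Fin (sum (suc k) f) ↔ Fin v) (sum-front k f) ↔-refl) (↔-trans Fin.+↔⊎ split)
  where
  rest : Fin (sum k (λ i → f (suc i))) ↔ Σ (Fin k) (λ i → Fin (f (suc (toℕ i))))
  rest = Fin-sum k (λ i → f (suc i))
  split : (Fin (f 0) ⊎ Fin (sum k (λ i → f (suc i)))) ↔ Σ (Fin (suc k)) (λ i → Fin (f (toℕ i)))
  split = mk↔ₛ′ to from to-from from-to
    where
    to : Fin (f 0) ⊎ Fin (sum k (λ i → f (suc i))) → Σ[ i ∈ Fin (suc k) ] Fin (f (toℕ i))
    to (inj₁ a) = zero , a
    to (inj₂ b) = suc (proj₁ (Inverse.to rest b)) , proj₂ (Inverse.to rest b)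
    from : Σ[ i ∈ Fin (suc k) ] Fin (f (toℕ i)) → Fin (f 0) ⊎ Fin (sum k (λ i → f (suc i)))
    from (zero  , a) = inj₁ a
    from (suc i , b) = inj₂ (Inverse.from rest (i , b))
    to-from : ∀ y → to (from y) ≡ y
    to-from (zero  , a) = refl
    to-from (suc i , b) = cong (λ (i , b) → suc i , b) (Inverse.strictlyInverseˡ rest (i , b))
    from-to : ∀ x → from (to x) ≡ x
    from-to (inj₁ a) = refl
    from-to (inj₂ b) = cong inj₂ (Inverse.strictlyInverseʳ rest b)

module _ {n m : ℕ} (G : DAG n m) where
  open DAG G

  tails heads weights : ℕ → ℕ
  tails   = entries (λ e → toℕ (src e))
  heads   = entries (λ e → toℕ (tgt e))
  weights = entries weight

  tails< : ∀ {e} → e < m → tails e < n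
  tails< e<m = subst (_< n) (sym (entries-< _ e<m)) (toℕ<n _)

  heads< : ∀ {e} → e < m → heads e < n
  heads< e<m = subst (_< n) (sym (entries-< _ e<m)) (toℕ<n _)

  data Walk : ℕ → Fin n → Set where
    stop : ∀ {u} → Walk 0 u
    _▸_  : ∀ {k u v} → Arc u v → Walk k v → Walk (suc k) u

  visited : ∀ {k u} → Walk k u → Fin (suc k) → Fin n
  visited {u = u} w zero = u
  visited (a ▸ w) (suc i) = visited w i

  segment : ∀ {k u} (w : Walk k u) (i j : Fin (suc k)) → i Fin.< j → TransClosure Arc (visited w i) (visited w j)
  segment (a ▸ w) zero    (suc zero)      _         = one a
  segment (a ▸ w) zero    (suc j@(suc _)) _         = a ◂ segment w zero j (s≤s z≤n)
  segment (a ▸ w) (suc i) (suc j)         (s≤s i<j) = segment w i j i<j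

  walk-short : ∀ {k u} → Walk k u → k < n
  walk-short {k} w = ≰⇒> λ n≤k → cycle (pigeonhole (s≤s n≤k) (visited w))
    where
    cycle : ∃[ i ] ∃[ j ] (i Fin.< j × visited w i ≡ visited w j) → ⊥
    cycle (i , j , i<j , eq) = acyclic (visited w i) (subst (TransClosure Arc (visited w i)) (sym eq) (segment w i j i<j))

  -- Length of a longest walk from u among those with at most r arcs.
  walks : ℕ → ℕ → ℕ
  walks zero    u = 0
  walks (suc r) u = max m (λ e → select (tails e) u (suc (walks r (heads e))))

  -- Exhibits the computed length as a walk of the graph, so that the pigeonhole argument applies to
  -- it.
  walks-walk : ∀ r (u : Fin n) → Walk (walks r (toℕ u)) u
  walks-walk zero    u = stop
  walks-walk (suc r) u with max-attained m (λ e → select (tails e) (toℕ u) (suc (walks r (heads e))))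
  ... | inj₁ eq rewrite eq = stop
  ... | inj₂ (e , e<m , eq) with tails e ≟ toℕ u
  ...   | no ≢u rewrite trans eq (select-no (suc (walks r (heads e))) ≢u) = stop
  ...   | yes ≡u rewrite trans eq (select-yes (suc (walks r (heads e))) ≡u) | entries-< (λ e → toℕ (tgt e)) e<m =
      (fromℕ< e<m , toℕ-injective (trans (sym (entries-< _ e<m)) ≡u) , refl) ▸ walks-walk r (tgt (fromℕ< e<m))

  walks-step : ∀ {e} r → e < m → suc (walks r (heads e)) ≤ walks (suc r) (tails e)
  walks-step {e} r e<m = ≤-trans (≤-reflexive (sym (select-yes {tails e} _ refl)))
    (max-≥ (λ i → select (tails i) (tails e) (suc (walks r (heads i)))) e<m)

  -- Passing to a head shortens a longest walk by at least one and the limit by exactly one, so the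
  -- hypothesis is inherited. Together with `walk-short` this makes `walks n` strictly decrease
  -- along arcs.
  walks-stable : ∀ r u → walks (suc r) u ≤ r → walks (suc r) u ≤ walks r u
  walks-stable zero    u le = le
  walks-stable (suc r) u le = max-≤ m λ {e} e<m → by e e<m (tails e ≟ u)
    where
    by : ∀ e → e < m → Dec (tails e ≡ u) → select (tails e) u (suc (walks (suc r) (heads e))) ≤ walks (suc r) u
    by e e<m (no ≢u)    = ≤-trans (≤-reflexive (select-no _ ≢u)) z≤n
    by e e<m (yes refl) = ≤-trans (≤-reflexive (select-yes {tails e} _ refl))
      (≤-trans (s≤s (walks-stable r (heads e) (s≤s⁻¹ (≤-trans (walks-step (suc r) e<m) le)))) (walks-step r e<m))

  height : ℕ → ℕ
  height = walks n

  height< : ∀ {v} → v < n → height v < n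
  height< {v} v<n = subst (λ v → height v < n) (toℕ-fromℕ< v<n) (walk-short (walks-walk n (fromℕ< v<n)))

  height-arc : ∀ {e} → e < m → height (heads e) < height (tails e)
  height-arc {e} e<m = ≤-trans (walks-step n e<m) (walks-stable n (tails e) (<⇒≤ walks<))
    where
    walks< : walks (suc n) (tails e) < n
    walks< = subst (λ v → walks (suc n) v < n) (toℕ-fromℕ< (tails< e<m)) (walk-short (walks-walk (suc n) (fromℕ< (tails< e<m))))

  -- Counting the paths to the target

  module _ (t : Fin n) (C : ℕ) where

    -- With at most r arcs: the number of paths from u to t of weight at most C + 1 − x.
    count : (r u x : ℕ) → ℕ
    count zero    u x = 0
    count (suc r) u x = if u ≡ᵇ toℕ t then (if x ≤ᵇ suc C then 1 else 0)
                        else sum m (λ e → select (tails e) u (count r (heads e) (x + weights e)))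

    count-target : ∀ r {u x} → u ≡ toℕ t → x ≤ suc C → count (suc r) u x ≡ 1
    count-target r {u} {x} eq le with u ≡ᵇ toℕ t | ≡⇒≡ᵇ u (toℕ t) eq | x ≤ᵇ suc C | ≤⇒≤ᵇ le
    ... | true | _ | true | _ = refl

    count-target′ : ∀ r {u x} → u ≡ toℕ t → suc C < x → count (suc r) u x ≡ 0
    count-target′ r {u} {x} eq lt with u ≡ᵇ toℕ t | ≡⇒≡ᵇ u (toℕ t) eq | x ≤ᵇ suc C | ≤ᵇ⇒≤ x (suc C)
    ... | true | _ | true  | f = contradiction (f tt) (<⇒≱ lt)
    ... | true | _ | false | _ = refl

    count-other : ∀ r {u x} → u ≢ toℕ t → count (suc r) u x ≡ sum m (λ e → select (tails e) u (count r (heads e) (x + weights e)))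
    count-other r {u} neq with u ≡ᵇ toℕ t | ≡ᵇ⇒≡ u (toℕ t)
    ... | true  | f = contradiction (f tt) neq
    ... | false | _ = refl

    select-cong : ∀ {a b x y} → (a ≡ b → x ≡ y) → select a b x ≡ select a b y
    select-cong {a} {b} {x} {y} f with a ≟ b
    ... | yes eq = trans (select-yes x eq) (trans (f eq) (sym (select-yes y eq)))
    ... | no neq = trans (select-no x neq) (sym (select-no y neq))

    count-stable : ∀ r {u} x → height u < r → count r u x ≡ count (suc r) u x
    count-stable (suc r) {u} x h<r with u ≟ toℕ t
    ... | yes eq with x ≤? suc C
    ...   | yes le = trans (count-target r eq le) (sym (count-target (suc r) eq le))
    ...   | no ≰   = trans (count-target′ r eq (≰⇒> ≰)) (sym (count-target′ (suc r) eq (≰⇒> ≰)))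
    count-stable (suc r) {u} x h<r | no neq = trans (count-other r neq) (trans
      (sum-cong m λ e e<m → select-cong λ eq → count-stable r (x + weights e)
        (<-≤-trans (height-arc e<m) (s≤s⁻¹ (subst (λ v → height v < suc r) (sym eq) h<r))))
      (sym (count-other (suc r) neq)))

    module _ (n>0 : 1 ≤ n) where
      private
        r : ℕ
        r = pred n
        n≡ : suc r ≡ n
        n≡ = suc-pred n {{>-nonZero n>0}}

      total-target : ∀ {x} → x ≤ suc C → count n (toℕ t) x ≡ 1
      total-target {x} le = subst (λ k → count k (toℕ t) x ≡ 1) n≡ (count-target r refl le)

      total-target′ : ∀ {x} → suc C < x → count n (toℕ t) x ≡ 0
      total-target′ {x} lt = subst (λ k → count k (toℕ t) x ≡ 0) n≡ (count-target′ r refl lt)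

      total-step : ∀ {u} → u ≢ toℕ t → ∀ x → count n u x ≡ sum m (λ e → select (tails e) u (count n (heads e) (x + weights e)))
      total-step {u} neq x with u <? n
      ... | yes u<n = trans (count-stable n x (height< u<n)) (count-other n neq)
      ... | no u≮n  = trans (subst (λ k → count k u x ≡ 0) n≡ (trans (count-other r neq) (none λ e → count r (heads e) (x + weights e)))) (sym (none λ e → count n (heads e) (x + weights e)))
        where
        none : ∀ (f : ℕ → ℕ) → sum m (λ e → select (tails e) u (f e)) ≡ 0
        none f = trans (sum-cong m λ e e<m → select-no (f e) λ eq → u≮n (subst (_< n) eq (tails< e<m))) (sum-zero m)

    Within : Fin n → ℕ → Set
    Within u x = Σ[ p ∈ Path u t ] totalWeight p + x ≤ suc C

    private
      within-≡ : ∀ {u x} {p q : Path u t} {i : totalWeight p + x ≤ suc C} {j : totalWeight q + x ≤ suc C} →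
                 p ≡ q → _≡_ {A = Within u x} (p , i) (q , j)
      within-≡ {p = p} refl = cong (p ,_) (≤-irrelevant _ _)

      -- This is why `count` may stop at the target: a nonempty path from `t` back to `t` would be a
      -- cycle.
      closed : ∀ (p : Path t t) → p ≡ Star.ε
      closed Star.ε       = refl
      closed (a ◅ p) = contradiction (extend a p) (acyclic t)
        where
        extend : ∀ {u v w} → Arc u v → Path v w → TransClosure Arc u w
        extend a Star.ε       = one a
        extend a (b ◅ p) = a ◂ extend b p

      Leaving : Fin n → ℕ → Fin m → Set
      Leaving u x e = src e ≡ u × Within (tgt e) (x + weight e)

      shift : ∀ a b c → a + (b + c) ≡ c + a + b
      shift = solve-∀

      leave : ∀ {u x} → u ≢ t → Σ (Fin m) (Leaving u x) ↔ Within u x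
      leave {u} {x} u≢t = mk↔ₛ′ to from to-from from-to
        where
        to : Σ (Fin m) (Leaving u x) → Within u x
        to (e , eq , p , le) = (e , eq , refl) ◅ p , subst (_≤ suc C) (shift (totalWeight p) x (weight e)) le
        from : Within u x → Σ (Fin m) (Leaving u x)
        from (Star.ε , le)                     = contradiction refl u≢t
        from ((e , eq , refl) ◅ p , le) = e , eq , p , subst (_≤ suc C) (sym (shift (totalWeight p) x (weight e))) le
        to-from : ∀ y → to (from y) ≡ y
        to-from (Star.ε , le)                     = contradiction refl u≢t
        to-from ((e , eq , refl) ◅ p , le) = within-≡ refl
        from-to : ∀ y → from (to y) ≡ y
        from-to (e , eq , p , le) = cong (λ le → e , eq , p , le) (≤-irrelevant _ _)

      leaving : ∀ {u x k} e → (src e ≡ u → Fin k ↔ Within (tgt e) (x + weight e)) →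
                Fin (select (toℕ (src e)) (toℕ u) k) ↔ Leaving u x e
      leaving {u} {x} {k} e iso with src e Fin.≟ u
      ... | yes eq = subst (λ j → Fin j ↔ Leaving u x e) (sym (select-yes k (cong toℕ eq))) (mk↔ₛ′
              (λ a → eq , Inverse.to (iso eq) a) (λ (_ , p) → Inverse.from (iso eq) p)
              (λ (eq' , p) → cong₂ _,_ (uip eq eq') (Inverse.strictlyInverseˡ (iso eq) p)) (Inverse.strictlyInverseʳ (iso eq)))
      ... | no neq = subst (λ j → Fin j ↔ Leaving u x e) (sym (select-no k (λ eq → neq (toℕ-injective eq)))) (mk↔ₛ′
              (λ ()) (λ (eq , _) → contradiction eq neq) (λ (eq , _) → contradiction eq neq) (λ ()))

    count-paths : ∀ r (u : Fin n) x → height (toℕ u) < r → Fin (count r (toℕ u) x) ↔ Within u x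
    count-paths (suc r) u x h<r with toℕ u ≟ toℕ t
    ... | no neq = subst (λ k → Fin k ↔ Within u x) (sym (count-other r neq)) (↔-trans (Fin-sum m _) (↔-trans
            (Σ-↔ ↔-refl λ {e} → subst₂ (λ v k → Fin (select v (toℕ u) k) ↔ Leaving u x e) (sym (entries-toℕ _ e))
                (sym (cong₂ (λ v w → count r v (x + w)) (entries-toℕ (λ e → toℕ (tgt e)) e) (entries-toℕ weight e)))
                (leaving e λ { refl → count-paths r (tgt e) (x + weight e)
                  (subst (λ v → height v < r) (entries-toℕ _ e) (<-≤-trans (height-arc (toℕ<n e)) (s≤s⁻¹
                    (subst (λ v → height v < suc r) (sym (entries-toℕ _ e)) h<r)))) }))
            (leave λ { refl → neq refl })))
    ... | yes eq with toℕ-injective eq | x ≤? suc C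
    ...   | refl | yes le = subst (λ k → Fin k ↔ Within u x) (sym (count-target r refl le)) (mk↔ₛ′
              (λ _ → Star.ε , le) (λ _ → zero) (λ (p , _) → within-≡ (sym (closed p))) (λ { zero → refl }))
    ...   | refl | no ≰ = subst (λ k → Fin k ↔ Within u x) (sym (count-target′ r refl (≰⇒> ≰))) (mk↔ₛ′
              (λ ()) (λ (p , le) → contradiction (≤-trans (m≤n+m x (totalWeight p)) le) ≰)
              (λ (p , le) → contradiction (≤-trans (m≤n+m x (totalWeight p)) le) ≰) (λ ()))

    -- The offset 1 leaves the full capacity, and `n` arcs are no restriction because the height is
    -- below `n`.
    paths-within : ∀ s → Fin (count n (toℕ s) 1) ↔ PathWithin s t C
    paths-within s = ↔-trans (count-paths n s 1 (height< (toℕ<n s))) (mk↔ₛ′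
      (λ (p , le) → p , s≤s⁻¹ (subst (_≤ suc C) (+-comm (totalWeight p) 1) le))
      (λ (p , le) → p , subst (_≤ suc C) (+-comm 1 (totalWeight p)) (s≤s le))
      (λ (p , le) → cong (p ,_) (≤-irrelevant _ _)) (λ (p , le) → cong (p ,_) (≤-irrelevant _ _)))

    -- An upper bound for the number of paths

    module _ {κ : ℕ} (db : Doublings n m κ) where
      private
        out : ℕ → ℕ
        out v = sum m (λ e → select (tails e) v 1)

        cost : ℕ → ℕ
        cost v = shr (out v) κ + κ

        out≤ : ∀ v → out v ≤ 2 ^ cost v
        out≤ v = begin
          out v ≤⟨ <⇒≤ (shr-upper (out v) κ) ⟩
          suc (shr (out v) κ) * 2 ^ κ ≤⟨ *-monoˡ-≤ (2 ^ κ) (n<2^n (shr (out v) κ)) ⟩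
          2 ^ shr (out v) κ * 2 ^ κ ≡⟨ ^-distribˡ-+-* 2 (shr (out v) κ) κ ⟨
          2 ^ cost v ∎
          where open ≤-Reasoning

        -- Without rounding, the shares of `2 ^ κ` in the degrees would sum to at most `m / 2 ^ κ`,
        -- and this is at most `n` by the choice of `κ`.
        total-cost : sum n cost ≤ n + κ * n
        total-cost = begin
          sum n cost ≡⟨ sum-+ n (λ v → shr (out v) κ) (λ _ → κ) ⟩
          sum n (λ v → shr (out v) κ) + sum n (λ _ → κ) ≤⟨ +-mono-≤ (*-cancelʳ-≤ _ n (2 ^ κ) {{m^n≢0 2 κ}} shares) (≤-reflexive (trans (sum-const n κ) (*-comm n κ))) ⟩
          n + κ * n ∎
          where
          open ≤-Reasoning
          shares : sum n (λ v → shr (out v) κ) * 2 ^ κ ≤ n * 2 ^ κ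
          shares = begin
            sum n (λ v → shr (out v) κ) * 2 ^ κ ≡⟨ sum-* n (λ v → shr (out v) κ) (2 ^ κ) ⟨
            sum n (λ v → shr (out v) κ * 2 ^ κ) ≤⟨ sum-mono n (λ v _ → shr-lower (out v) κ) ⟩
            sum n out ≤⟨ degree-sum n m tails ⟩
            m ≤⟨ Doublings.enough db ⟩
            2 ^ κ * n ≡⟨ *-comm (2 ^ κ) n ⟩
            n * 2 ^ κ ∎

        -- After its first vertex a path visits only lower vertices, so restricting the product of
        -- the out-degrees to vertices below a height gives one bound for all heads at once.
        below : ℕ → ℕ → ℕ
        below h v = if height v <ᵇ h then cost v else 0

        below≤ : ∀ {h h'} → h ≤ h' → ∀ v → below h v ≤ below h' v
        below≤ {h} {h'} h≤h' v with height v <ᵇ h | <ᵇ⇒< (height v) h | height v <ᵇ h' | <⇒<ᵇ {height v} {h'}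
        ... | false | _ | _     | _ = z≤n
        ... | true  | f | true  | _ = ≤-refl
        ... | true  | f | false | g = ⊥-elim (g (<-≤-trans (f tt) h≤h'))

        below-self : ∀ v → cost v + below (height v) v ≤ below (suc (height v)) v
        below-self v with height v <ᵇ height v | <ᵇ⇒< (height v) (height v) | height v <ᵇ suc (height v) | <⇒<ᵇ {height v} {suc (height v)}
        ... | true  | f | _     | _ = ⊥-elim (<-irrefl refl (f tt))
        ... | false | _ | true  | _ = ≤-reflexive (+-identityʳ (cost v))
        ... | false | _ | false | g = ⊥-elim (g ≤-refl)

        select-* : ∀ a b K → select a b 1 * K ≡ select a b K
        select-* a b K with a ≡ᵇ b
        ... | true  = +-identityʳ K
        ... | false = refl

      -- All heads lie below `height u`, so each of the at most `2 ^ cost u` arcs contributes at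
      -- most `M`. The factor for `u` itself appears when the limit rises from `height u` to its
      -- successor.
      count-bound : ∀ r {u} x → u < n → count r u x ≤ 2 ^ sum n (below (suc (height u)))
      count-bound zero        x u<n = z≤n
      count-bound (suc r) {u} x u<n with u ≟ toℕ t
      ... | yes eq with x ≤? suc C
      ...   | yes le = ≤-trans (≤-reflexive (count-target r eq le)) (pow>0 (sum n (below (suc (height u)))))
      ...   | no ≰   = ≤-trans (≤-reflexive (count-target′ r eq (≰⇒> ≰))) z≤n
      count-bound (suc r) {u} x u<n | no neq = begin
        count (suc r) u x ≡⟨ count-other r neq ⟩
        sum m (λ e → select (tails e) u (count r (heads e) (x + weights e))) ≤⟨ sum-mono m term ⟩
        sum m (λ e → select (tails e) u 1 * M) ≡⟨ sum-* m (λ e → select (tails e) u 1) M ⟩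
        out u * M ≤⟨ *-monoˡ-≤ M (out≤ u) ⟩
        2 ^ cost u * M ≡⟨ ^-distribˡ-+-* 2 (cost u) (sum n (below (height u))) ⟨
        2 ^ (cost u + sum n (below (height u))) ≤⟨ ^-monoʳ-≤ 2 (sum-gap u<n (λ v _ → below≤ (n≤1+n (height u)) v) (below-self u)) ⟩
        2 ^ sum n (below (suc (height u))) ∎
        where
        open ≤-Reasoning
        M : ℕ
        M = 2 ^ sum n (below (height u))
        term : ∀ e → e < m → select (tails e) u (count r (heads e) (x + weights e)) ≤ select (tails e) u 1 * M
        term e e<m with tails e ≟ u
        ... | no ≢u    = ≤-trans (≤-reflexive (select-no _ ≢u)) z≤n
        ... | yes ≡u = begin
          select (tails e) u (count r (heads e) (x + weights e)) ≤⟨ select-≤ (tails e) u _ ⟩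
          count r (heads e) (x + weights e) ≤⟨ count-bound r (x + weights e) (heads< e<m) ⟩
          2 ^ sum n (below (suc (height (heads e)))) ≤⟨ ^-monoʳ-≤ 2 (sum-mono n λ v _ → below≤ (subst (λ v → height (heads e) < height v) ≡u (height-arc e<m)) v) ⟩
          M ≡⟨ select-yes M ≡u ⟨
          select (tails e) u M ≡⟨ select-* (tails e) u M ⟨
          select (tails e) u 1 * M ∎

      count≤ : ∀ {s} → s < n → count n s 1 ≤ 2 ^ (n + κ * n)
      count≤ {s} s<n = ≤-trans (count-bound n 1 s<n) (^-monoʳ-≤ 2 (≤-trans (sum-mono n λ v _ → all v) total-cost))
        where
        all : ∀ v → below (suc (height s)) v ≤ cost v
        all v with height v <ᵇ suc (height s)
        ... | true  = ≤-refl
        ... | false = z≤n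

-- Ceilings of rational numbers

open import Data.Integer as ℤ using (ℤ; +_; -[1+_]; +[1+_]; ∣_∣)
import Data.Integer.Properties as ℤ
open import Data.Nat.Coprimality using (Coprime; 1-coprimeTo) renaming (sym to coprime-sym)
open import Data.Rational as ℚ using (ℚ; mkℚ; 0ℚ; 1ℚ; 1/_; *≤*)
import Data.Rational.Properties as ℚ

private
  ι : ℕ → ℚ
  ι k = mkℚ (+ k) 0 (coprime-sym (1-coprimeTo k))

  fromℕ≡ι : ∀ k → fromℕ k ≡ ι k
  fromℕ≡ι k = ℚ.↥p/↧p≡p (ι k)

fromℕ-+ : ∀ a b → fromℕ (a + b) ≡ fromℕ a ℚ.+ fromℕ b
fromℕ-+ a b rewrite fromℕ≡ι a | fromℕ≡ι b = cong (ℚ._/ 1)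
  (trans (ℤ.pos-+ a b) (sym (cong₂ ℤ._+_ (ℤ.*-identityʳ (+ a)) (ℤ.*-identityʳ (+ b)))))

fromℕ-* : ∀ a b → fromℕ (a * b) ≡ fromℕ a ℚ.* fromℕ b
fromℕ-* a b rewrite fromℕ≡ι a | fromℕ≡ι b = cong (ℚ._/ 1) (ℤ.pos-* a b)

fromℕ-mono : ∀ {a b} → a ≤ b → fromℕ a ℚ.≤ fromℕ b
fromℕ-mono {a} {b} le rewrite fromℕ≡ι a | fromℕ≡ι b = *≤* (ℤ.*-monoʳ-≤-nonNeg (+ 1) (ℤ.+≤+ le))

fromℕ≥0 : ∀ a → 0ℚ ℚ.≤ fromℕ a
fromℕ≥0 a = fromℕ-mono {0} {a} z≤n

fromℕ-nonNeg : ∀ a → ℚ.NonNegative (fromℕ a)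
fromℕ-nonNeg a = ℚ.nonNegative (fromℕ≥0 a)

private
  -- A ceiling is the negated floor of the negated number, and the division of a negative integer
  -- splits into cases on whether the remainder vanishes.
  quotient : ∀ k d .{{_ : NonZero d}} → let q = ∣ -[1+ k ] ℤ./ℕ d ∣ in suc k ≤ q * d × q * d < suc k + d
  quotient k d with suc k % d in eq
  ... | zero = subst (λ q → suc k ≤ q * d × q * d < suc k + d) (sym (ℤ.∣-i∣≡∣i∣ (+ (suc k / d))))
      (≤-reflexive a≡ , ≤-<-trans (≤-reflexive (sym a≡)) (m<m+n (suc k) (>-nonZero⁻¹ d)))
    where
    a≡ : suc k ≡ suc k / d * d
    a≡ = trans (m≡m%n+[m/n]*n (suc k) d) (cong (_+ suc k / d * d) eq)
  ... | suc r = ≤-trans (≤-reflexive a≡) (+-monoˡ-≤ (suc k / d * d) (<⇒≤ (subst (_< d) eq (m%n<n (suc k) d))))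
      , ≤-trans (s≤s (≤-trans (≤-reflexive (+-comm d _)) (+-monoˡ-≤ d (≤-trans (m≤n+m _ r) (s≤s⁻¹ (≤-reflexive (sym a≡))))))) ≤-refl
    where
    a≡ : suc k ≡ suc r + suc k / d * d
    a≡ = trans (m≡m%n+[m/n]*n (suc k) d) (cong (_+ suc k / d * d) eq)

  ceiling-pos : ∀ k d-1 .(c : Coprime (suc k) (suc d-1)) → ∣ ℚ.ceiling (mkℚ +[1+ k ] d-1 c) ∣ ≡ ∣ -[1+ k ] ℤ./ℕ suc d-1 ∣
  ceiling-pos k d-1 c = trans (ℤ.∣-i∣≡∣i∣ (+ 1 ℤ.* (-[1+ k ] ℤ./ℕ suc d-1))) (cong ∣_∣ (ℤ.*-identityˡ (-[1+ k ] ℤ./ℕ suc d-1)))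

ceiling-spec : ∀ p → 0ℚ ℚ.< p → ∃[ q ] (∣ ℚ.ceiling p ∣ ≡ suc q × p ℚ.≤ fromℕ (suc q) × fromℕ q ℚ.≤ p)
ceiling-spec (mkℚ (+ 0)     d-1 c) (ℚ.*<* (ℤ.+<+ ()))
ceiling-spec (mkℚ -[1+ _ ] d-1 c) (ℚ.*<* ())
ceiling-spec (mkℚ +[1+ k ] d-1 c) _ = by _ refl
  where
  d = suc d-1
  by : ∀ q → ∣ -[1+ k ] ℤ./ℕ d ∣ ≡ q →
       ∃[ q ] (∣ ℚ.ceiling (mkℚ +[1+ k ] d-1 c) ∣ ≡ suc q × mkℚ +[1+ k ] d-1 c ℚ.≤ fromℕ (suc q) × fromℕ q ℚ.≤ mkℚ +[1+ k ] d-1 c)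
  by zero    eq = contradiction (subst (λ q → suc k ≤ q * d) eq (proj₁ (quotient k d))) λ ()
  by (suc q) eq = q , trans (ceiling-pos k d-1 c) eq
    , subst (mkℚ +[1+ k ] d-1 c ℚ.≤_) (sym (fromℕ≡ι (suc q)))
        (*≤* (subst₂ ℤ._≤_ (sym (ℤ.*-identityʳ +[1+ k ])) (ℤ.pos-* (suc q) d)
          (ℤ.+≤+ (subst (λ q → suc k ≤ q * d) eq (proj₁ (quotient k d))))))
    , subst (ℚ._≤ mkℚ +[1+ k ] d-1 c) (sym (fromℕ≡ι q))
        (*≤* (subst₂ ℤ._≤_ (ℤ.pos-* q d) (sym (ℤ.*-identityʳ +[1+ k ]))
          (ℤ.+≤+ (<⇒≤ (+-cancelˡ-< d (q * d) (suc k) (≤-trans (subst (λ q → q * d < suc k + d) eq (proj₂ (quotient k d)))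
            (≤-reflexive (+-comm (suc k) d))))))))

-- Bounds on the running time

open import Data.Fin.Properties using (combine-injectiveˡ; combine-injectiveʳ; injective⇒≤)
open import Data.Nat.Logarithm using (⌊log₂⌋-mono-≤; ⌊log₂[2^n]⌋≡n)
open import Data.Rational.Solver using (module +-*-Solver)

open +-*-Solver using (solve; _:=_; _:+_; _:*_; _:-_; con)

<2^log : ∀ x → x < 2 ^ suc ⌊log₂ x ⌋
<2^log x = ≰⇒> λ le → <-irrefl refl
  (≤-trans (≤-reflexive (sym (⌊log₂[2^n]⌋≡n (suc ⌊log₂ x ⌋)))) (⌊log₂⌋-mono-≤ le))

log≤ : ∀ x → ⌊log₂ x ⌋ ≤ x
log≤ x = ≤-trans (⌊log₂⌋-mono-≤ (<⇒≤ (n<2^n x))) (≤-reflexive (⌊log₂[2^n]⌋≡n x))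

doublings≤ : ∀ {p x k} → Doublings p x k → 2 ^ k * p ≤ p + 2 * x
doublings≤ {p} {x} {zero}  db = ≤-trans (≤-reflexive (+-identityʳ p)) (m≤m+n p _)
doublings≤ {p} {x} {suc j} db = ≤-trans (≤-reflexive (*-assoc 2 (2 ^ j) p))
  (≤-trans (*-monoʳ-≤ 2 (<⇒≤ (Doublings.least db ≤-refl))) (m≤n+m (2 * x) p))

doublings-1 : ∀ {x k} → 1 ≤ x → Doublings 1 x k → 2 ^ k ≤ 2 * x
doublings-1 {x} {zero}  1≤x db = ≤-trans 1≤x (m≤m+n x _)
doublings-1 {x} {suc j} 1≤x db = *-monoʳ-≤ 2 (≤-trans (≤-reflexive (sym (*-identityʳ (2 ^ j)))) (<⇒≤ (Doublings.least db ≤-refl)))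

-- Adding one to `C` may add a bit, and the binary logarithm is rounded down; two chunks of length
-- `w` cover both.
number-cap : ∀ n C → Timed.numberTime n C (suc C) ≤ 3
number-cap n C = begin
  1 + bits (suc C) / w ≤⟨ s≤s (/-monoˡ-≤ w (bits≤ {suc C} {2 * w} C<)) ⟩
  1 + 2 * w / w ≡⟨ cong suc (m*n/n≡m 2 w) ⟩
  3 ∎
  where
  open ≤-Reasoning
  w : ℕ
  w = suc (⌊log₂ n ⌋ + ⌊log₂ C ⌋)
  C< : suc C < 2 ^ (2 * w)
  C< = ≤-<-trans (<2^log C) (^-monoʳ-< 2 (s≤s (s≤s z≤n)) (≤-trans (≤-reflexive (+-comm 1 (suc ⌊log₂ C ⌋)))
    (+-mono-≤ (s≤s (m≤n+m ⌊log₂ C ⌋ ⌊log₂ n ⌋)) (s≤s z≤n))))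

word-n : ∀ n C → Timed.wordTime n C n ≤ 3
word-n n C = ≤-trans (s≤s (≤-trans (/-monoˡ-≤ g (bits≤ {n} {g} (<2^log n))) (≤-reflexive (n/n≡1 g)))) (n≤1+n 2)
  where
  g : ℕ
  g = suc ⌊log₂ n ⌋

-- Abstract, lest the type checker unfolds it in unary.
abstract
  factor : ℕ
  factor = (1 + 40 + 1400 * 256) * (5 * 22)

  factor≡ : (1 + 40 + 1400 * 256) * (5 * 22) ≡ factor
  factor≡ = refl

  factor≥ : 60 ≤ factor
  factor≥ = ≤ᵇ⇒≤ 60 factor tt

module Bounds (n m q k C : ℕ) (n>0 : 1 ≤ n) (m>0 : 1 ≤ m) (q>0 : 1 ≤ q) (k>0 : 1 ≤ k)
  (m≤n² : m ≤ n * n) (q≤ : q ≤ (n ⊔ 2) ^ k) (l : ℕ) (l>0 : 1 ≤ l) (l≥ : _/_ m n {{>-nonZero n>0}} < 2 ^ suc l) (l≤m : l ≤ m)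
  {β₁ β₂ κ α : ℕ}
  (db₁ : Doublings 1 n β₁) (db₂ : Doublings 1 q β₂) (dbX : Doublings n m κ) (dbA : Doublings 1 (suc (n + κ * n)) α) where

  private
    X a J Z g : ℕ
    X = n + κ * n
    a = 3 + β₁ + β₂ + α
    J = 2 ^ a
    Z = m * 8 * J
    g = suc ⌊log₂ n ⌋

  V : ℕ
  V = wordBound n m κ a

  private
    κ≤ : κ ≤ suc l
    κ≤ = by κ dbX
      where
      by : ∀ κ → Doublings n m κ → κ ≤ suc l
      by zero    db = z≤n
      by (suc j) db = s≤s (s≤s⁻¹ (≰⇒> λ l<j → <⇒≱ l≥ (≤-trans (^-monoʳ-≤ 2 l<j)
        (≤-trans (≤-reflexive (sym (m*n/n≡m (2 ^ j) n {{>-nonZero n>0}})))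
          (/-monoˡ-≤ n {{>-nonZero n>0}} (<⇒≤ (Doublings.least db ≤-refl)))))))

    X≤ : suc X ≤ 4 * (n * l)
    X≤ = begin
      suc (n + κ * n) ≤⟨ s≤s (+-monoʳ-≤ n (*-monoˡ-≤ n κ≤)) ⟩
      1 + (n + (n + l * n)) ≤⟨ +-mono-≤ (*-mono-≤ n>0 l>0) (+-mono-≤ (m≤m*n n l {{>-nonZero l>0}}) (+-mono-≤ (m≤m*n n l {{>-nonZero l>0}}) (≤-reflexive (*-comm l n)))) ⟩
      n * l + (n * l + (n * l + n * l)) ≡⟨ lem (n * l) ⟩
      4 * (n * l) ∎
      where
      open ≤-Reasoning
      lem : ∀ x → x + (x + (x + x)) ≡ 4 * x
      lem = solve-∀

  -- The constant is 8 · 2 · 2 · 2 · 4: the 8 of the precision, a 2 for each of three logarithms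
  -- rounded up, and the 4 of `X≤`.
  J≤ : J ≤ 256 * (n ^ 2 * l * q)
  J≤ = begin
    2 ^ (3 + β₁ + β₂ + α) ≡⟨ split ⟩
    8 * 2 ^ β₁ * 2 ^ β₂ * 2 ^ α ≤⟨ *-mono-≤ (*-mono-≤ (*-monoʳ-≤ 8 (doublings-1 n>0 db₁)) (doublings-1 q>0 db₂)) (doublings-1 (s≤s z≤n) dbA) ⟩
    8 * (2 * n) * (2 * q) * (2 * suc X) ≤⟨ *-monoʳ-≤ (8 * (2 * n) * (2 * q)) (*-monoʳ-≤ 2 X≤) ⟩
    8 * (2 * n) * (2 * q) * (2 * (4 * (n * l))) ≡⟨ lem n l q ⟩
    256 * (n ^ 2 * l * q) ∎
    where
    open ≤-Reasoning
    split : 2 ^ (3 + β₁ + β₂ + α) ≡ 8 * 2 ^ β₁ * 2 ^ β₂ * 2 ^ α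
    split = trans (^-distribˡ-+-* 2 (3 + β₁ + β₂) α) (cong (_* 2 ^ α)
      (trans (^-distribˡ-+-* 2 (3 + β₁) β₂) (cong (_* 2 ^ β₂) (^-distribˡ-+-* 2 3 β₁))))
    lem : ∀ n l q → 8 * (2 * n) * (2 * q) * (2 * (4 * (n * l))) ≡ 256 * (n * (n * 1) * l * q)
    lem = solve-∀

  private
    n≤ : n ≤ 2 ^ g
    n≤ = <⇒≤ (<2^log n)

    q≤2 : q ≤ 2 ^ (g * k)
    q≤2 = ≤-trans q≤ (≤-trans (^-monoˡ-≤ k (⊔-lub n≤ (^-monoʳ-≤ 2 {1} {g} (s≤s z≤n)))) (≤-reflexive (^-*-assoc 2 g k)))

    m≤ : m ≤ 2 ^ g * 2 ^ g
    m≤ = ≤-trans m≤n² (*-mono-≤ n≤ n≤)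

    Y : ℕ
    Y = n * (m * J)

    J>0 : 1 ≤ J
    J>0 = pow>0 a

    V≤ : V ≤ 26 * Y
    V≤ = begin
      suc Z + suc Z + (n * J + (2 ^ κ * n + (n + m)))
        ≤⟨ +-monoʳ-≤ (suc Z + suc Z) (+-monoʳ-≤ (n * J) (+-monoˡ-≤ (n + m) (doublings≤ dbX))) ⟩
      suc Z + suc Z + (n * J + (n + 2 * m + (n + m)))
        ≡⟨ lem₁ m J n ⟩
      16 * (m * J) + n * J + (2 * n + 3 * m + 2)
        ≤⟨ +-mono-≤ (+-mono-≤ (*-monoʳ-≤ 16 mJ≤) nJ≤) (+-mono-≤ (+-mono-≤ (*-monoʳ-≤ 2 nY) (*-monoʳ-≤ 3 mY)) (*-monoʳ-≤ 2 (*-mono-≤ n>0 (*-mono-≤ m>0 J>0)))) ⟩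
      16 * Y + Y + (2 * Y + 3 * Y + 2 * Y)
        ≤⟨ m≤m+n _ (2 * Y) ⟩
      16 * Y + Y + (2 * Y + 3 * Y + 2 * Y) + 2 * Y
        ≡⟨ lem₂ Y ⟩
      26 * Y ∎
      where
      open ≤-Reasoning
      mJ≤ : m * J ≤ Y
      mJ≤ = m≤n*m (m * J) n {{>-nonZero n>0}}
      nJ≤ : n * J ≤ Y
      nJ≤ = *-monoʳ-≤ n (m≤n*m J m {{>-nonZero m>0}})
      nY : n ≤ Y
      nY = ≤-trans (m≤m*n n J {{m^n≢0 2 a}}) nJ≤
      mY : m ≤ Y
      mY = ≤-trans (m≤m*n m J {{m^n≢0 2 a}}) mJ≤
      lem₁ : ∀ m J n → suc (m * 8 * J) + suc (m * 8 * J) + (n * J + (n + 2 * m + (n + m))) ≡ 16 * (m * J) + n * J + (2 * n + 3 * m + 2)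
      lem₁ = solve-∀
      lem₂ : ∀ Y → 16 * Y + Y + (2 * Y + 3 * Y + 2 * Y) + 2 * Y ≡ 26 * Y
      lem₂ = solve-∀

    -- Only the number of bits matters here, so the crude `l ≤ m` is enough. The 7 counts powers of
    -- `n`: one for `n`, two each for `m`, `n ^ 2` and `l`; the 8 stands for the 256.
    Y≤ : Y ≤ 2 ^ (8 + 7 * g + g * k)
    Y≤ = begin
      n * (m * J) ≤⟨ *-monoʳ-≤ n (*-monoʳ-≤ m (≤-trans J≤ (*-monoʳ-≤ 256 (*-monoˡ-≤ q (*-monoʳ-≤ (n ^ 2) l≤m))))) ⟩
      n * (m * (256 * (n ^ 2 * m * q))) ≤⟨ *-mono-≤ n≤ (*-mono-≤ m≤ (*-monoʳ-≤ 256 (*-mono-≤ (*-mono-≤ (^-monoˡ-≤ 2 n≤) m≤) q≤2))) ⟩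
      G * (G * G * (256 * (G ^ 2 * (G * G) * 2 ^ (g * k)))) ≡⟨ lem G (2 ^ (g * k)) ⟩
      256 * G ^ 7 * 2 ^ (g * k) ≡⟨ cong (λ v → 256 * v * 2 ^ (g * k)) (trans (^-*-assoc 2 g 7) (cong (2 ^_) (*-comm g 7))) ⟩
      2 ^ 8 * 2 ^ (7 * g) * 2 ^ (g * k) ≡⟨ cong (_* 2 ^ (g * k)) (^-distribˡ-+-* 2 8 (7 * g)) ⟨
      2 ^ (8 + 7 * g) * 2 ^ (g * k) ≡⟨ ^-distribˡ-+-* 2 (8 + 7 * g) (g * k) ⟨
      2 ^ (8 + 7 * g + g * k) ∎
      where
      open ≤-Reasoning
      G : ℕ
      G = 2 ^ g
      lem : ∀ G t → G * (G * G * (256 * (G * (G * 1) * (G * G) * t))) ≡ 256 * (G * (G * (G * (G * (G * (G * (G * 1))))))) * t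
      lem = solve-∀

    V< : V < 2 ^ (21 * (k * g))
    V< = begin-strict
      V ≤⟨ V≤ ⟩
      26 * Y <⟨ *-monoˡ-< Y {{>-nonZero (*-mono-≤ n>0 (*-mono-≤ m>0 J>0))}} (m≤m+n 27 5) ⟩
      32 * Y ≤⟨ *-monoʳ-≤ 32 Y≤ ⟩
      2 ^ 5 * 2 ^ (8 + 7 * g + g * k) ≡⟨ ^-distribˡ-+-* 2 5 (8 + 7 * g + g * k) ⟨
      2 ^ (13 * 1 + 7 * g + g * k) ≤⟨ ^-monoʳ-≤ 2 (+-mono-≤ (+-mono-≤ (*-monoʳ-≤ 13 (*-mono-≤ k>0 (s≤s (z≤n {⌊log₂ n ⌋})))) (*-monoʳ-≤ 7 (m≤n*m g k {{>-nonZero k>0}}))) (≤-reflexive (*-comm g k))) ⟩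
      2 ^ (13 * (k * g) + 7 * (k * g) + k * g) ≡⟨ cong (2 ^_) (lem (k * g)) ⟩
      2 ^ (21 * (k * g)) ∎
      where
      open ≤-Reasoning
      lem : ∀ x → 13 * x + 7 * x + x ≡ 21 * x
      lem = solve-∀

  -- Origin of the factor `k` in the running time: `V` has O(k g) bits and a word has `g` bits. The
  -- exponent 21 is 5 for the constant 26, plus 8 and 7 from `Y≤`, plus 1 for `q`.
  word-V : Timed.wordTime n C V ≤ 22 * k
  word-V = begin
    1 + bits V / g ≤⟨ +-mono-≤ k>0 (/-monoˡ-≤ g (bits≤ {V} {21 * (k * g)} V<)) ⟩
    k + 21 * (k * g) / g ≡⟨ cong (λ v → k + v / g) (*-assoc 21 k g) ⟨
    k + 21 * k * g / g ≡⟨ cong (λ v → k + v) (m*n/n≡m (21 * k) g) ⟩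
    k + 21 * k ∎
    where open ≤-Reasoning

  number-C : Timed.numberTime n C (suc C) ≤ 22 * k
  number-C = ≤-trans (number-cap n C) (≤-trans (m≤m+n 3 19) (m≤m*n 22 k {{>-nonZero k>0}}))

  time-bound : ∀ {T} → T ≤ suc (40 * (n * n * m) + 1400 * (m * J)) * (5 * (22 * k)) → T ≤ factor * (m * n ^ 2 * l * k * q)
  time-bound {T} le = begin
    T ≤⟨ le ⟩
    suc (40 * (n * n * m) + 1400 * (m * J)) * (5 * (22 * k)) ≤⟨ *-monoˡ-≤ (5 * (22 * k)) (+-mono-≤ W>0 (+-mono-≤ (*-monoʳ-≤ 40 nnm≤) (*-monoʳ-≤ 1400 (*-monoʳ-≤ m J≤)))) ⟩
    (W + (40 * W + 1400 * (m * (256 * (n ^ 2 * l * q))))) * (5 * (22 * k)) ≡⟨ trans (lem 40 1400 256 5 22 m (n ^ 2) l q k) (cong (_* (m * n ^ 2 * l * k * q)) factor≡) ⟩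
    factor * (m * n ^ 2 * l * k * q) ∎
    where
    open ≤-Reasoning
    W : ℕ
    W = m * (n ^ 2 * l * q)
    n²>0 : 1 ≤ n ^ 2
    n²>0 = *-mono-≤ n>0 (*-mono-≤ n>0 (≤-refl {1}))
    W>0 : 1 ≤ W
    W>0 = *-mono-≤ m>0 (*-mono-≤ (*-mono-≤ n²>0 l>0) q>0)
    nnm≤ : n * n * m ≤ W
    nnm≤ = begin
      n * n * m ≡⟨ lem′ n m ⟩
      m * (n ^ 2 * 1 * 1) ≤⟨ *-monoʳ-≤ m (*-mono-≤ (*-monoʳ-≤ (n ^ 2) l>0) q>0) ⟩
      W ∎
      where
      lem′ : ∀ n m → n * n * m ≡ m * (n * (n * 1) * 1 * 1)
      lem′ = solve-∀
    lem : ∀ a b d e f m s l q k → (m * (s * l * q) + (a * (m * (s * l * q)) + b * (m * (d * (s * l * q))))) * (e * (f * k))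
          ≡ (1 + a + b * d) * (e * f) * (m * s * l * k * q)
    lem = solve-∀

-- The machine knows only `q`, an upper bound of 1/ε; since then `1 ≤ ε * q`, the error `N / q` is
-- at most `ε * N`.
accurate-ℚ : ∀ {q q' N Z} (ε : ℚ) .{{_ : ℚ.Positive ε}} → q ≡ suc q' → (1/ ε) {{ℚ.pos⇒nonZero ε}} ℚ.≤ fromℕ q →
             q * N ≤ q * Z + N → (1ℚ ℚ.- ε) ℚ.* fromℕ N ℚ.≤ fromℕ Z
accurate-ℚ {q} {q'} {N} {Z} ε refl 1/ε≤ le = ℚ.*-cancelˡ-≤-pos (fromℕ q) {{positive}} (begin
  fq ℚ.* ((1ℚ ℚ.- ε) ℚ.* fN) ≡⟨ lem fq ε fN ⟩
  fq ℚ.* fN ℚ.- (ε ℚ.* fq) ℚ.* fN ≤⟨ ℚ.+-monoʳ-≤ (fq ℚ.* fN) (ℚ.neg-antimono-≤ (ℚ.*-monoʳ-≤-nonNeg fN {{fromℕ-nonNeg N}} 1≤εq)) ⟩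
  fq ℚ.* fN ℚ.- 1ℚ ℚ.* fN ≤⟨ ℚ.+-monoˡ-≤ (ℚ.- (1ℚ ℚ.* fN)) le′ ⟩
  fq ℚ.* fZ ℚ.+ fN ℚ.- 1ℚ ℚ.* fN ≡⟨ lem′ (fq ℚ.* fZ) fN ⟩
  fq ℚ.* fZ ∎)
  where
  open ℚ.≤-Reasoning
  fq fN fZ : ℚ
  fq = fromℕ q
  fN = fromℕ N
  fZ = fromℕ Z
  positive : ℚ.Positive (fromℕ q)
  positive = ℚ.positive (ℚ.<-≤-trans (ℚ.positive⁻¹ ((1/ ε) {{ℚ.pos⇒nonZero ε}}) {{ℚ.1/pos⇒pos ε}}) 1/ε≤)
  1≤εq : 1ℚ ℚ.≤ ε ℚ.* fq
  1≤εq = ℚ.≤-trans (ℚ.≤-reflexive (sym (ℚ.*-inverseʳ ε {{ℚ.pos⇒nonZero ε}}))) (ℚ.*-monoˡ-≤-nonNeg ε {{ℚ.pos⇒nonNeg ε}} 1/ε≤)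
  le′ : fq ℚ.* fN ℚ.≤ fq ℚ.* fZ ℚ.+ fN
  le′ = subst₂ ℚ._≤_ (fromℕ-* q N) (trans (fromℕ-+ (q * Z) N) (cong (ℚ._+ fN) (fromℕ-* q Z))) (fromℕ-mono le)
  lem : ∀ a e x → a ℚ.* ((1ℚ ℚ.- e) ℚ.* x) ≡ a ℚ.* x ℚ.- (e ℚ.* a) ℚ.* x
  lem = solve 3 (λ a e x → a :* ((con 1ℚ :- e) :* x) := a :* x :- (e :* a) :* x) refl
  lem′ : ∀ a x → a ℚ.+ x ℚ.- 1ℚ ℚ.* x ≡ a
  lem′ = solve 2 (λ a x → a :+ x :- con 1ℚ :* x := a) refl

-- Rounding 1/ε up to an integer at most doubles it, because 1/ε is at least 1. This doubles the
-- constant.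
timely-ℚ : ∀ c {T M q q'} (p : ℚ) → 1ℚ ℚ.≤ p → q ≡ suc q' → fromℕ q' ℚ.≤ p → T ≤ c + c * (M * q) →
           fromℕ T ℚ.≤ fromℕ (c + c) ℚ.* (1ℚ ℚ.+ fromℕ M ℚ.* p)
timely-ℚ c {T} {M} {q} {q'} p 1≤p refl q'≤ le = begin
  fromℕ T ≤⟨ fromℕ-mono le ⟩
  fromℕ (c + c * (M * q)) ≡⟨ trans (fromℕ-+ c (c * (M * q))) (cong (fc ℚ.+_) (trans (fromℕ-* c (M * q)) (cong (fc ℚ.*_) (fromℕ-* M q)))) ⟩
  fc ℚ.+ fc ℚ.* (fM ℚ.* fromℕ q) ≤⟨ ℚ.+-monoʳ-≤ fc (ℚ.*-monoˡ-≤-nonNeg fc {{fromℕ-nonNeg c}} (ℚ.*-monoˡ-≤-nonNeg fM {{fromℕ-nonNeg M}} q≤2p)) ⟩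
  fc ℚ.+ fc ℚ.* (fM ℚ.* (p ℚ.+ p)) ≡⟨ ℚ.+-identityʳ (fc ℚ.+ fc ℚ.* (fM ℚ.* (p ℚ.+ p))) ⟨
  fc ℚ.+ fc ℚ.* (fM ℚ.* (p ℚ.+ p)) ℚ.+ 0ℚ ≤⟨ ℚ.+-monoʳ-≤ (fc ℚ.+ fc ℚ.* (fM ℚ.* (p ℚ.+ p))) (fromℕ≥0 c) ⟩
  fc ℚ.+ fc ℚ.* (fM ℚ.* (p ℚ.+ p)) ℚ.+ fc ≡⟨ lem fc fM p ⟩
  (fc ℚ.+ fc) ℚ.* (1ℚ ℚ.+ fM ℚ.* p) ≡⟨ cong (ℚ._* (1ℚ ℚ.+ fM ℚ.* p)) (fromℕ-+ c c) ⟨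
  fromℕ (c + c) ℚ.* (1ℚ ℚ.+ fM ℚ.* p) ∎
  where
  open ℚ.≤-Reasoning
  fc fM : ℚ
  fc = fromℕ c
  fM = fromℕ M
  q≤2p : fromℕ q ℚ.≤ p ℚ.+ p
  q≤2p = subst (ℚ._≤ p ℚ.+ p) (sym (fromℕ-+ 1 q')) (ℚ.+-mono-≤ 1≤p q'≤)
  lem : ∀ c M p → c ℚ.+ c ℚ.* (M ℚ.* (p ℚ.+ p)) ℚ.+ c ≡ (c ℚ.+ c) ℚ.* (1ℚ ℚ.+ M ℚ.* p)
  lem = solve 3 (λ c M p → c :+ c :* (M :* (p :+ p)) :+ c := (c :+ c) :* (con 1ℚ :+ M :* p)) refl

-- Without parallel arcs an arc is determined by its ends. Arc numbers then have O(log n) bits, as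
-- the time for addressing them requires.
arcs≤ : ∀ {n m} → DAG n m → m ≤ n * n
arcs≤ G = injective⇒≤ {f = λ e → Fin.combine (src e) (tgt e)} λ {e} {f} eq →
  simple (combine-injectiveˡ (src e) (tgt e) (src f) (tgt f) eq) (combine-injectiveʳ (src e) (tgt e) (src f) (tgt f) eq)
  where
  open DAG G

-- If `m` is 0, the time bound is constant and leaves no room even for one pass over the vertices;
-- the count is then 1 or 0 according to whether `s` equals `t`.
noArcs : Program
noArcs = IF reg 2 ≤' reg 3 THEN (IF reg 3 ≤' reg 2 THEN (0 ≔ val (lit 1)) ELSE (0 ≔ val (lit 0))) ELSE (0 ≔ val (lit 0))

program : Program
program = IF reg 1 ≤' lit 0 THEN noArcs ELSE approximate

lookup-zeros : ∀ k x → lookup 0 (replicate k 0) x ≡ 0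
lookup-zeros zero    x       = refl
lookup-zeros (suc k) zero    = refl
lookup-zeros (suc k) (suc x) = lookup-zeros k x

module _ {n m : ℕ} (G : DAG n m) (s t : Fin n) (C : ℕ) (ε : ℚ) .{{_ : ℚ.Positive ε}} where

  private
    e₀ : Env
    e₀ = startEnv n m (toℕ s) (toℕ t) C ⌈1/ ε ⌉ (tails G) (heads G) (weights G)

  input≈ : input G s t C ε ≈ toState e₀
  input≈ = record { regs≈ = rs ; mem≈ = ms }
    where
    rs : ∀ x → inputRegs G s t C ε x ≡ regs (toState e₀) x
    rs 0 = refl
    rs 1 = refl
    rs 2 = refl
    rs 3 = refl
    rs 4 = refl
    rs 5 = refl
    rs (suc (suc (suc (suc (suc (suc x)))))) = sym (lookup-zeros 33 x)
    ms : ∀ a i → inputMem G s t C ε a i ≡ mem (toState e₀) a i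
    ms 0 i = refl
    ms 1 i = refl
    ms 2 i = refl
    ms 3 i = refl
    ms 4 i = refl
    ms 5 i = refl
    ms (suc (suc (suc (suc (suc (suc a)))))) i = refl

  private
    p : ℚ
    p = (1/ ε) {{ℚ.pos⇒nonZero ε}}

    Answer : .{{_ : NonZero n}} → ℕ → ℕ → Set
    Answer N c = Σ[ σ ∈ State ] Σ[ T ∈ ℕ ]
      (Runs n C program (input G s t C ε) σ T
       × (1ℚ ℚ.- ε) ℚ.* fromℕ N ℚ.≤ fromℕ (output σ)
       × output σ ≤ N
       × fromℕ T ℚ.≤ fromℕ c ℚ.* timeBound n m ε)

  module _ .{{_ : NonZero n}} (ε≤1 : ε ℚ.≤ 1ℚ) where
    private
      n>0 : 1 ≤ n
      n>0 = >-nonZero⁻¹ n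

      1≤p : 1ℚ ℚ.≤ p
      1≤p = begin
        1ℚ ≡⟨ ℚ.*-inverseʳ ε {{ℚ.pos⇒nonZero ε}} ⟨
        ε ℚ.* p ≤⟨ ℚ.*-monoʳ-≤-nonNeg p {{ℚ.pos⇒nonNeg p {{ℚ.1/pos⇒pos ε}}}} ε≤1 ⟩
        1ℚ ℚ.* p ≡⟨ ℚ.*-identityˡ p ⟩
        p ∎
        where open ℚ.≤-Reasoning

      N : ℕ
      N = count G t C n (toℕ s) 1

    answer : ∀ c {k u V} (word-V : Timed.wordTime n C V ≤ u) (number-C : Timed.numberTime n C (suc C) ≤ u) →
      Cost.Reach n C V u word-V number-C program e₀ k
        (λ e → regs (toState e) 0 ≤ N × ⌈1/ ε ⌉ * N ≤ ⌈1/ ε ⌉ * regs (toState e) 0 + N) →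
      (∀ {T} → T ≤ k * (5 * u) → T ≤ c + c * (m * n ^ 2 * log[m/n] n m ε * ⌈log[1/ε]/log[n]⌉ n m ε * ⌈1/ ε ⌉)) →
      Answer N (c + c)
    answer c {k} {u} {V} word-V number-C r time =
      conclude (Cost.exec {n} {C} {V} {u} {word-V} {number-C} r (input G s t C ε) input≈) (ceiling-spec p (ℚ.positive⁻¹ p {{ℚ.1/pos⇒pos ε}}))
      where
      conclude : Σ[ σ ∈ State ] Σ[ T ∈ ℕ ] Σ[ e ∈ Env ] (Runs n C program (input G s t C ε) σ T × T ≤ k * (5 * u) × σ ≈ toState e
                   × regs (toState e) 0 ≤ N × ⌈1/ ε ⌉ * N ≤ ⌈1/ ε ⌉ * regs (toState e) 0 + N) →
                 ∃[ q ] (⌈1/ ε ⌉ ≡ suc q × p ℚ.≤ fromℕ (suc q) × fromℕ q ℚ.≤ p) → Answer N (c + c)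
      conclude (σ , T , e , run , T≤ , eq , ≤N , acc) (q , q≡ , p≤ , q≤p) =
        σ , T , run
        , accurate-ℚ ε q≡ (subst (λ q → p ℚ.≤ fromℕ q) (sym q≡) p≤) (subst (λ z → ⌈1/ ε ⌉ * N ≤ ⌈1/ ε ⌉ * z + N) (sym (_≈_.regs≈ eq 0)) acc)
        , ≤-trans (≤-reflexive (_≈_.regs≈ eq 0)) ≤N
        , timely-ℚ c {M = m * n ^ 2 * log[m/n] n m ε * ⌈log[1/ε]/log[n]⌉ n m ε} p 1≤p q≡ q≤p (time T≤)

    no-arcs : m ≡ 0 → Answer N (factor + factor)
    no-arcs m≡0 = answer factor {4} {V = n} word-V number-C
      (branch (tt , tt , inj₂ (word z≤n)) (λ _ → run) (λ ¬le → contradiction (≤-reflexive m≡0) ¬le))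
      -- Four units of `5 * 3` each make the 60 of `factor≥`.
      λ {T} le → ≤-trans le (≤-trans factor≥ (m≤m+n factor _))
      where
      word-V = word-n n C
      number-C = number-cap n C
      open Cost n C n 3 word-V number-C
      Good : ℕ → Set
      Good z = z ≤ N × ⌈1/ ε ⌉ * N ≤ ⌈1/ ε ⌉ * z + N
      good : ∀ {z} → N ≡ z → Good z
      good refl = ≤-refl , m≤m+n _ N
      N-no : toℕ s ≢ toℕ t → N ≡ 0
      N-no s≢t = trans (total-step G t C n>0 s≢t 1) (cong (λ k → sum k λ e → select (tails G e) (toℕ s) (count G t C n (heads G e) (1 + weights G e))) m≡0)
      N-yes : toℕ s ≡ toℕ t → N ≡ 1
      N-yes eq = trans (cong (λ u → count G t C n u 1) eq) (total-target G t C n>0 (s≤s z≤n))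
      run : Reach noArcs e₀ 3 (λ e → Good (regs (toState e) 0))
      run = branch (tt , tt , inj₁ (word (<⇒≤ (toℕ<n s))))
        (λ le → branch (tt , tt , inj₁ (word (<⇒≤ (toℕ<n t))))
          (λ ge → set (tt , word n>0) (good (N-yes (≤-antisym le ge))))
          (λ ¬ge → set (tt , word z≤n) (good (N-no λ eq → ¬ge (≤-reflexive (sym eq))))))
        (λ ¬le → relax (n≤1+n 1) (set (tt , word z≤n) (good (N-no λ eq → ¬le (≤-reflexive eq)))))

    some-arcs : ∀ {β₁ β₂ κ α} → 1 ≤ m → Doublings 1 n β₁ → Doublings 1 ⌈1/ ε ⌉ β₂ → Doublings n m κ →
                Doublings 1 (suc (n + κ * n)) α → Answer N (factor + factor)
    some-arcs {β₁} {β₂} {κ} {α} m>0 db₁ db₂ dbX dbA = answer factor {V = B.V} word-V number-C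
      (branch (tt , tt , inj₂ (word z≤n)) (λ le → contradiction le (<⇒≱ m>0)) (λ _ → R.approximate-run))
      λ {T} le → ≤-trans (B.time-bound le) (m≤n+m _ factor)
      where
      q k : ℕ
      q = ⌈1/ ε ⌉
      k = ⌈log[1/ε]/log[n]⌉ n m ε
      q>0 : 1 ≤ q
      q>0 with ceiling-spec p (ℚ.positive⁻¹ p {{ℚ.1/pos⇒pos ε}})
      ... | q' , q≡ , _ = ≤-trans (s≤s z≤n) (≤-reflexive (sym q≡))
      q≤ : q ≤ (n ⊔ 2) ^ k
      q≤ = ≤-trans (⌈log⌉-upper {n ⊔ 2} {q} (m≤n⊔m n 2)) (^-monoʳ-≤ (n ⊔ 2) {{>-nonZero (≤-trans (s≤s z≤n) (m≤n⊔m n 2))}} (m≤n⊔m 1 ⌈log[ n ⊔ 2 ] q ⌉))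
      l≤m : log[m/n] n m ε ≤ m
      l≤m = ⊔-lub m>0 (≤-trans (log≤ (m / n)) (m/n≤m m n))
      l≥ : m / n < 2 ^ suc (log[m/n] n m ε)
      l≥ = <-≤-trans (<2^log (m / n)) (^-monoʳ-≤ 2 (s≤s (m≤n⊔m 1 ⌊log₂ m / n ⌋)))
      module B = Bounds n m q k C n>0 m>0 q>0 (m≤m⊔n 1 ⌈log[ n ⊔ 2 ] q ⌉) (arcs≤ G) q≤ (log[m/n] n m ε) (m≤m⊔n 1 ⌊log₂ m / n ⌋) l≥ l≤m db₁ db₂ dbX dbA
      word-V = B.word-V
      number-C = B.number-C
      open Cost n C B.V (22 * k) word-V number-C
      inst : Instance
      inst = record
        { n = n ; C = C ; V = B.V ; u = 22 * k ; word-V = word-V ; number-C = number-C ; m = m ; s = toℕ s ; t = toℕ t ; q = q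
        ; β₁ = β₁ ; β₂ = β₂ ; κ = κ ; α = α ; sr = tails G ; tg = heads G ; wt = weights G ; RR = count G t C n ; ht = height G
        ; n>0 = n>0 ; m>0 = m>0 ; s<n = toℕ<n s ; t<n = toℕ<n t ; db₁ = db₁ ; db₂ = db₂ ; dbX = dbX ; dbA = dbA
        ; tg<n = heads< G ; sr<n = tails< G ; ht-arc = height-arc G ; ht<n = height< G
        ; rec = total-step G t C n>0 ; RR-t = total-target G t C n>0 ; RR-t′ = total-target′ G t C n>0
        ; N≤ = count≤ G t C dbX (toℕ<n s) ; V≥ = ≤-refl }
      module R = MainRun inst

    approximation : Σ[ N ∈ ℕ ] Σ[ σ ∈ State ] Σ[ T ∈ ℕ ]
      ((Fin N ↔ DAG.PathWithin G s t C)
       × Runs n C program (input G s t C ε) σ T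
       × (1ℚ ℚ.- ε) ℚ.* fromℕ N ℚ.≤ fromℕ (output σ)
       × output σ ≤ N
       × fromℕ T ℚ.≤ fromℕ (factor + factor) ℚ.* timeBound n m ε)
    approximation = N , proj₁ found , proj₁ (proj₂ found) , paths-within G t C s , proj₂ (proj₂ found)
      where
      by : Dec (m ≡ 0) → Answer N (factor + factor)
      by (yes m≡0) = no-arcs m≡0
      by (no m≢0)  = some-arcs (n≢0⇒n>0 m≢0) (proj₂ (doublings n ≤-refl)) (proj₂ (doublings ⌈1/ ε ⌉ ≤-refl))
                       (proj₂ (doublings m n>0)) (proj₂ (doublings _ ≤-refl))
      found : Answer N (factor + factor)
      found = by (m ≟ 0)

theorem5 : Σ[ P ∈ Program ] Σ[ c ∈ ℕ ]
    ((n m : ℕ) .{{_ : NonZero n}} (G : DAG n m) (s t : Fin n) (C : ℕ)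
    (ε : ℚ) .{{_ : ℚ.Positive ε}} → ε ℚ.≤ 1ℚ →
    Σ[ N ∈ ℕ ] Σ[ σ ∈ State ] Σ[ T ∈ ℕ ]
    (Fin N ↔ DAG.PathWithin G s t C)
    × Runs n C P (input G s t C ε) σ T
    × (1ℚ ℚ.- ε) ℚ.* fromℕ N ℚ.≤ fromℕ (output σ)
    × output σ ≤ N
    × fromℕ T ℚ.≤ fromℕ c ℚ.* timeBound n m ε)
theorem5 = program , factor + factor , λ n m G s t C ε ε≤1 → approximation G s t C ε ε≤1
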